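{- Let $a\ge2$ and $b\ge1$ be integers, consider the fence $\breve F(a,b,a)$, and define $$g=\gcd(a,b),\quad \bar a=a/g,\quad \bar b=b/g,\quad \ell=\operatorname{lcm}(a,b).$$ Let $m$ be the smallest positive integer such that $$m\bar a=q\bar b+1$$ for some positive integer $q$ (such $m$ exists since $\bar a,\bar b$ are relatively prime), and let $q$ be the corresponding integer. Then the orbits of rowmotion on $\breve F(a,b,a)$ can be partitioned by length into three sets $\mathcal S,\mathcal M,\mathcal L$ having the following properties. (a) We have $$\#\mathcal S=\bar a(g-1)^2,\quad \#\mathcal M=q,\quad \#\mathcal L=\bar a-q,$$ and $$\#\mathcal O=\begin{cases}\ell&\text{if }\mathcal O\in\mathcal S,\\ a(2b-2\bar b+m)+g&\text{if }\mathcal O\in\mathcal M,\\ a(2b-\bar b+m)+g&\text{if }\mathcal O\in\mathcal L.\end{cases}$$ (b) For rowmotion on antichains, $\chi$ is homometric. (c) For rowmotion on ideals, $\hat\chi$ is $n/2$-mesic where $n=\#\breve F(a,b,a)=2a+b-1$.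
   Context: The fence $\breve F(a,b,a)$ is the poset on $x_1,\dots,x_{2a+b-1}$ with covering relations $x_1\lhd\cdots\lhd x_a\rhd x_{a+1}\rhd\cdots\rhd x_{a+b}\lhd x_{a+b+1}\lhd\cdots\lhd x_{2a+b-1}$. For a finite poset $P$, rowmotion on antichains is the bijection $\rho$ on the set of antichains sending $A$ to the set of minimal elements of $P\setminus I$, where $I$ is the (lower order) ideal generated by $A$. Rowmotion on ideals is the bijection $\hat\rho$ on the set of ideals sending $I$ to the ideal generated by the minimal elements of $P\setminus I$. Orbits are those of the cyclic groups generated by these maps; $A\mapsto$ (ideal generated by $A$) gives a size-preserving bijection between orbits of $\rho$ and of $\hat\rho$. The length of an orbit $\mathcal O$ is its size $\#\mathcal O$. The statistics are $\chi(A)=\#A$ on antichains and $\hat\chi(I)=\#I$ on ideals, and for a statistic $\mathrm{st}$, $\mathrm{st}(\mathcal O)=\sum_{y\in\mathcal O}\mathrm{st}(y)$. A statistic is $d$-mesic if $\mathrm{st}(\mathcal O)/\#\mathcal O=d$ for every orbit $\mathcal O$; it is homometric if $\#\mathcal O_1=\#\mathcal O_2$ implies $\mathrm{st}(\mathcal O_1)=\mathrm{st}(\mathcal O_2)$ for all orbits $\mathcal O_1,\mathcal O_2$. -}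

module Defs where

open import Data.Fin.Base using (Fin; toℕ; fromℕ<)
open import Data.Fin.Properties using (toℕ<n; toℕ-injective; toℕ-fromℕ<; any?; all?)
  renaming (_≟_ to _≟ᶠ_)
open import Data.Fin.Subset using (Subset; _∈_; ∁; ∣_∣)
open import Data.Fin.Subset.Properties using (_∈?_)
open import Data.Integer.Base using (+_)
open import Data.Irrelevant using ([_])
open import Data.List.Base using (map)
open import Data.List.Membership.Propositional using () renaming (_∈_ to _∈ˡ_)
open import Data.List.NonEmpty.Base using (List⁺; head; toList; length)
open import Data.List.Relation.Binary.BagAndSetEquality using (set; [_]-Equality)
open import Data.List.Relation.Unary.Unique.Propositional using (Unique)
open import Data.Nat.Base
open import Data.Nat.GCD using (gcd; gcd[m,n]≢0)
open import Data.Nat.ListAction using (sum)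
open import Data.Nat.Properties
open import Data.Product.Base using (_×_; _,_; proj₁; proj₂; ∃; ∃-syntax)
open import Data.Rational.Base using (ℚ) renaming (_/_ to _/ℚ_)
open import Data.Refinement using (Refinement; value; _,_)
open import Data.Sum.Base using (_⊎_; inj₁; inj₂)
open import Data.Vec.Base using (tabulate)
open import Data.Vec.Properties using (lookup∘tabulate; []=⇒lookup; lookup⇒[]=)
open import Function.Base using (_∘_; flip)
open import Function.Bundles using (_⇔_; Bijection)
open import Level using (0ℓ)
open import Relation.Binary.Bundles using (Setoid)
open import Relation.Binary.Construct.Closure.Equivalence using (EqClosure)
open import Relation.Binary.Construct.Closure.ReflexiveTransitive
  using (Star; ε; _◅_; _◅◅_; reverse)
import Relation.Binary.Construct.On as On
open import Relation.Binary.Core using (Rel)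
open import Relation.Binary.Definitions using () renaming (Decidable to Decidable₂)
open import Relation.Binary.PropositionalEquality
  using (_≡_; refl; sym; trans; cong; subst; isEquivalence; setoid)
open import Relation.Binary.Structures using (IsDecPartialOrder)
open import Relation.Nullary using (¬_; does; yes; no; contradiction)
open import Relation.Nullary.Decidable
  using (map′; _×-dec_; _⊎-dec_; _→-dec_; dec-true)
open import Relation.Unary using (Pred; Decidable; Universal; _∪_; _⊥_)

comprehension : ∀ {n} {P : Pred (Fin n) 0ℓ} → Decidable P → Subset n
comprehension P? = tabulate (does ∘ P?)

module _ {n} {P : Pred (Fin n) 0ℓ} (P? : Decidable P) where

  ∈-comprehension⁺ : ∀ {x} → P x → x ∈ comprehension P?
  ∈-comprehension⁺ {x} px = lookup⇒[]= x _
    (trans (lookup∘tabulate (does ∘ P?) x) (dec-true (P? x) px))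

  ∈-comprehension⁻ : ∀ {x} → x ∈ comprehension P? → P x
  ∈-comprehension⁻ {x} x∈
    with P? x | trans (sym (lookup∘tabulate (does ∘ P?) x)) ([]=⇒lookup x∈)
  ... | yes px | _ = px
  ... | no _   | ()

module Rowmotion {n} {_⊑_ : Rel (Fin n) 0ℓ} (poset : IsDecPartialOrder _≡_ _⊑_) where

  open IsDecPartialOrder poset using () renaming (_≤?_ to _⊑?_; trans to ⊑-trans)

  IsAntichain : Pred (Subset n) 0ℓ
  IsAntichain A = ∀ x y → x ∈ A → y ∈ A → x ⊑ y → x ≡ y

  IsIdeal : Pred (Subset n) 0ℓ
  IsIdeal I = ∀ x y → y ∈ I → x ⊑ y → x ∈ I

  Antichain : Set
  Antichain = Refinement (Subset n) IsAntichain

  Ideal : Set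
  Ideal = Refinement (Subset n) IsIdeal

  generated? : ∀ A → Decidable (λ x → ∃[ y ] y ∈ A × x ⊑ y)
  generated? A x = any? λ y → (y ∈? A) ×-dec (x ⊑? y)

  minimal? : ∀ A → Decidable (λ x → x ∈ A × (∀ y → y ∈ A → y ⊑ x → y ≡ x))
  minimal? A x = (x ∈? A) ×-dec all? λ y → (y ∈? A) →-dec ((y ⊑? x) →-dec (y ≟ᶠ x))

  generatedIdeal : Subset n → Subset n
  generatedIdeal A = comprehension (generated? A)

  minimals : Subset n → Subset n
  minimals A = comprehension (minimal? A)

  generatedIdeal-isIdeal : ∀ A → IsIdeal (generatedIdeal A)
  generatedIdeal-isIdeal A x y y∈ x⊑y with ∈-comprehension⁻ (generated? A) y∈
  ... | z , z∈A , y⊑z = ∈-comprehension⁺ (generated? A) (z , z∈A , ⊑-trans x⊑y y⊑z)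

  minimals-isAntichain : ∀ A → IsAntichain (minimals A)
  minimals-isAntichain A x y x∈ y∈ x⊑y =
    proj₂ (∈-comprehension⁻ (minimal? A) y∈) x
      (proj₁ (∈-comprehension⁻ (minimal? A) x∈)) x⊑y

  ρ : Antichain → Antichain
  ρ (A , _) = minimals (∁ (generatedIdeal A)) , [ minimals-isAntichain _ ]

  ρ̂ : Ideal → Ideal
  ρ̂ (I , _) = generatedIdeal (minimals (∁ I)) , [ generatedIdeal-isIdeal _ ]

  χ : Antichain → ℕ
  χ = ∣_∣ ∘ value

  χ̂ : Ideal → ℕ
  χ̂ = ∣_∣ ∘ value

-- When f is a bijection, x and y are related exactly when y = fᵏ x for
-- some integer k, since each link of the closure applies f or f⁻¹.
SameOrbit : {X : Set} → (X → X) → Rel X 0ℓ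
SameOrbit f = EqClosure (λ x y → f x ≡ y)

record Orbit {X : Set} (f : X → X) : Set where
  field
    elements : List⁺ X
    unique   : Unique (toList elements)
    complete : ∀ y → y ∈ˡ toList elements ⇔ SameOrbit f (head elements) y

  size : ℕ
  size = length elements

  total : (X → ℕ) → ℕ
  total st = sum (map st (toList elements))

open Orbit public using (size; total)

-- The elements of an orbit are listed in no particular order, so orbits are
-- equal when they are equal as sets.
orbits : {X : Set} → (X → X) → Setoid 0ℓ 0ℓ
orbits {X} f = On.setoid ([ set ]-Equality X) (toList ∘ Orbit.elements {f = f})

Mesic : {X : Set} → (X → X) → (X → ℕ) → ℚ → Set
Mesic f st d = (O : Orbit f) → (+ total O st) /ℚ size O ≡ d

Homometric : {X : Set} → (X → X) → (X → ℕ) → Set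
Homometric f st = (O₁ O₂ : Orbit f) → size O₁ ≡ size O₂ → total O₁ st ≡ total O₂ st

infix 4 #_≐_

#_≐_ : {X : Set} {f : X → X} → Pred (Orbit f) 0ℓ → ℕ → Set
#_≐_ {f = f} 𝒞 k =
  Bijection (setoid (Fin k)) (On.setoid {B = ∃ 𝒞} (orbits f) proj₁)

-- Two orbits lie in the same part if and only if they have the same length.
-- Parts may be empty.
record IsPartitionByLength {X : Set} {f : X → X} (𝒮 ℳ ℒ : Pred (Orbit f) 0ℓ) : Set where
  field
    cover     : Universal (𝒮 ∪ ℳ ∪ ℒ)
    disjoint₁ : 𝒮 ⊥ ℳ
    disjoint₂ : 𝒮 ⊥ ℒ
    disjoint₃ : ℳ ⊥ ℒ
    uniform   : ∀ O₁ O₂ →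
                ((𝒮 O₁ × 𝒮 O₂) ⊎ (ℳ O₁ × ℳ O₂) ⊎ (ℒ O₁ × ℒ O₂)) ⇔ size O₁ ≡ size O₂

#fence : ℕ → ℕ → ℕ
#fence a b = 2 * a + b ∸ 1

-- The order is generated by x₁ ⋖ ⋯ ⋖ x_a ⋗ ⋯ ⋗ x_{a+b} ⋖ ⋯ ⋖ x_{2a+b-1}; the edge
-- between x_i and x_{i+1} goes up when Rise i and down when Fall i.
module Fence (a b : ℕ) where

  -- x : Fin (#fence a b) stands for the element x_i with i = index x.
  index : Fin (#fence a b) → ℕ
  index x = suc (toℕ x)

  Rise Fall : Pred ℕ 0ℓ
  Rise i = i < a ⊎ a + b ≤ i
  Fall i = a ≤ i × i < a + b

  infix 4 _⋖_ _≼_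

  data _⋖_ (x y : Fin (#fence a b)) : Set where
    rise : Rise (index x) → index y ≡ suc (index x) → x ⋖ y
    fall : Fall (index y) → index x ≡ suc (index y) → x ⋖ y

  _≼_ : Rel (Fin (#fence a b)) 0ℓ
  _≼_ = Star _⋖_

  module Runs where

    Run : Pred ℕ 0ℓ → Rel ℕ 0ℓ
    Run E i j = i ≤ j × (∀ {k} → k < j → i ≤ k → E k)

    clash : ∀ {i} → Rise i → ¬ Fall i
    clash (inj₁ i<a)   (a≤i , _)   = <⇒≱ i<a a≤i
    clash (inj₂ a+b≤i) (_ , i<a+b) = <⇒≱ i<a+b a+b≤i

    run-refl : ∀ {E i} → Run E i i
    run-refl = ≤-refl , λ k<i i≤k → contradiction i≤k (<⇒≱ k<i)

    consˡ : ∀ {E i j} → E i → Run E (suc i) j → Run E i j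
    consˡ {E} {i} {j} e (i<j , r) = <⇒≤ i<j , go
      where
      go : ∀ {k} → k < j → i ≤ k → E k
      go k<j i≤k with m≤n⇒m<n∨m≡n i≤k
      ... | inj₁ i<k  = r k<j i<k
      ... | inj₂ refl = e

    consʳ : ∀ {E i j} → E j → Run E i j → Run E i (suc j)
    consʳ {E} {i} {j} e (i≤j , r) = m≤n⇒m≤1+n i≤j , go
      where
      go : ∀ {k} → k < suc j → i ≤ k → E k
      go (s≤s k≤j) i≤k with m≤n⇒m<n∨m≡n k≤j
      ... | inj₁ k<j  = r k<j i≤k
      ... | inj₂ refl = e

    run? : ∀ {E} → Decidable E → Decidable₂ (Run E)
    run? E? i j = (i ≤? j) ×-dec allUpTo? (λ k → (i ≤? k) →-dec E? k) j

    rise? : Decidable Rise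
    rise? i = (i <? a) ⊎-dec (a + b ≤? i)

    fall? : Decidable Fall
    fall? i = (a ≤? i) ×-dec (i <? a + b)

    Monotone : Rel (Fin (#fence a b)) 0ℓ
    Monotone x y = Run Rise (index x) (index y) ⊎ Run Fall (index y) (index x)

    ≼⇒monotone : ∀ {x y} → x ≼ y → Monotone x y
    ≼⇒monotone ε = inj₁ run-refl
    ≼⇒monotone (rise r eq ◅ z≼y) with ≼⇒monotone z≼y
    ... | inj₁ run rewrite eq = inj₁ (consˡ r run)
    ... | inj₂ (y≤z , run) rewrite eq with m≤n⇒m<n∨m≡n y≤z
    ...   | inj₁ (s≤s y≤x) = contradiction (run ≤-refl y≤x) (clash r)
    ...   | inj₂ y≡1+x rewrite y≡1+x = inj₁ (consˡ r run-refl)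
    ≼⇒monotone (fall f eq ◅ z≼y) with ≼⇒monotone z≼y
    ... | inj₂ run rewrite eq = inj₂ (consʳ f run)
    ... | inj₁ (z≤y , run) rewrite eq with m≤n⇒m<n∨m≡n z≤y
    ...   | inj₁ z<y = contradiction f (clash (run z<y ≤-refl))
    ...   | inj₂ z≡y rewrite sym z≡y = inj₂ (consʳ f run-refl)

    climb : ∀ {E} {R : Rel (Fin (#fence a b)) 0ℓ} →
            (∀ {x y} → E (index x) → index y ≡ suc (index x) → R x y) →
            ∀ d x y → index y ≡ d + index x → Run E (index x) (index y) → Star R x y
    climb step zero x y eq _ with toℕ-injective (suc-injective eq)
    ... | refl = ε
    climb {E} step (suc d) x y eq (x≤y , run) =
      step (run x<y ≤-refl) z≡1+x ◅
      climb {E} step d z y y≡d+z (subst (_≤ index y) (sym z≡1+x) x<y ,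
        λ {k} k<y z≤k → run k<y (<⇒≤ (subst (_≤ k) z≡1+x z≤k)))
      where
      x<y : index x < index y
      x<y = subst (index x <_) (sym eq) (s≤s (m≤n+m (index x) d))
      x<n : index x < #fence a b
      x<n = <-≤-trans x<y (toℕ<n y)
      z : Fin (#fence a b)
      z = fromℕ< x<n
      z≡1+x : index z ≡ suc (index x)
      z≡1+x = cong suc (toℕ-fromℕ< x<n)
      y≡d+z : index y ≡ d + index z
      y≡d+z = trans eq (sym (trans (cong (λ i → d + i) z≡1+x) (+-suc d (index x))))

    monotone⇒≼ : ∀ {x y} → Monotone x y → x ≼ y
    monotone⇒≼ {x} {y} (inj₁ run) =
      climb {Rise} rise (index y ∸ index x) x y (sym (m∸n+n≡m (proj₁ run))) run
    monotone⇒≼ {x} {y} (inj₂ run) =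
      reverse {T = flip _⋖_} {U = _⋖_} (λ e → e)
        (climb {Fall} fall (index x ∸ index y) y x (sym (m∸n+n≡m (proj₁ run))) run)

    index-injective : ∀ {x y} → index x ≡ index y → x ≡ y
    index-injective = toℕ-injective ∘ suc-injective

    run-clash : ∀ {i j} → Run Rise i j → Run Fall i j → i ≡ j
    run-clash (i≤j , r) (_ , f) with m≤n⇒m<n∨m≡n i≤j
    ... | inj₁ i<j = contradiction (f i<j ≤-refl) (clash (r i<j ≤-refl))
    ... | inj₂ i≡j = i≡j

    ≼-antisym : ∀ {x y} → x ≼ y → y ≼ x → x ≡ y
    ≼-antisym x≼y y≼x with ≼⇒monotone x≼y | ≼⇒monotone y≼x
    ... | inj₁ r | inj₁ s = index-injective (≤-antisym (proj₁ r) (proj₁ s))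
    ... | inj₁ r | inj₂ s = index-injective (run-clash r s)
    ... | inj₂ r | inj₁ s = index-injective (sym (run-clash s r))
    ... | inj₂ r | inj₂ s = index-injective (≤-antisym (proj₁ s) (proj₁ r))

  open Runs

  _≼?_ : Decidable₂ _≼_
  x ≼? y = map′ monotone⇒≼ ≼⇒monotone
    (run? rise? (index x) (index y) ⊎-dec run? fall? (index y) (index x))

  ≼-isDecPartialOrder : IsDecPartialOrder _≡_ _≼_
  ≼-isDecPartialOrder = record
    { isPartialOrder = record
      { isPreorder = record
        { isEquivalence = isEquivalence
        ; reflexive     = λ where refl → ε
        ; trans         = _◅◅_
        }
      ; antisym = ≼-antisym
      }
    ; _≟_  = _≟ᶠ_
    ; _≤?_ = _≼?_
    }

  open Rowmotion ≼-isDecPartialOrder public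

gcd-nonZero : ∀ a {b} → 1 ≤ b → NonZero (gcd a b)
gcd-nonZero a {b@(suc _)} _ = ≢-nonZero (gcd[m,n]≢0 a b (inj₂ λ ()))

IsSmallest : Pred ℕ 0ℓ → Pred ℕ 0ℓ
IsSmallest P m = P m × (∀ k → P k → m ≤ k)

{-# OPTIONS --safe #-}

-- Recording how far an ideal reaches up the left, middle and right chain turns
-- rowmotion into three clocks of periods a, b, a that advance together, with two
-- exceptions.  When the left and middle clocks complete a turn simultaneously, the
-- peak takes one extra step on which only the right clock advances; when the middle
-- and right clocks do, the valley is missing for one extra step on which only the
-- left clock advances.  Sampled once per turn of the middle clock this is the map
-- (x , y) ↦ (x + b , y + b) on (ℤ/a)², followed by y ↦ y + 1 if x = 0 and then by
-- x ↦ x + 1 if y = 0.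
--
-- Since g divides b, the residues of x and y modulo g change only at these extra
-- steps.  If both residues are nonzero there are none, and the orbit closes after
-- ā turns.  Otherwise visits to the peak and to the missing valley alternate in
-- blocks of g visits, ā turns apart within a block.  If s turns lead from a valley
-- block to the next peak block and s′ turns back, then 1 ≤ s ≤ ā, 0 ≤ s′ < ā and
-- s + s′ ≡ q modulo ā, so s + s′ is q (q orbits) or q + ā (ā − q orbits).
--
-- Up to a coboundary, χ and χ̂ are constant on each of the three kinds of states, so
-- their totals over an orbit depend only on the number of turns and of visits.
module Submission where

open import Defs
open import Data.Bool.Base using (Bool; true; false; if_then_else_; _∧_)
open import Data.Bool.Properties using (∧-identityʳ)
open import Data.Empty using (⊥)
open import Data.Fin.Base using (Fin; zero; suc; toℕ; fromℕ<)
open import Data.Fin.Properties using (toℕ-injective; toℕ-fromℕ<; toℕ<n; injective⇒≤; any?; all?; punchOut-injective)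
  renaming (_≟_ to _≟ᶠ_)
open import Data.Fin.Properties using (+↔⊎; *↔×)
open import Data.Fin.Subset using (Subset; _∈_; _⊆_; ∁; ∣_∣)
open import Data.Fin.Subset.Properties using (⊆-antisym; x∈∁p⇒x∉p; x∉p⇒x∈∁p; _∈?_)
import Data.Integer.Properties as ℤ
open import Data.Irrelevant using ([_])
open import Data.List.Base as List using (List; []; _∷_; applyUpTo; map)
open import Data.List.Membership.Propositional using () renaming (_∈_ to _∈ˡ_)
open import Data.List.Membership.Propositional.Properties using (∈-applyUpTo⁺; ∈-applyUpTo⁻)
open import Data.List.Membership.Propositional.Properties.WithK using (unique∧set⇒bag)
open import Data.List.NonEmpty.Base using (_∷_; toList; head; tail)
open import Data.List.Properties using (length-applyUpTo)
open import Data.List.Relation.Binary.BagAndSetEquality using (∼bag⇒↭)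
open import Data.List.Relation.Binary.Permutation.Propositional using (_↭_)
open import Data.List.Relation.Binary.Permutation.Propositional.Properties using (↭-length; map⁺)
open import Data.List.Relation.Unary.Any using (here)
open import Data.List.Relation.Unary.Unique.Propositional using (Unique)
open import Data.List.Relation.Unary.Unique.Propositional.Properties using (applyUpTo⁺₁)
open import Data.Nat.Base
open import Data.Nat.Divisibility
open import Data.Nat.DivMod using (_mod_; m≡m%n+[m/n]*n; [m+kn]%n≡m%n; m<n⇒m%n≡m; m%n<n; m/n*n≡m)
open import Data.Nat.GCD using (gcd; gcd[m,n]∣m; gcd[m,n]∣n)
open import Data.Nat.GeneralisedArithmetic using (iterate)
open import Data.Nat.LCM using (lcm; gcd*lcm)
open import Data.Nat.ListAction using (sum)
open import Data.Nat.ListAction.Properties using (sum-↭)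
open import Data.Nat.Properties
open import Data.Nat.Tactic.RingSolver using (solve-∀)
open import Data.Product.Base using (Σ; Σ-syntax; ∃-syntax; _×_; _,_; proj₁; proj₂)
open import Data.Product.Function.NonDependent.Propositional using (_×-↔_)
open import Data.Rational.Base using () renaming (_/_ to _/ℚ_)
open import Data.Rational.Properties using (fromℚᵘ-cong)
open import Data.Rational.Unnormalised.Base using (mkℚᵘ; *≡*)
open import Data.Refinement using (value; _,_)
open import Data.Sum.Base using (_⊎_; inj₁; inj₂)
open import Data.Sum.Function.Propositional using (_⊎-↔_)
open import Data.Vec.Base using (tabulate)
open import Function.Base using (_∘_)
open import Function.Bundles using (_⇔_; mk⇔; Equivalence; _↔_; Inverse; Injection)
open import Function.Construct.Identity using (↔-id)
open import Function.Definitions using (Injective)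
open import Function.Properties.Inverse using (↔-trans; ↔-sym; Inverse⇒Injection)
open import Level using (0ℓ)
open import Relation.Binary.Construct.Closure.Equivalence using (symmetric)
open import Relation.Binary.Construct.Closure.ReflexiveTransitive using (Star; ε; _◅_; _◅◅_)
open import Relation.Binary.Construct.Closure.Symmetric using (fwd; bwd)
open import Relation.Binary.Core using (Rel)
open import Relation.Binary.PropositionalEquality
open import Relation.Binary.Structures using (IsDecPartialOrder)
open import Relation.Nullary using (¬_; contradiction; yes; no; does; Dec)
open import Relation.Nullary.Decidable using (_×-dec_; _→-dec_; dec-true; dec-false; recompute)
open import Relation.Unary using (Pred; Decidable)

-- Cycle decompositions

-- The congruence s + s′ ≡ q comes from scaling the equation for m by g: q b + g = m a, so the shift
-- by g that a block of visits leaves on a clock is undone by q turns, and ā is the order of b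
-- modulo a. The ranges of s and s′ differ because the peak is tested before the valley within a
-- turn: a visit to the valley may follow the last visit to the peak at once, whereas a visit to the
-- peak always needs a further turn. Minimality of m serves to give q ≤ ā, so that both families of
-- long orbits have sensible sizes.
--
-- The obstacle is to show that the listed orbits are distinct and do not close earlier. This is
-- never checked directly: it is proved that each closes after its stated length and that together
-- they cover all states. The lengths add up to a b a + 2 a, the number of states, and the
-- pigeonhole principle does the rest.
--
-- The bound a ≥ 2 separates the first two lengths when g = 1.

module _ {X : Set} (f : X → X) where

  iterate-+ : ∀ x m n → iterate f x (m + n) ≡ iterate f (iterate f x m) n
  iterate-+ x zero    n = refl
  iterate-+ x (suc m) n = iterate-+ (f x) m n

  iterate-suc : ∀ x n → iterate f x (suc n) ≡ f (iterate f x n)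
  iterate-suc x zero    = refl
  iterate-suc x (suc n) = iterate-suc (f x) n

  sumAlong : (X → ℕ) → X → ℕ → ℕ
  sumAlong st x zero    = 0
  sumAlong st x (suc n) = st x + sumAlong st (f x) n

  sumAlong-+ : ∀ st x m n →
               sumAlong st x (m + n) ≡ sumAlong st x m + sumAlong st (iterate f x m) n
  sumAlong-+ st x zero    n = refl
  sumAlong-+ st x (suc m) n = trans (cong (st x +_) (sumAlong-+ st (f x) m n))
    (sym (+-assoc (st x) _ _))

  sumAlong-applyUpTo : ∀ st x n → sum (map st (applyUpTo (iterate f x) n)) ≡ sumAlong st x n
  sumAlong-applyUpTo st x zero    = refl
  sumAlong-applyUpTo st x (suc n) = cong (st x +_) (sumAlong-applyUpTo st (f x) n)

  -- The potential `Φ` cancels between consecutive points; having it on both sides keeps the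
  -- identity in ℕ. The factor `k` clears denominators: `a * b` for χ and 2 for χ̂.
  sumAlong-telescope : ∀ k (st wt Φ : X → ℕ) →
                       (∀ x → k * st x + Φ (f x) ≡ wt x + Φ x) → ∀ x n →
                       k * sumAlong st x n + Φ (iterate f x n) ≡ sumAlong wt x n + Φ x
  sumAlong-telescope k st wt Φ local x zero    = cong (_+ Φ x) (*-zeroʳ k)
  sumAlong-telescope k st wt Φ local x (suc n) = begin
    k * (st x + S) + Φ (iterate f (f x) n)     ≡⟨ distrib k (st x) S _ ⟩
    k * st x + (k * S + Φ (iterate f (f x) n)) ≡⟨ cong (k * st x +_) (sumAlong-telescope k st wt Φ local (f x) n) ⟩
    k * st x + (W + Φ (f x))                   ≡⟨ shuffle (k * st x) W (Φ (f x)) ⟩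
    W + (k * st x + Φ (f x))                   ≡⟨ cong (W +_) (local x) ⟩
    W + (wt x + Φ x)                           ≡⟨ rotate W (wt x) (Φ x) ⟩
    wt x + W + Φ x                             ∎
    where
    open ≡-Reasoning
    S W : ℕ
    S = sumAlong st (f x) n
    W = sumAlong wt (f x) n
    distrib : ∀ k u v w → k * (u + v) + w ≡ k * u + (k * v + w)
    distrib = solve-∀
    shuffle : ∀ u v w → u + (v + w) ≡ v + (u + w)
    shuffle = solve-∀
    rotate : ∀ u v w → u + (v + w) ≡ v + u + w
    rotate = solve-∀

  -- Injectivity in the pair (index, time) makes every `len i` the exact period and keeps different
  -- cycles apart.
  record CycleDecomposition (I : Set) : Set where
    field
      rep       : I → X
      len       : I → ℕ
      len>0     : ∀ i → 0 < len i
      closed    : ∀ i → iterate f (rep i) (len i) ≡ rep i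
      reached   : ∀ x → ∃[ i ] ∃[ t ] t < len i × iterate f (rep i) t ≡ x
      separated : ∀ i j {s t} → s < len i → t < len j →
                  iterate f (rep i) s ≡ iterate f (rep j) t → i ≡ j × s ≡ t

module _ {X Y : Set} {f : X → X} {g : Y → Y} (h : X → Y) (comm : ∀ x → h (f x) ≡ g (h x)) where

  iterate-conjugate : ∀ x n → h (iterate f x n) ≡ iterate g (h x) n
  iterate-conjugate x zero    = refl
  iterate-conjugate x (suc n) =
    trans (iterate-conjugate (f x) n) (cong (λ y → iterate g y n) (comm x))

  sumAlong-conjugate : ∀ st x n → sumAlong g st (h x) n ≡ sumAlong f (st ∘ h) x n
  sumAlong-conjugate st x zero    = refl
  sumAlong-conjugate st x (suc n) = cong (st (h x) +_)
    (trans (cong (λ y → sumAlong g st y n) (sym (comm x))) (sumAlong-conjugate st (f x) n))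

  -- The orbits are computed once, on states; this carries them to antichains and to ideals with the
  -- same indices and lengths.
  conjugate : Injective _≡_ _≡_ h → (∀ y → ∃[ x ] h x ≡ y) →
              ∀ {I} → CycleDecomposition f I → CycleDecomposition g I
  conjugate inj surj D = record
    { rep       = h ∘ rep
    ; len       = len
    ; len>0     = len>0
    ; closed    = λ i → trans (sym (iterate-conjugate _ (len i))) (cong h (closed i))
    ; reached   = reached′
    ; separated = λ i j {s} {t} s< t< eq → separated i j s< t<
        (inj (trans (iterate-conjugate _ s) (trans eq (sym (iterate-conjugate _ t)))))
    }
    where
    open CycleDecomposition D
    reached′ : ∀ y → ∃[ i ] ∃[ t ] t < len i × iterate g (h (rep i)) t ≡ y
    reached′ y with surj y
    ... | x , refl with reached x
    ...   | i , t , t< , refl = i , t , t< , sym (iterate-conjugate _ t)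

module _ {X : Set} {f : X → X} {I : Set} (D : CycleDecomposition f I) where
  open CycleDecomposition D

  cycle : I → List X
  cycle i = applyUpTo (iterate f (rep i)) (len i)

  cycle-unique : ∀ i → Unique (cycle i)
  cycle-unique i = applyUpTo⁺₁ _ (len i) λ s<t t< eq →
    <⇒≢ s<t (proj₂ (separated i i (<-trans s<t t<) t< eq))

  indexOf : X → I
  indexOf x = proj₁ (reached x)

  ∈-cycle-indexOf : ∀ x → x ∈ˡ cycle (indexOf x)
  ∈-cycle-indexOf x with reached x
  ... | i , t , t< , refl = ∈-applyUpTo⁺ _ t<

  ∈-cycle⇒indexOf : ∀ {x i} → x ∈ˡ cycle i → indexOf x ≡ i
  ∈-cycle⇒indexOf {x} {i} x∈ with ∈-applyUpTo⁻ _ x∈ | reached x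
  ... | s , s< , eq | j , t , t< , eq′ = proj₁ (separated j i t< s< (trans eq′ eq))

  indexOf-step : ∀ x → indexOf (f x) ≡ indexOf x
  indexOf-step x = ∈-cycle⇒indexOf fx∈
    where
    fx∈ : f x ∈ˡ cycle (indexOf x)
    fx∈ with reached x
    ... | i , t , t< , refl with m≤n⇒m<n∨m≡n t<
    ...   | inj₁ 1+t< = subst (_∈ˡ cycle i) (iterate-suc f (rep i) t) (∈-applyUpTo⁺ _ 1+t<)
    -- At the last point `f` returns to the representative, which heads the list because the length
    -- is positive.
    ...   | inj₂ 1+t≡ = subst (_∈ˡ cycle i)
      (trans (sym (closed i)) (trans (cong (iterate f (rep i)) (sym 1+t≡)) (iterate-suc f (rep i) t)))
      (∈-applyUpTo⁺ (iterate f (rep i)) (len>0 i))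

  -- A backward link is an application of `f` read in reverse, so invariance under one step settles
  -- both directions.
  SameOrbit⇒indexOf : ∀ {x y} → SameOrbit f x y → indexOf x ≡ indexOf y
  SameOrbit⇒indexOf ε                = refl
  SameOrbit⇒indexOf (fwd refl ◅ eqs) = trans (sym (indexOf-step _)) (SameOrbit⇒indexOf eqs)
  SameOrbit⇒indexOf (bwd refl ◅ eqs) = trans (indexOf-step _) (SameOrbit⇒indexOf eqs)

  SameOrbit-iterate : ∀ x n → SameOrbit f x (iterate f x n)
  SameOrbit-iterate x zero    = ε
  SameOrbit-iterate x (suc n) = fwd refl ◅ SameOrbit-iterate (f x) n

  SameOrbit-rep : ∀ x → SameOrbit f (rep (indexOf x)) x
  SameOrbit-rep x with reached x
  ... | i , t , _ , refl = SameOrbit-iterate (rep i) t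

  indexOf⇒SameOrbit : ∀ {x y} → indexOf x ≡ indexOf y → SameOrbit f x y
  indexOf⇒SameOrbit {x} {y} eq =
    symmetric _ (subst (λ i → SameOrbit f (rep i) x) eq (SameOrbit-rep x)) ◅◅ SameOrbit-rep y

  indexOf⇒∈-cycle : ∀ {x i} → indexOf x ≡ i → x ∈ˡ cycle i
  indexOf⇒∈-cycle {x} refl = ∈-cycle-indexOf x

  orbitIndex : Orbit f → I
  orbitIndex O = indexOf (head (Orbit.elements O))

  ∈-orbit⇔∈-cycle : ∀ O {x} → x ∈ˡ toList (Orbit.elements O) ⇔ x ∈ˡ cycle (orbitIndex O)
  ∈-orbit⇔∈-cycle O {x} = mk⇔
    (λ x∈ → indexOf⇒∈-cycle (sym (SameOrbit⇒indexOf (Equivalence.to (Orbit.complete O x) x∈))))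
    (λ x∈ → Equivalence.from (Orbit.complete O x) (indexOf⇒SameOrbit (sym (∈-cycle⇒indexOf x∈))))

  -- Duplicate-free lists with the same members are permutations of each other, so the size and
  -- totals of an orbit listed in any order can be computed on the cycle.
  orbit↭cycle : ∀ O → toList (Orbit.elements O) ↭ cycle (orbitIndex O)
  orbit↭cycle O = ∼bag⇒↭
    (unique∧set⇒bag (Orbit.unique O) (cycle-unique (orbitIndex O)) (∈-orbit⇔∈-cycle O))

  size-orbit : ∀ O → size O ≡ len (orbitIndex O)
  size-orbit O = trans (↭-length (orbit↭cycle O)) (length-applyUpTo _ (len (orbitIndex O)))

  total-orbit : ∀ O st → total O st ≡ sumAlong f st (rep (orbitIndex O)) (size O)
  total-orbit O st = trans (sum-↭ (map⁺ st (orbit↭cycle O)))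
    (trans (sumAlong-applyUpTo f st _ (len (orbitIndex O)))
      (cong (sumAlong f st (rep (orbitIndex O))) (sym (size-orbit O))))

  cycle⁺ : ∀ i → ∃[ xs ] toList xs ≡ cycle i
  cycle⁺ i with len i | len>0 i
  ... | suc n | _ = rep i ∷ applyUpTo (iterate f (f (rep i))) n , refl

  orbitAt : I → Orbit f
  orbitAt i with cycle⁺ i
  ... | xs , eq = record
    { elements = xs
    ; unique   = subst Unique (sym eq) (cycle-unique i)
    ; complete = λ y → mk⇔
        (λ y∈ → indexOf⇒SameOrbit (trans head-index (sym (∈-cycle⇒indexOf (subst (y ∈ˡ_) eq y∈)))))
        (λ same → subst (y ∈ˡ_) (sym eq)
          (indexOf⇒∈-cycle (trans (sym (SameOrbit⇒indexOf same)) head-index)))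
    }
    where
    head-index : indexOf (head xs) ≡ i
    head-index = ∈-cycle⇒indexOf (subst (head xs ∈ˡ_) eq (here refl))

  ∈-orbitAt : ∀ i → toList (Orbit.elements (orbitAt i)) ≡ cycle i
  ∈-orbitAt i with cycle⁺ i
  ... | xs , eq = eq

  orbitIndex-orbitAt : ∀ i → orbitIndex (orbitAt i) ≡ i
  orbitIndex-orbitAt i =
    ∈-cycle⇒indexOf (subst (head (Orbit.elements (orbitAt i)) ∈ˡ_) (∈-orbitAt i) (here refl))

  -- Orbits are equal as sets exactly when their indices agree, so it suffices to enumerate the
  -- indices of length `c`.
  #ofLength : ∀ {k c} (ι : Fin k → I) → Injective _≡_ _≡_ ι → (∀ x → len (ι x) ≡ c) →
              (∀ i → len i ≡ c → ∃[ x ] ι x ≡ i) → # (λ (O : Orbit f) → size O ≡ c) ≐ k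
  #ofLength ι ι-inj ι-len ι-surj = record
    { to        = λ x → orbitAt (ι x) ,
        trans (size-orbit (orbitAt (ι x))) (trans (cong len (orbitIndex-orbitAt (ι x))) (ι-len x))
    ; cong      = λ { refl → mk⇔ (λ y∈ → y∈) (λ y∈ → y∈) }
    ; bijective = inj , surj
    }
    where
    inj : ∀ {x y} → (∀ {z} → z ∈ˡ toList (Orbit.elements (orbitAt (ι x)))
                            ⇔ z ∈ˡ toList (Orbit.elements (orbitAt (ι y)))) → x ≡ y
    inj {x} {y} same = ι-inj (trans (sym (orbitIndex-orbitAt (ι x)))
      (∈-cycle⇒indexOf (subst (_ ∈ˡ_) (∈-orbitAt (ι y)) (Equivalence.to same (here refl)))))
    surj : ∀ y → ∃[ x ] (∀ {z} → z ≡ x → ∀ {e} → e ∈ˡ toList (Orbit.elements (orbitAt (ι z)))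
                                     ⇔ e ∈ˡ toList (Orbit.elements (proj₁ y)))
    surj (O , sz) with ι-surj (orbitIndex O) (trans (sym (size-orbit O)) sz)
    ... | x , eq = x , λ { refl → mk⇔
      (λ e∈ → Equivalence.from (∈-orbit⇔∈-cycle O)
        (subst (λ i → _ ∈ˡ cycle i) eq (subst (_ ∈ˡ_) (∈-orbitAt (ι x)) e∈)))
      (λ e∈ → subst (_ ∈ˡ_) (sym (trans (∈-orbitAt (ι x)) (cong cycle eq)))
        (Equivalence.to (∈-orbit⇔∈-cycle O) e∈)) }

-- Pigeonhole principle and decompositions obtained by counting

injective⇒surjective : ∀ {n} {f : Fin n → Fin n} → Injective _≡_ _≡_ f → ∀ y → ∃[ x ] f x ≡ y
injective⇒surjective {suc n} {f} inj y with any? (λ x → f x ≟ᶠ y)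
... | yes hit = hit
-- A missed value `y` could be deleted from the codomain, leaving an injection of `Fin (suc n)` into
-- `Fin n`.
... | no miss = contradiction
  (injective⇒≤ (λ {x} {x′} eq → inj (punchOut-injective (misses x) (misses x′) eq))) 1+n≰n
  where
  misses : ∀ x → y ≢ f x
  misses x eq = miss (x , sym eq)

-- The maps `κ` and `ι` say |A| ≤ n ≤ |B|. For a section `σ` of `φ`, the map `κ ∘ σ ∘ ι` is an
-- injection of `Fin n` into itself, hence onto; so every element of `A` is a value of `σ`, and `σ`
-- is a two-sided inverse.
surjective⇒injective : ∀ {n} {A B : Set} {φ : A → B} {κ : A → Fin n} {ι : Fin n → B} →
                       Injective _≡_ _≡_ κ → Injective _≡_ _≡_ ι →
                       (∀ y → ∃[ x ] φ x ≡ y) → Injective _≡_ _≡_ φ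
surjective⇒injective {n} {A} {B} {φ} {κ} {ι} κ-inj ι-inj surj {x} {y} eq =
  trans (sym (σ∘φ x)) (trans (cong σ eq) (σ∘φ y))
  where
  σ : B → A
  σ = proj₁ ∘ surj
  φ∘σ : ∀ b → φ (σ b) ≡ b
  φ∘σ = proj₂ ∘ surj
  κσι-inj : Injective _≡_ _≡_ (κ ∘ σ ∘ ι)
  κσι-inj {i} {j} e = ι-inj (trans (sym (φ∘σ (ι i))) (trans (cong φ (κ-inj e)) (φ∘σ (ι j))))
  σ∘φ : ∀ a → σ (φ a) ≡ a
  σ∘φ a with injective⇒surjective κσι-inj (κ a)
  ... | i , e with κ-inj e
  ...   | refl = cong σ (φ∘σ (ι i))

-- Distinctness of the points on the cycles comes for free once they cover X and
-- the lengths add up to the number of points of X.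
decompose : ∀ {X I : Set} {f : X → X} {n} (rep : I → X) (len : I → ℕ) → (∀ i → 0 < len i) →
            (∀ i → iterate f (rep i) (len i) ≡ rep i) →
            (∀ x → ∃[ i ] ∃[ t ] iterate f (rep i) t ≡ x) →
            {κ : Σ I (Fin ∘ len) → Fin n} {ι : Fin n → X} →
            Injective _≡_ _≡_ κ → Injective _≡_ _≡_ ι → CycleDecomposition f I
decompose {X} {I} {f} rep len len>0 closed covered κ-inj ι-inj = record
  { rep       = rep
  ; len       = len
  ; len>0     = len>0
  ; closed    = closed
  ; reached   = λ x → let (i , t) , eq = point-surj x in i , toℕ t , toℕ<n t , eq
  ; separated = separated
  }
  where
  point : Σ I (Fin ∘ len) → X
  point (i , t) = iterate f (rep i) (toℕ t)

  wrap : ∀ i k → iterate f (rep i) (k * len i) ≡ rep i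
  wrap i zero    = refl
  wrap i (suc k) = trans (iterate-+ f (rep i) (len i) (k * len i))
    (trans (cong (λ x → iterate f x (k * len i)) (closed i)) (wrap i k))

  -- Covering supplies an arbitrary time; it is reduced modulo `len i`, full rounds being discarded
  -- by `wrap`.
  point-surj : ∀ x → ∃[ it ] point it ≡ x
  point-surj x with covered x
  ... | i , t , refl = (i , fromℕ< (m%n<n t (len i))) , eq
    where
    instance
      _ : NonZero (len i)
      _ = >-nonZero (len>0 i)
    eq : iterate f (rep i) (toℕ (fromℕ< (m%n<n t (len i)))) ≡ iterate f (rep i) t
    eq = begin
      iterate f (rep i) (toℕ (fromℕ< (m%n<n t (len i))))
        ≡⟨ cong (iterate f (rep i)) (toℕ-fromℕ< (m%n<n t (len i))) ⟩
      iterate f (rep i) (t % len i)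
        ≡⟨ cong (λ x → iterate f x (t % len i)) (wrap i (t / len i)) ⟨
      iterate f (iterate f (rep i) (t / len i * len i)) (t % len i)
        ≡⟨ iterate-+ f (rep i) (t / len i * len i) (t % len i) ⟨
      iterate f (rep i) (t / len i * len i + t % len i)
        ≡⟨ cong (iterate f (rep i)) (trans (+-comm _ (t % len i)) (sym (m≡m%n+[m/n]*n t (len i)))) ⟩
      iterate f (rep i) t
        ∎
      where open ≡-Reasoning

  separated : ∀ i j {s t} → s < len i → t < len j →
              iterate f (rep i) s ≡ iterate f (rep j) t → i ≡ j × s ≡ t
  separated i j {s} {t} s< t< eq = cong proj₁ same , trans (sym (toℕ-fromℕ< s<))
    (trans (cong (λ (i , t) → toℕ t) same) (toℕ-fromℕ< t<))
    where
    same : (i , fromℕ< s<) ≡ (j , fromℕ< t<)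
    same = surjective⇒injective κ-inj ι-inj point-surj
      (trans (cong (iterate f (rep i)) (toℕ-fromℕ< s<))
        (trans eq (cong (iterate f (rep j)) (sym (toℕ-fromℕ< t<)))))

-- Cyclic clocks

module _ {k : ℕ} where

  inc : Fin (suc k) → Fin (suc k)
  inc i with toℕ i <? k
  ... | yes i<k = suc (fromℕ< i<k)
  ... | no  _   = zero

  data IncView (i : Fin (suc k)) : Fin (suc k) → Set where
    next : (i<k : toℕ i < k) → IncView i (suc (fromℕ< i<k))
    last : toℕ i ≡ k → IncView i zero

  incView : ∀ i → IncView i (inc i)
  incView i with toℕ i <? k
  ... | yes i<k = next i<k
  ... | no  i≮k = last (≤-antisym (s≤s⁻¹ (toℕ<n i)) (≮⇒≥ i≮k))

  clock : ℕ → Fin (suc k)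
  clock n = n mod suc k

  toℕ-clock : ∀ n → toℕ (clock n) ≡ n % suc k
  toℕ-clock n = toℕ-fromℕ< (m%n<n n (suc k))

  -- Congruence is witnessed by multiples of the period added on both sides, which avoids
  -- subtraction.
  clock-cong : ∀ {m n} u v → m + u * suc k ≡ n + v * suc k → clock m ≡ clock n
  clock-cong {m} {n} u v eq = toℕ-injective (begin
    toℕ (clock m)             ≡⟨ toℕ-clock m ⟩
    m % suc k                 ≡⟨ [m+kn]%n≡m%n m u (suc k) ⟨
    (m + u * suc k) % suc k   ≡⟨ cong (_% suc k) eq ⟩
    (n + v * suc k) % suc k   ≡⟨ [m+kn]%n≡m%n n v (suc k) ⟩
    n % suc k                 ≡⟨ toℕ-clock n ⟨
    toℕ (clock n)             ∎)
    where open ≡-Reasoning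

  clock-toℕ : ∀ i → clock (toℕ i) ≡ i
  clock-toℕ i = toℕ-injective (trans (toℕ-clock (toℕ i)) (m<n⇒m%n≡m (toℕ<n i)))

  clock≡0⇒∣ : ∀ {n} → clock n ≡ zero → suc k ∣ n
  clock≡0⇒∣ {n} eq = m%n≡0⇒n∣m n (suc k) (trans (sym (toℕ-clock n)) (cong toℕ eq))

  ∣⇒clock≡0 : ∀ {n} → suc k ∣ n → clock n ≡ zero
  ∣⇒clock≡0 {n} (divides d eq) = clock-cong {n} {0} 0 d (trans (+-identityʳ n) eq)

  clock-inc : ∀ n → inc (clock n) ≡ clock (suc n)
  clock-inc n = toℕ-injective (go (incView (clock n)))
    where
    same : clock (suc (n % suc k)) ≡ clock (suc n)
    same = clock-cong {suc (n % suc k)} {suc n} (n / suc k) 0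
      (trans (cong suc (sym (m≡m%n+[m/n]*n n (suc k)))) (sym (+-identityʳ (suc n))))
    go : ∀ {j} → IncView (clock n) j → toℕ j ≡ toℕ (clock (suc n))
    go (next i<k) = begin
      suc (toℕ (fromℕ< i<k))       ≡⟨ cong suc (trans (toℕ-fromℕ< i<k) (toℕ-clock n)) ⟩
      suc (n % suc k)              ≡⟨ m<n⇒m%n≡m (s≤s (subst (_< k) (toℕ-clock n) i<k)) ⟨
      suc (n % suc k) % suc k      ≡⟨ toℕ-clock (suc (n % suc k)) ⟨
      toℕ (clock (suc (n % suc k))) ≡⟨ cong toℕ same ⟩
      toℕ (clock (suc n))          ∎
      where open ≡-Reasoning
    go (last eq) = cong toℕ (trans
      (sym (∣⇒clock≡0 (divides 1 (trans (cong suc (trans (sym (toℕ-clock n)) eq))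
        (sym (+-identityʳ (suc k)))))))
      same)

-- States encode the ideals of the fence with a = suc a′ and b = suc b′ by the numbers
-- l, m, r of elements below the peak on the left, strictly between valley and peak,
-- and above the valley on the right: w has the valley but not the peak, z lacks the
-- valley (so m = r = 0), p has the peak (so l and m are maximal).
data State (a′ b′ : ℕ) : Set where
  w : (l : Fin (suc a′)) (m : Fin (suc b′)) (r : Fin (suc a′)) → State a′ b′
  z : (l : Fin (suc a′)) → State a′ b′
  p : (r : Fin (suc a′)) → State a′ b′

-- Rowmotion on states and its paths

module _ {a′ b′ : ℕ} where

  -- The middle chain has just been cleared. The valley then remains only below a nonempty right
  -- chain, so a right clock at 0 leads to `z`.
  enter : Fin (suc a′) → Fin (suc a′) → State a′ b′
  enter l zero    = z l
  enter l (suc r) = w l zero (suc r)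

  -- The arguments are clocks already advanced. A middle clock at 0 has just wrapped; the peak
  -- enters exactly if the left clock wrapped in the same step, because only then were all its lower
  -- covers present.
  arrive : Fin (suc a′) → Fin (suc b′) → Fin (suc a′) → State a′ b′
  arrive l       (suc m) r = w l (suc m) r
  arrive zero    zero    r = p r
  arrive (suc l) zero    r = enter (suc l) r

  step : State a′ b′ → State a′ b′
  step (w l m r) = arrive (inc l) (inc m) (inc r)
  step (z l)     = w (inc l) zero zero
  step (p r)     = enter zero (inc r)

  weight : ℕ → ℕ → ℕ → State a′ b′ → ℕ
  weight α β γ (w _ _ _) = α
  weight α β γ (z _)     = β
  weight α β γ (p _)     = γ

  -- Path s i j k s′: a path from s to s′ that leaves i states w, j states z and
  -- k states p.
  data Path : State a′ b′ → ℕ → ℕ → ℕ → State a′ b′ → Set where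
    []  : ∀ {s} → Path s 0 0 0 s
    w∷_ : ∀ {l m r i j k s} → Path (step (w l m r)) i j k s → Path (w l m r) (suc i) j k s
    z∷_ : ∀ {l i j k s} → Path (step (z l)) i j k s → Path (z l) i (suc j) k s
    p∷_ : ∀ {r i j k s} → Path (step (p r)) i j k s → Path (p r) i j (suc k) s

  infixr 5 _++_
  _++_ : ∀ {s i j k s′ i′ j′ k′ s″} → Path s i j k s′ → Path s′ i′ j′ k′ s″ →
         Path s (i + i′) (j + j′) (k + k′) s″
  []       ++ π′ = π′
  (w∷ π) ++ π′ = w∷ (π ++ π′)
  (z∷ π) ++ π′ = z∷ (π ++ π′)
  (p∷ π) ++ π′ = p∷ (π ++ π′)

  castPath : ∀ {s t i i′ j k s′ t′} → s ≡ t → i ≡ i′ → s′ ≡ t′ → Path s i j k s′ → Path t i′ j k t′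
  castPath refl refl refl π = π

  recount : ∀ {s i i′ j j′ k k′ s′} → i ≡ i′ → j ≡ j′ → k ≡ k′ → Path s i j k s′ → Path s i′ j′ k′ s′
  recount refl refl refl π = π

  path-iterate : ∀ {s i j k s′} → Path s i j k s′ → iterate step s (i + j + k) ≡ s′
  path-iterate []     = refl
  path-iterate (w∷ π) = path-iterate π
  path-iterate {s} {i} {suc j} {k} (z∷ π) =
    trans (cong (λ n → iterate step s (n + k)) (+-suc i j)) (path-iterate π)
  path-iterate {s} {i} {j} {suc k} (p∷ π) =
    trans (cong (iterate step s) (+-suc (i + j) k)) (path-iterate π)

  path-weight : ∀ {s i j k s′} → Path s i j k s′ → ∀ α β γ →
                sumAlong step (weight α β γ) s (i + j + k) ≡ α * i + β * j + γ * k
  path-weight [] α β γ = sym (cong₂ _+_ (cong₂ _+_ (*-zeroʳ α) (*-zeroʳ β)) (*-zeroʳ γ))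
  path-weight {s} {suc i} {j} {k} (w∷ π) α β γ =
    trans (cong (α +_) (path-weight π α β γ)) (eq α β γ i j k)
    where
    eq : ∀ α β γ i j k → α + (α * i + β * j + γ * k) ≡ α * suc i + β * j + γ * k
    eq = solve-∀
  path-weight {s} {i} {suc j} {k} (z∷ π) α β γ =
    trans (cong (λ n → sumAlong step (weight α β γ) s (n + k)) (+-suc i j))
      (trans (cong (β +_) (path-weight π α β γ)) (eq α β γ i j k))
    where
    eq : ∀ α β γ i j k → β + (α * i + β * j + γ * k) ≡ α * i + β * suc j + γ * k
    eq = solve-∀
  path-weight {s} {i} {j} {suc k} (p∷ π) α β γ =
    trans (cong (sumAlong step (weight α β γ) s) (+-suc (i + j) k))
      (trans (cong (γ +_) (path-weight π α β γ)) (eq α β γ i j k))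
    where
    eq : ∀ α β γ i j k → γ + (α * i + β * j + γ * k) ≡ α * i + β * j + γ * suc k
    eq = solve-∀

  _⟶*_ : State a′ b′ → State a′ b′ → Set
  s ⟶* s′ = ∃[ n ] iterate step s n ≡ s′

  ⟶*-trans : ∀ {s s′ s″} → s ⟶* s′ → s′ ⟶* s″ → s ⟶* s″
  ⟶*-trans {s} (m , eq) (n , eq′) =
    m + n , trans (iterate-+ step s m n) (trans (cong (λ x → iterate step x n) eq) eq′)

  reach : ∀ {s i j k s′} → Path s i j k s′ → s ⟶* s′
  reach {i = i} {j} {k} π = i + j + k , path-iterate π

  -- arriveAt x y is where the middle has just been filled up, and enterAt x y
  -- where the middle is empty and the peak is not in the ideal.
  section arriveAt enterAt : ℕ → ℕ → State a′ b′
  section  x y = w (clock x) zero (clock y)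
  arriveAt x y = arrive (clock x) zero (clock y)
  enterAt  x y = enter (clock x) (clock y)

  -- The bound on `d + m` keeps the middle clock from wrapping, so none of the exceptional cases of
  -- `arrive` occurs.
  climb : ∀ d m x y → d + m ≤ b′ → Path (w (clock x) (clock m) (clock y)) d 0 0
                                        (w (clock (d + x)) (clock (d + m)) (clock (d + y)))
  climb zero    m x y d+m≤ = []
  climb (suc d) m x y d+m≤ = w∷ castPath (sym step≡) refl shift
      (climb d (suc m) (suc x) (suc y) (subst (_≤ b′) (sym (+-suc d m)) d+m≤))
    where
    m< : suc m < suc b′
    m< = s≤s (≤-trans (s≤s (m≤n+m m d)) d+m≤)
    shift : w (clock (d + suc x)) (clock (d + suc m)) (clock (d + suc y))
          ≡ w (clock (suc d + x)) (clock (suc d + m)) (clock (suc d + y))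
    shift rewrite +-suc d x | +-suc d m | +-suc d y = refl
    arrive-suc : ∀ {m} l i r → toℕ i ≡ suc m → arrive l i r ≡ w l i r
    arrive-suc l (suc i) r _ = refl
    step≡ : step (w (clock x) (clock m) (clock y)) ≡ w (clock (suc x)) (clock (suc m)) (clock (suc y))
    step≡ rewrite clock-inc {a′} x | clock-inc {b′} m | clock-inc {a′} y =
      arrive-suc (clock (suc x)) (clock (suc m)) (clock (suc y)) (trans (toℕ-clock (suc m)) (m<n⇒m%n≡m m<))

  turn : ∀ x y → Path (section x y) (suc b′) 0 0 (arriveAt (suc b′ + x) (suc b′ + y))
  turn x y = castPath refl (+-comm b′ 1) refl
    (climb b′ 0 x y (≤-reflexive (+-identityʳ b′)) ++ (w∷ castPath (sym step≡) refl refl []))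
    where
    step≡ : step (w (clock (b′ + x)) (clock (b′ + 0)) (clock (b′ + y))) ≡ arriveAt (suc b′ + x) (suc b′ + y)
    step≡ rewrite clock-inc {a′} (b′ + x) | clock-inc {b′} (b′ + 0) | clock-inc {a′} (b′ + y)
      | ∣⇒clock≡0 {b′} {suc (b′ + 0)} (divides 1 refl) = refl

  arriveAt≡enterAt : ∀ {x y} → clock {a′} x ≢ zero → arriveAt x y ≡ enterAt x y
  arriveAt≡enterAt {x} x≢0 with clock {a′} x
  ... | zero  = contradiction refl x≢0
  ... | suc _ = refl

  enterAt≡section : ∀ {x y} → clock {a′} y ≢ zero → enterAt x y ≡ section x y
  enterAt≡section {y = y} y≢0 with clock {a′} y
  ... | zero  = contradiction refl y≢0
  ... | suc _ = refl

  visitPeak : ∀ {x y} → clock {a′} x ≡ zero → Path (arriveAt x y) 0 0 1 (enterAt x (suc y))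
  visitPeak {x} {y} x≡0 rewrite x≡0 = p∷ castPath (cong (enter zero) (sym (clock-inc y))) refl refl []

  visitValley : ∀ {x y} → clock {a′} y ≡ zero → Path (enterAt x y) 0 1 0 (section (suc x) y)
  visitValley {x} {y} y≡0 rewrite y≡0 =
    z∷ castPath (cong (λ i → w i zero zero) (sym (clock-inc x))) refl refl []

  Free : ℕ → ℕ → Set
  Free x y = clock {a′} x ≢ zero × clock {a′} y ≢ zero

  glide : ∀ t x y → (∀ τ → 0 < τ → τ ≤ t → Free (τ * suc b′ + x) (τ * suc b′ + y)) →
          Path (section x y) (t * suc b′) 0 0 (section (t * suc b′ + x) (t * suc b′ + y))
  glide zero    x y free = []
  glide (suc t) x y free =
    castPath refl (+-comm (t * suc b′) (suc b′)) at-end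
      (glide t x y (λ τ 0<τ τ≤t → free τ 0<τ (m≤n⇒m≤1+n τ≤t)) ++ turn (t * suc b′ + x) (t * suc b′ + y))
    where
    free-end : Free (suc t * suc b′ + x) (suc t * suc b′ + y)
    free-end = free (suc t) z<s ≤-refl
    at-end : arriveAt (suc b′ + (t * suc b′ + x)) (suc b′ + (t * suc b′ + y))
           ≡ section (suc t * suc b′ + x) (suc t * suc b′ + y)
    at-end rewrite sym (+-assoc (suc b′) (t * suc b′) x) | sym (+-assoc (suc b′) (t * suc b′) y) =
      trans (arriveAt≡enterAt {suc t * suc b′ + x} {suc t * suc b′ + y} (proj₁ free-end))
        (enterAt≡section {suc t * suc b′ + x} {suc t * suc b′ + y} (proj₂ free-end))

  -- The path stops before the peak and the valley are tested in the last turn, so `Free` is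
  -- demanded only strictly before `t`. Blocks of visits can thus start at its end.
  glideToArrival : ∀ {t} x y → 0 < t →
                   (∀ τ → 0 < τ → τ < t → Free (τ * suc b′ + x) (τ * suc b′ + y)) →
                   Path (section x y) (t * suc b′) 0 0 (arriveAt (t * suc b′ + x) (t * suc b′ + y))
  glideToArrival {suc t} x y _ free =
    castPath refl (+-comm (t * suc b′) (suc b′))
      (cong₂ arriveAt (sym (+-assoc (suc b′) (t * suc b′) x)) (sym (+-assoc (suc b′) (t * suc b′) y)))
      (glide t x y (λ τ 0<τ τ≤t → free τ 0<τ (s≤s τ≤t)) ++ turn (t * suc b′ + x) (t * suc b′ + y))

-- Orbits of states

module Orbits (a′ b′ ā b̄ g′ m q : ℕ)
              (a≡ : suc a′ ≡ ā * suc g′) (b≡ : suc b′ ≡ b̄ * suc g′)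
              (mā≡ : m * ā ≡ q * b̄ + 1) (1≤q : 1 ≤ q) (q≤ā : q ≤ ā) where

  private
    a b g : ℕ
    a = suc a′
    b = suc b′
    g = suc g′

  0<ā : 0 < ā
  0<ā = ≤-trans 1≤q q≤ā

  -- Multiplication by `q` inverts `b̄` up to sign, since q b̄ ≡ -1 modulo `ā`.
  ā∣⇐ā∣*b̄ : ∀ {t} → ā ∣ t * b̄ → ā ∣ t
  ā∣⇐ā∣*b̄ {t} ā∣tb̄ = ∣m+n∣m⇒∣n (divides (t * m) eq) (∣n⇒∣m*n q ā∣tb̄)
    where
    expand : ∀ t q b̄ → q * (t * b̄) + t ≡ t * (q * b̄ + 1)
    expand = solve-∀
    eq : q * (t * b̄) + t ≡ t * m * ā
    eq = trans (expand t q b̄) (trans (cong (t *_) (sym mā≡)) (sym (*-assoc t m ā)))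

  -- Together with `āb≡b̄a` this says that `b` has order exactly `ā` modulo `a`.
  a∤ : ∀ {t} → 0 < t → t < ā → ¬ a ∣ t * b
  a∤ {t} 0<t t<ā a∣tb = <⇒≱ t<ā (∣⇒≤ {{>-nonZero 0<t}} (ā∣⇐ā∣*b̄ (*-cancelʳ-∣ g
    (subst₂ _∣_ a≡ (trans (cong (t *_) b≡) (sym (*-assoc t b̄ g))) a∣tb))))

  g∣a : g ∣ a
  g∣a = divides ā a≡

  g∣*b : ∀ t → g ∣ t * b
  g∣*b t = ∣n⇒∣m*n t (divides b̄ b≡)

  āb≡b̄a : ā * b ≡ b̄ * a
  āb≡b̄a = trans (cong (ā *_) b≡) (trans (eq ā b̄ g) (cong (b̄ *_) (sym a≡)))
    where
    eq : ∀ u v w → u * (v * w) ≡ v * (u * w)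
    eq = solve-∀

  -- The equation for `m`, scaled by `g`: it trades the `g` extra ticks of a block of visits for `q`
  -- turns.
  qb+g≡ma : q * b + g ≡ m * a
  qb+g≡ma = begin
    q * b + g           ≡⟨ cong (λ x → q * x + g) b≡ ⟩
    q * (b̄ * g) + g     ≡⟨ eq q b̄ g ⟩
    (q * b̄ + 1) * g     ≡⟨ cong (_* g) mā≡ ⟨
    m * ā * g           ≡⟨ *-assoc m ā g ⟩
    m * (ā * g)         ≡⟨ cong (m *_) a≡ ⟨
    m * a               ∎
    where
    open ≡-Reasoning
    eq : ∀ u v w → u * (v * w) + w ≡ (u * v + 1) * w
    eq = solve-∀

  clock-period : ∀ x → clock {a′} (ā * b + x) ≡ clock x
  clock-period x = clock-cong {a′} {ā * b + x} {x} 0 b̄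
    (trans (+-identityʳ _) (trans (+-comm (ā * b) x) (cong (x +_) āb≡b̄a)))

  ¬g∣⇒clock≢0 : ∀ {x} → ¬ g ∣ x → clock {a′} x ≢ zero
  ¬g∣⇒clock≢0 {x} ¬g∣x eq = ¬g∣x (∣-trans g∣a (clock≡0⇒∣ {n = x} eq))

  ¬g∣ : ∀ {x i} → g ∣ x → i < g′ → ¬ g ∣ suc i + x
  ¬g∣ {x} {i} g∣x i<g′ g∣ = <⇒≱ (s≤s i<g′) (∣⇒≤ (∣m+n∣m⇒∣n (subst (g ∣_) (+-comm (suc i) x) g∣) g∣x))

  ¬g∣-shift : ∀ τ {x} → ¬ g ∣ x → ¬ g ∣ τ * b + x
  ¬g∣-shift τ ¬g∣x g∣ = ¬g∣x (∣m+n∣m⇒∣n g∣ (g∣*b τ))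

  clock-multiple≢0 : ∀ {τ} → 0 < τ → τ < ā → clock {a′} (τ * b + 0) ≢ zero
  clock-multiple≢0 {τ} 0<τ τ<ā eq =
    a∤ 0<τ τ<ā (subst (a ∣_) (+-identityʳ (τ * b)) (clock≡0⇒∣ {n = τ * b + 0} eq))

  -- Two zeros of a clock that only turns are a multiple of `ā` turns apart, and `s ∸ τ` lies
  -- strictly between 0 and `ā`.
  clock-before≢0 : ∀ {s τ x} → a ∣ s * b + x → s < ā + τ → τ < s → clock {a′} (τ * b + x) ≢ zero
  clock-before≢0 {s} {τ} {x} a∣ s<ā+τ τ<s eq = a∤ (m<n⇒0<n∸m τ<s) d<ā
    (∣m+n∣m⇒∣n (subst (a ∣_) split a∣) (clock≡0⇒∣ {n = τ * b + x} eq))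
    where
    d<ā : s ∸ τ < ā
    d<ā = +-cancelʳ-< τ (s ∸ τ) ā (subst (_< ā + τ) (sym (m∸n+n≡m (<⇒≤ τ<s))) s<ā+τ)
    eq′ : ∀ d t b x → (d + t) * b + x ≡ t * b + x + d * b
    eq′ = solve-∀
    split : s * b + x ≡ τ * b + x + (s ∸ τ) * b
    split = trans (cong (λ u → u * b + x) (sym (m∸n+n≡m (<⇒≤ τ<s)))) (eq′ (s ∸ τ) τ b x)

  private
    infix 4 _⟶_
    _⟶_ : State a′ b′ → State a′ b′ → Set
    _⟶_ = _⟶*_

  -- After fewer than `g` visits the right clock is nonzero modulo `g`, so the valley is always
  -- present and the left clock next shows 0 exactly `ā` turns later.
  visitPeaks : ∀ i {y} → i ≤ g′ → g ∣ y →
               Path {a′} {b′} (arriveAt 0 y) (i * (ā * b)) 0 (suc i) (enterAt 0 (suc i + y))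
  visitPeaks zero    {y} _ _ = visitPeak {x = 0} {y} refl
  visitPeaks (suc i) {y} i<g′ g∣y =
    recount (trans (cong (i * (ā * b) +_) (+-identityʳ _)) (+-comm (i * (ā * b)) (ā * b))) refl (+-comm (suc i) 1)
      (visitPeaks i (<⇒≤ i<g′) g∣y ++ between ++ visitPeak {x = 0} {suc i + y} refl)
    where
    off : ¬ g ∣ suc i + y
    off = ¬g∣ g∣y i<g′
    between : Path (enterAt 0 (suc i + y)) (ā * b) 0 0 (arriveAt 0 (suc i + y))
    between = castPath (sym (enterAt≡section {x = 0} {suc i + y} (¬g∣⇒clock≢0 off))) refl
      (cong₂ (λ u v → arrive u zero v) (clock-period 0) (clock-period (suc i + y)))
      (glideToArrival 0 (suc i + y) 0<ā λ τ 0<τ τ<ā →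
        clock-multiple≢0 0<τ τ<ā , ¬g∣⇒clock≢0 (¬g∣-shift τ off))

  visitValleys : ∀ i {x} → i ≤ g′ → g ∣ x →
                 Path {a′} {b′} (enterAt x 0) (i * (ā * b)) (suc i) 0 (section (suc i + x) 0)
  visitValleys zero    {x} _ _ = visitValley {x = x} {0} refl
  visitValleys (suc i) {x} i<g′ g∣x =
    recount (trans (cong (i * (ā * b) +_) (+-identityʳ _)) (+-comm (i * (ā * b)) (ā * b))) (+-comm (suc i) 1) refl
      (visitValleys i (<⇒≤ i<g′) g∣x ++ between ++ visitValley {x = suc i + x} {0} refl)
    where
    off : ¬ g ∣ suc i + x
    off = ¬g∣ g∣x i<g′
    between : Path (section (suc i + x) 0) (ā * b) 0 0 (enterAt (suc i + x) 0)
    between = castPath refl refl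
      (trans (cong₂ (λ u v → arrive u zero v) (clock-period (suc i + x)) (clock-period 0))
        (arriveAt≡enterAt {x = suc i + x} {0} (¬g∣⇒clock≢0 off)))
      (glideToArrival (suc i + x) 0 0<ā λ τ 0<τ τ<ā →
        ¬g∣⇒clock≢0 (¬g∣-shift τ off) , clock-multiple≢0 0<τ τ<ā)

  a∣nb+g : ∀ {n} → n ≡ q ⊎ n ≡ q + ā → a ∣ n * b + g
  a∣nb+g     (inj₁ refl) = divides m qb+g≡ma
  a∣nb+g {n} (inj₂ refl) = divides (m + b̄) (begin
    (q + ā) * b + g        ≡⟨ expand q ā b g ⟩
    q * b + g + ā * b      ≡⟨ cong₂ _+_ qb+g≡ma āb≡b̄a ⟩
    m * a + b̄ * a          ≡⟨ *-distribʳ-+ a m b̄ ⟨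
    (m + b̄) * a            ∎)
    where
    open ≡-Reasoning
    expand : ∀ q ā b g → (q + ā) * b + g ≡ q * b + g + ā * b
    expand = solve-∀

  -- s and s′ count the turns of the middle clock from the last visit to the valley to
  -- the first visit to the peak, and from the last visit to the peak to the first
  -- visit to the valley.
  module Long {s s′ : ℕ} (0<s : 0 < s) (s≤ā : s ≤ ā) (s′<ā : s′ < ā)
              (s+s′ : s + s′ ≡ q ⊎ s + s′ ≡ q + ā) where

    -- The left clock at the end of a block of visits to the valley, where the right clock shows 0,
    -- and the right clock at the end of a block of visits to the peak, where the left clock shows
    -- 0.
    x₀ y₁ : ℕ
    x₀ = g + s′ * b
    y₁ = g + s * b

    a∣sb+x₀ : a ∣ s * b + x₀
    a∣sb+x₀ = subst (a ∣_) (eq s s′ b g) (a∣nb+g s+s′)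
      where
      eq : ∀ s t b g → (s + t) * b + g ≡ s * b + (g + t * b)
      eq = solve-∀

    a∣s′b+y₁ : a ∣ s′ * b + y₁
    a∣s′b+y₁ = subst (a ∣_) (eq s s′ b g) (a∣nb+g s+s′)
      where
      eq : ∀ s t b g → (s + t) * b + g ≡ t * b + (g + s * b)
      eq = solve-∀

    start : State a′ b′
    start = section x₀ 0

    free₁ : ∀ τ → 0 < τ → τ < s → Free {a′} {b′} (τ * b + x₀) (τ * b + 0)
    free₁ τ 0<τ τ<s =
      -- Since `s` may equal `ā`, strictness has to come from `0 < τ`.
      clock-before≢0 {s} {τ} a∣sb+x₀ (≤-<-trans s≤ā (m<m+n ā 0<τ)) τ<s ,
      clock-multiple≢0 0<τ (<-≤-trans τ<s s≤ā)

    free₂ : ∀ τ → 0 < τ → τ < s′ → Free {a′} {b′} (τ * b + 0) (τ * b + y₁)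
    free₂ τ 0<τ τ<s′ =
      clock-multiple≢0 0<τ (<-trans τ<s′ s′<ā) ,
      clock-before≢0 {s′} {τ} a∣s′b+y₁ (<-≤-trans s′<ā (m≤m+n ā τ)) τ<s′

    toPeaks : Path start (s * b) 0 0 (arriveAt 0 (s * b))
    toPeaks = castPath refl refl
      (cong₂ (λ u v → arrive u zero v) (∣⇒clock≡0 {n = s * b + x₀} a∣sb+x₀) (cong clock (+-identityʳ (s * b))))
      (glideToArrival x₀ 0 0<s free₁)

    leavePeaks : 0 < s′ → enterAt 0 y₁ ≡ section {a′} {b′} 0 y₁
    leavePeaks 0<s′ = enterAt≡section {x = 0} {y₁}
      (clock-before≢0 {s′} {0} a∣s′b+y₁ (subst (s′ <_) (sym (+-identityʳ ā)) s′<ā) 0<s′)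

    toValleys : Path (enterAt 0 y₁) (s′ * b) 0 0 (enterAt (s′ * b) 0)
    toValleys = go s′ refl
      where
      atValley : ∀ t → t ≡ s′ → clock {a′} (t * b + y₁) ≡ zero
      atValley t refl = ∣⇒clock≡0 {n = t * b + y₁} a∣s′b+y₁
      go : ∀ t → t ≡ s′ → Path {a′} {b′} (enterAt 0 y₁) (t * b) 0 0 (enterAt (t * b) 0)
      -- For `s′ = 0` the valley is missing directly after the last visit to the peak, without any
      -- turn in between.
      go zero    eq = castPath refl refl (cong (enter zero) (atValley zero eq)) []
      go (suc t) refl = castPath (sym (leavePeaks z<s)) refl
        (trans (arriveAt≡enterAt {x = suc t * b + 0} {suc t * b + y₁} (clock-multiple≢0 {suc t} z<s s′<ā))
          (cong₂ enter (cong clock (+-identityʳ (suc t * b))) (atValley (suc t) refl)))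
        (glideToArrival 0 y₁ z<s free₂)

    roundTrip : Path start ((s + s′ + (g′ * ā + g′ * ā)) * b) g g start
    roundTrip = recount (eq s s′ g′ ā b) refl (+-identityʳ g)
      (toPeaks ++ visitPeaks g′ ≤-refl (g∣*b s) ++ toValleys ++ visitValleys g′ ≤-refl (g∣*b s′))
      where
      eq : ∀ s t h c b → s * b + (h * (c * b) + (t * b + h * (c * b))) ≡ (s + t + (h * c + h * c)) * b
      eq = solve-∀

    -- The lemmas `reach₁` to `reach₄` list the sections on a long orbit by phase: before the peaks,
    -- among the peaks, before the valleys, among the valleys. They feed `coveredResidue`.
    reach₁ : ∀ {t} → t < s → start ⟶ section (t * b + x₀) (t * b + 0)
    reach₁ {t} t<s = reach (glide t x₀ 0 λ τ 0<τ τ≤t → free₁ τ 0<τ (≤-<-trans τ≤t t<s))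

    reach₂ : ∀ {i t} → i < g′ → t < ā → start ⟶ section (t * b + 0) (t * b + (suc i + s * b))
    reach₂ {i} {t} i<g′ t<ā = reach (toPeaks ++ visitPeaks i (<⇒≤ i<g′) (g∣*b s) ++
      castPath (sym (enterAt≡section {x = 0} {suc i + s * b} (¬g∣⇒clock≢0 off))) refl refl
        (glide t 0 (suc i + s * b) λ τ 0<τ τ≤t →
          clock-multiple≢0 0<τ (≤-<-trans τ≤t t<ā) , ¬g∣⇒clock≢0 (¬g∣-shift τ off)))
      where
      off : ¬ g ∣ suc i + s * b
      off = ¬g∣ (g∣*b s) i<g′

    reach₃ : ∀ {t} → t < s′ → start ⟶ section (t * b + 0) (t * b + y₁)
    reach₃ {t} t<s′ = reach (toPeaks ++ visitPeaks g′ ≤-refl (g∣*b s) ++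
      castPath (sym (leavePeaks (≤-<-trans z≤n t<s′))) refl refl
        (glide t 0 y₁ λ τ 0<τ τ≤t → free₂ τ 0<τ (≤-<-trans τ≤t t<s′)))

    reach₄ : ∀ {i t} → i < g′ → t < ā → start ⟶ section (t * b + (suc i + s′ * b)) (t * b + 0)
    reach₄ {i} {t} i<g′ t<ā = reach (toPeaks ++ visitPeaks g′ ≤-refl (g∣*b s) ++ toValleys ++
      visitValleys i (<⇒≤ i<g′) (g∣*b s′) ++
        glide t (suc i + s′ * b) 0 λ τ 0<τ τ≤t →
          ¬g∣⇒clock≢0 (¬g∣-shift τ off) , clock-multiple≢0 0<τ (≤-<-trans τ≤t t<ā))
      where
      off : ¬ g ∣ suc i + s′ * b
      off = ¬g∣ (g∣*b s′) i<g′

  -- Turns preserve the two nonzero residues modulo `g` and the offset `t * b` between the clocks;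
  -- with `t` ranging over `Fin ā` these data index the short orbits.
  module Short {j k : ℕ} (j<g′ : j < g′) (k<g′ : k < g′) (t : ℕ) where

    start : State a′ b′
    start = section (suc j) (suc k + t * b)

    off₁ : ¬ g ∣ suc j
    off₁ = subst (λ u → ¬ g ∣ u) (+-identityʳ (suc j)) (¬g∣ (g ∣0) j<g′)

    off₂ : ¬ g ∣ suc k + t * b
    off₂ = ¬g∣ (g∣*b t) k<g′

    away : ∀ n → Path start (n * b) 0 0 (section (n * b + suc j) (n * b + (suc k + t * b)))
    away n = glide n (suc j) (suc k + t * b) λ τ _ _ →
      ¬g∣⇒clock≢0 (¬g∣-shift τ off₁) , ¬g∣⇒clock≢0 (¬g∣-shift τ off₂)

    roundTrip : Path start (ā * b) 0 0 start
    roundTrip = castPath refl refl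
      (cong₂ (λ u v → w u zero v) (clock-period (suc j)) (clock-period (suc k + t * b))) (away ā)

  LongIndex Index : Set
  LongIndex = Fin q ⊎ Fin (ā ∸ q)
  Index     = (Fin ā × Fin g′ × Fin g′) ⊎ LongIndex

  -- These are `s` and `s′`. The first family solves s + s′ = q, the second s + s′ = q + ā; jointly
  -- `before` runs once through 1, ..., ā and `after` once through 0, ..., ā - 1, so either number
  -- determines the orbit.
  before after : LongIndex → ℕ
  before (inj₁ i) = q ∸ toℕ i
  before (inj₂ i) = ā ∸ toℕ i
  after  (inj₁ i) = toℕ i
  after  (inj₂ i) = q + toℕ i

  before>0 : ∀ i → 0 < before i
  before>0 (inj₁ i) = m<n⇒0<n∸m (toℕ<n i)
  before>0 (inj₂ i) = m<n⇒0<n∸m (<-≤-trans (toℕ<n i) (m∸n≤m ā q))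

  before≤ā : ∀ i → before i ≤ ā
  before≤ā (inj₁ i) = ≤-trans (m∸n≤m q (toℕ i)) q≤ā
  before≤ā (inj₂ i) = m∸n≤m ā (toℕ i)

  after<ā : ∀ i → after i < ā
  after<ā (inj₁ i) = <-≤-trans (toℕ<n i) q≤ā
  after<ā (inj₂ i) = subst (q + toℕ i <_) (m+[n∸m]≡n q≤ā) (+-monoʳ-< q (toℕ<n i))

  before+after₁ : ∀ i → before (inj₁ i) + after (inj₁ i) ≡ q
  before+after₁ i = m∸n+n≡m (<⇒≤ (toℕ<n i))

  before+after₂ : ∀ i → before (inj₂ i) + after (inj₂ i) ≡ q + ā
  before+after₂ i = trans (swap (ā ∸ toℕ i) q (toℕ i))
    (cong (q +_) (m∸n+n≡m (<⇒≤ (<-≤-trans (toℕ<n i) (m∸n≤m ā q)))))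
    where
    swap : ∀ u v w → u + (v + w) ≡ v + (u + w)
    swap = solve-∀

  before+after : ∀ i → before i + after i ≡ q ⊎ before i + after i ≡ q + ā
  before+after (inj₁ i) = inj₁ (before+after₁ i)
  before+after (inj₂ i) = inj₂ (before+after₂ i)

  before-surjective : ∀ s → 0 < s → s ≤ ā → ∃[ i ] before i ≡ s
  before-surjective s 0<s s≤ā with s ≤? q
  ... | yes s≤q = inj₁ (fromℕ< q∸s<q) ,
    trans (cong (q ∸_) (toℕ-fromℕ< q∸s<q)) (m∸[m∸n]≡n s≤q)
    where
    q∸s<q : q ∸ s < q
    q∸s<q = ∸-monoʳ-< 0<s s≤q
  ... | no s≰q = inj₂ (fromℕ< ā∸s<) ,
    trans (cong (ā ∸_) (toℕ-fromℕ< ā∸s<)) (m∸[m∸n]≡n s≤ā)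
    where
    ā∸s< : ā ∸ s < ā ∸ q
    ā∸s< = ∸-monoʳ-< (≰⇒> s≰q) s≤ā

  after-surjective : ∀ s′ → s′ < ā → ∃[ i ] after i ≡ s′
  after-surjective s′ s′<ā with s′ <? q
  ... | yes s′<q = inj₁ (fromℕ< s′<q) , toℕ-fromℕ< s′<q
  ... | no s′≮q = inj₂ (fromℕ< s′∸q<) ,
    trans (cong (q +_) (toℕ-fromℕ< s′∸q<)) (m+[n∸m]≡n (≮⇒≥ s′≮q))
    where
    s′∸q< : s′ ∸ q < ā ∸ q
    s′∸q< = ∸-monoˡ-< s′<ā (≮⇒≥ s′≮q)

  module LongAt (i : LongIndex) =
    Long {before i} {after i} (before>0 i) (before≤ā i) (after<ā i) (before+after i)

  module ShortAt (t : Fin ā) (j k : Fin g′) = Short (toℕ<n j) (toℕ<n k) (toℕ t)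

  -- The number of turns of the middle clock during one round of the orbit.
  cycles : Index → ℕ
  cycles (inj₁ _)        = ā
  cycles (inj₂ (inj₁ _)) = q + (g′ * ā + g′ * ā)
  cycles (inj₂ (inj₂ _)) = q + ā + (g′ * ā + g′ * ā)

  visits : Index → ℕ
  visits (inj₁ _) = 0
  visits (inj₂ _) = g

  len : Index → ℕ
  len i = cycles i * b + visits i + visits i

  rep : Index → State a′ b′
  rep (inj₁ (t , j , k)) = ShortAt.start t j k
  rep (inj₂ i)           = LongAt.start i

  roundTrip : ∀ i → Path (rep i) (cycles i * b) (visits i) (visits i) (rep i)
  roundTrip (inj₁ (t , j , k)) = ShortAt.roundTrip t j k
  roundTrip (inj₂ (inj₁ i)) = recount
    (cong (λ n → (n + (g′ * ā + g′ * ā)) * b) (before+after₁ i)) refl refl (LongAt.roundTrip (inj₁ i))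
  roundTrip (inj₂ (inj₂ i)) = recount
    (cong (λ n → (n + (g′ * ā + g′ * ā)) * b) (before+after₂ i)) refl refl (LongAt.roundTrip (inj₂ i))

  Covered : State a′ b′ → Set
  Covered s = ∃[ i ] rep i ⟶ s

  covered-trans : ∀ {s s′} → Covered s → s ⟶ s′ → Covered s′
  covered-trans (i , π) π′ = i , ⟶*-trans π π′

  clock-shift : ∀ t x {y} c → t + x ≡ y ⊎ t + x ≡ y + ā → clock {a′} (x * b + (c + t * b)) ≡ clock (y * b + c)
  clock-shift t x c (inj₁ refl) = cong clock (eq c t x b)
    where
    eq : ∀ c t x b → x * b + (c + t * b) ≡ (t + x) * b + c
    eq = solve-∀
  clock-shift t x {y} c (inj₂ t+x≡) = trans
    (cong clock (trans (eq c t x b) (trans (cong (λ u → u * b + c) t+x≡) (eq′ c y ā b))))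
    (clock-period (y * b + c))
    where
    eq : ∀ c t x b → x * b + (c + t * b) ≡ (t + x) * b + c
    eq = solve-∀
    eq′ : ∀ c y ā b → (y + ā) * b + c ≡ ā * b + (y * b + c)
    eq′ = solve-∀

  -- The divisibility says g + v b ≡ -u b modulo `a`, so both sides are (y - u) b.
  clock-wrap : ∀ {u v x y} → a ∣ (u + v) * b + g → u + x ≡ y + ā →
               clock {a′} (y * b + (g + v * b)) ≡ clock (x * b + 0)
  clock-wrap {u} {v} {x} {y} (divides d eq) u+x≡ = clock-cong b̄ d (begin
    y * b + (g + v * b) + b̄ * a       ≡⟨ cong (y * b + (g + v * b) +_) āb≡b̄a ⟨
    y * b + (g + v * b) + ā * b       ≡⟨ eq₁ y g v ā b ⟩
    (y + ā) * b + (g + v * b)         ≡⟨ cong (λ n → n * b + (g + v * b)) u+x≡ ⟨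
    (u + x) * b + (g + v * b)         ≡⟨ eq₂ u x g v b ⟩
    x * b + 0 + ((u + v) * b + g)     ≡⟨ cong (x * b + 0 +_) eq ⟩
    x * b + 0 + d * a                 ∎)
    where
    open ≡-Reasoning
    eq₁ : ∀ y g v ā b → y * b + (g + v * b) + ā * b ≡ (y + ā) * b + (g + v * b)
    eq₁ = solve-∀
    eq₂ : ∀ u x g v b → (u + x) * b + (g + v * b) ≡ x * b + 0 + ((u + v) * b + g)
    eq₂ = solve-∀

  difference : ∀ {x y} → x < ā → y < ā → ∃[ t ] t < ā × (t + x ≡ y ⊎ t + x ≡ y + ā)
  difference {x} {y} x<ā y<ā with x ≤? y
  ... | yes x≤y = y ∸ x , ≤-<-trans (m∸n≤m y x) y<ā , inj₁ (m∸n+n≡m x≤y)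
  ... | no x≰y = y + ā ∸ x , +-cancelʳ-< x _ _ (subst₂ _<_ (sym split) (+-comm x ā) (+-monoˡ-< ā (≰⇒> x≰y))) , inj₂ split
    where
    split : y + ā ∸ x + x ≡ y + ā
    split = m∸n+n≡m (≤-trans (<⇒≤ x<ā) (m≤n+m ā y))

  -- The difference modulo `ā` is represented in 1, ..., ā, the range of `s`, whereas `difference`
  -- uses 0, ..., ā - 1, the range of `s′`.
  difference>0 : ∀ {x y} → x < ā → y < ā → ∃[ t ] 0 < t × t ≤ ā × (t + x ≡ y ⊎ t + x ≡ y + ā)
  difference>0 {x} {y} x<ā y<ā with x <? y
  ... | yes x<y = y ∸ x , m<n⇒0<n∸m x<y , ≤-trans (m∸n≤m y x) (<⇒≤ y<ā) , inj₁ (m∸n+n≡m (<⇒≤ x<y))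
  ... | no x≮y = y + ā ∸ x , m<n⇒0<n∸m (<-≤-trans x<ā (m≤n+m ā y)) ,
    +-cancelʳ-≤ x _ _ (subst₂ _≤_ (sym split) (+-comm x ā) (+-monoˡ-≤ ā (≮⇒≥ x≮y))) , inj₂ split
    where
    split : y + ā ∸ x + x ≡ y + ā
    split = m∸n+n≡m (≤-trans (<⇒≤ x<ā) (m≤n+m ā y))

  -- g ≡ − q b modulo a, so multiples of g are multiples of b.
  residue : ∀ x → ∃[ j ] ∃[ X ] j < g × X < ā × clock {a′} x ≡ clock (X * b + j)
  residue x = j , X % ā , m%n<n x g , m%n<n X ā , clock-cong (q * n * b̄) (n * m + X / ā * b̄) (begin
    x + q * n * b̄ * a                          ≡⟨ cong (_+ q * n * b̄ * a) (m≡m%n+[m/n]*n x g) ⟩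
    j + n * g + q * n * b̄ * a                  ≡⟨ eq₀ j (n * g) (q * n) b̄ a ⟩
    j + n * g + q * n * (b̄ * a)                ≡⟨ cong (λ u → j + n * g + q * n * u) āb≡b̄a ⟨
    j + n * g + q * n * (ā * b)                ≡⟨ cong (λ u → j + n * g + q * n * (u * b)) ā≡ ⟨
    j + n * g + q * n * (suc (pred ā) * b)     ≡⟨ eq₁ j n g q (pred ā) b ⟩
    j + n * (q * b + g) + X * b                ≡⟨ cong₂ (λ u v → j + n * u + v * b) qb+g≡ma (m≡m%n+[m/n]*n X ā) ⟩
    j + n * (m * a) + (X % ā + X / ā * ā) * b  ≡⟨ eq₂ j n m a (X % ā) (X / ā) ā b ⟩
    X % ā * b + j + (n * m * a + X / ā * (ā * b)) ≡⟨ cong (λ u → X % ā * b + j + (n * m * a + X / ā * u)) āb≡b̄a ⟩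
    X % ā * b + j + (n * m * a + X / ā * (b̄ * a)) ≡⟨ eq₃ (X % ā * b + j) (n * m) (X / ā) b̄ a ⟩
    X % ā * b + j + (n * m + X / ā * b̄) * a    ∎)
    where
    open ≡-Reasoning
    instance
      _ : NonZero ā
      _ = >-nonZero 0<ā
    j n X : ℕ
    j = x % g
    n = x / g
    -- From n g ≡ -q n b; the factor ā - 1 stands for -1 modulo the order `ā` of `b`.
    X = pred ā * (q * n)
    ā≡ : suc (pred ā) ≡ ā
    ā≡ = suc-pred ā
    eq₀ : ∀ j u v w x → j + u + v * w * x ≡ j + u + v * (w * x)
    eq₀ = solve-∀
    eq₁ : ∀ j n g q p b → j + n * g + q * n * ((1 + p) * b) ≡ j + n * (q * b + g) + p * (q * n) * b
    eq₁ = solve-∀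
    eq₂ : ∀ j n m a r k ā b → j + n * (m * a) + (r + k * ā) * b ≡ r * b + j + (n * m * a + k * (ā * b))
    eq₂ = solve-∀
    eq₃ : ∀ r u k w a → r + (u * a + k * (w * a)) ≡ r + (u + k * w) * a
    eq₃ = solve-∀

  ⟶-cong : ∀ {s t t′} → t ≡ t′ → s ⟶ t → s ⟶ t′
  ⟶-cong refl π = π

  -- The residues modulo `g` reveal the phase. Both nonzero: a short orbit. Only the left one
  -- nonzero: among the valleys. Only the right one: among the peaks. Both zero: between two blocks,
  -- where comparing `X` with `Y` tells which block comes next.
  coveredResidue : ∀ j k {X Y} → j < g → k < g → X < ā → Y < ā →
                   Covered (section (X * b + j) (Y * b + k))
  coveredResidue (suc j) (suc k) {X} {Y} (s≤s j<) (s≤s k<) X<ā Y<ā with difference X<ā Y<ā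
  ... | t , t<ā , t+X = inj₁ (fromℕ< t<ā , fromℕ< j< , fromℕ< k<) ,
    ⟶-cong (cong₂ (λ u v → w u zero v)
        (cong (λ u → clock (X * b + suc u)) (toℕ-fromℕ< j<))
        (trans (cong₂ (λ u v → clock (X * b + (suc u + v * b))) (toℕ-fromℕ< k<) (toℕ-fromℕ< t<ā))
          (clock-shift t X (suc k) t+X)))
      (reach (ShortAt.away (fromℕ< t<ā) (fromℕ< j<) (fromℕ< k<) X))
  coveredResidue (suc j) zero {X} {Y} (s≤s j<) _ X<ā Y<ā with difference Y<ā X<ā
  ... | s′ , s′<ā , s′+Y with after-surjective s′ s′<ā
  ...   | i , refl = inj₂ i , ⟶-cong (cong (λ u → w u zero (clock (Y * b + 0))) (clock-shift (after i) Y (suc j) s′+Y))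
      (LongAt.reach₄ i j< Y<ā)
  coveredResidue zero (suc k) {X} {Y} _ (s≤s k<) X<ā Y<ā with difference>0 X<ā Y<ā
  ... | s , 0<s , s≤ā , s+X with before-surjective s 0<s s≤ā
  ...   | i , refl = inj₂ i , ⟶-cong (cong (w (clock (X * b + 0)) zero) (clock-shift (before i) X (suc k) s+X))
      (LongAt.reach₂ i k< X<ā)
  coveredResidue zero zero {X} {Y} _ _ X<ā Y<ā with Y ≤? X
  -- Here `Y` turns have passed since the last visit to the valley, and the choice of `s` makes the
  -- left clock reach 0 at turn `s`; `Y ≤ X` is what ensures `s ≤ ā`.
  ... | yes Y≤X with before-surjective (Y + ā ∸ X) (≤-<-trans z≤n Y<s) s≤ā
    where
    split : Y + ā ∸ X + X ≡ Y + ā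
    split = m∸n+n≡m (≤-trans (<⇒≤ X<ā) (m≤n+m ā Y))
    Y<s : Y < Y + ā ∸ X
    Y<s = +-cancelʳ-< X _ _ (subst (Y + X <_) (sym split) (+-monoʳ-< Y X<ā))
    s≤ā : Y + ā ∸ X ≤ ā
    s≤ā = +-cancelʳ-≤ X _ _ (subst₂ _≤_ (sym split) (+-comm X ā) (+-monoˡ-≤ ā Y≤X))
  ...   | i , eq = inj₂ i , ⟶-cong
      (cong (λ u → w u zero (clock (Y * b + 0)))
        (clock-wrap {before i} {after i} {X} {Y} (a∣nb+g (before+after i)) s+X))
      (LongAt.reach₁ i Y<s)
    where
    s+X : before i + X ≡ Y + ā
    s+X = trans (cong (_+ X) eq) (m∸n+n≡m (≤-trans (<⇒≤ X<ā) (m≤n+m ā Y)))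
    Y<s : Y < before i
    Y<s = +-cancelʳ-< X _ _ (subst (Y + X <_) (sym s+X) (+-monoʳ-< Y X<ā))
  coveredResidue zero zero {X} {Y} _ _ X<ā Y<ā | no Y≰X with after-surjective (X + ā ∸ Y) s′<ā
    where
    s′<ā : X + ā ∸ Y < ā
    s′<ā = +-cancelʳ-< Y _ _ (subst₂ _<_ (sym (m∸n+n≡m (≤-trans (<⇒≤ Y<ā) (m≤n+m ā X))))
      (+-comm Y ā) (+-monoˡ-< ā (≰⇒> Y≰X)))
  ...   | i , eq = inj₂ i , ⟶-cong
      (cong (w (clock (X * b + 0)) zero) (clock-wrap {after i} {before i} {Y} {X}
        (subst (λ n → a ∣ n * b + g) (+-comm (before i) (after i)) (a∣nb+g (before+after i))) s′+Y))
      (LongAt.reach₃ i X<s′)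
    where
    s′+Y : after i + Y ≡ X + ā
    s′+Y = trans (cong (_+ Y) eq) (m∸n+n≡m (≤-trans (<⇒≤ Y<ā) (m≤n+m ā X)))
    X<s′ : X < after i
    X<s′ = +-cancelʳ-< Y _ _ (subst (X + Y <_) (sym s′+Y) (+-monoʳ-< X Y<ā))

  coveredSection : ∀ x y → Covered (section x y)
  coveredSection x y = go (residue x) (residue y)
    where
    go : ∃[ j ] ∃[ X ] j < g × X < ā × clock {a′} x ≡ clock (X * b + j) →
         ∃[ k ] ∃[ Y ] k < g × Y < ā × clock {a′} y ≡ clock (Y * b + k) → Covered (section x y)
    go (j , X , j<g , X<ā , x≈) (k , Y , k<g , Y<ā , y≈) =
      subst Covered (sym (cong₂ (λ u v → w u zero v) x≈ y≈)) (coveredResidue j k j<g k<g X<ā Y<ā)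

  -- Modulo `a`, `x + b * a′` is x - b, so the path starts at the section one turn earlier.
  coveredArrival : ∀ x y → Covered (arriveAt (x + b * a) (y + b * a))
  coveredArrival x y = subst Covered (cong₂ arriveAt (eq x b a′) (eq y b a′))
    (covered-trans (coveredSection (x + b * a′) (y + b * a′)) (reach (turn (x + b * a′) (y + b * a′))))
    where
    eq : ∀ x b a′ → b + (x + b * a′) ≡ x + b * (1 + a′)
    eq = solve-∀

  arrive-covered : ∀ i j → Covered (arrive i zero j)
  arrive-covered i j = subst Covered
    (cong₂ (λ u v → arrive u zero v) (clock-back i) (clock-back j)) (coveredArrival (toℕ i) (toℕ j))
    where
    clock-back : ∀ i → clock (toℕ i + b * a) ≡ i
    clock-back i = trans (clock-cong {a′} {toℕ i + b * a} {toℕ i} 0 b (+-identityʳ _)) (clock-toℕ i)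

  covered : ∀ s → Covered s
  covered (w l m r) = subst Covered (cong₃ (turned l) middle (turned r))
    (covered-trans (coveredSection (start l) (start r))
      (reach (climb (toℕ m) 0 (start l) (start r) (subst (_≤ b′) (sym (+-identityʳ (toℕ m))) (s≤s⁻¹ (toℕ<n m))))))
    where
    start : Fin a → ℕ
    -- This is i - m modulo `a`: the clock is set back to the moment when the middle was empty.
    start i = toℕ i + toℕ m * a′
    cong₃ : ∀ {l l′ m m′ r r′} → l ≡ l′ → m ≡ m′ → r ≡ r′ → w {a′} {b′} l m r ≡ w l′ m′ r′
    cong₃ refl refl refl = refl
    eq : ∀ i m a′ → m + (i + m * a′) + 0 ≡ i + m * (1 + a′)
    eq = solve-∀
    turned : ∀ i → clock (toℕ m + start i) ≡ i
    turned i = trans (clock-cong {a′} {toℕ m + start i} {toℕ i} 0 (toℕ m) (eq (toℕ i) (toℕ m) a′)) (clock-toℕ i)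
    middle : clock (toℕ m + 0) ≡ m
    middle = trans (cong clock (+-identityʳ (toℕ m))) (clock-toℕ m)
  covered (p r)       = arrive-covered zero r
  covered (z (suc l)) = arrive-covered (suc l) zero
  -- The empty ideal is the successor of the full one, which is `p` with the right chain complete.
  covered (z zero)    = covered-trans (covered (p (clock a′))) (1 , cong (enter zero)
    (trans (clock-inc a′) (∣⇒clock≡0 {n = suc a′} ∣-refl)))

  len>0 : ∀ i → 0 < len i
  len>0 (inj₁ _)        = <-≤-trans (*-mono-< 0<ā z<s) (≤-trans (m≤m+n _ 0) (m≤m+n _ 0))
  len>0 (inj₂ (inj₁ _)) = <-≤-trans z<s (m≤n+m g _)
  len>0 (inj₂ (inj₂ _)) = <-≤-trans z<s (m≤n+m g _)

  shortLen longLen₁ longLen₂ : ℕ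
  shortLen = ā * b + 0 + 0
  longLen₁ = (q + (g′ * ā + g′ * ā)) * b + g + g
  longLen₂ = (q + ā + (g′ * ā + g′ * ā)) * b + g + g

  -- Over all listed orbits the turns add up to a², each worth `b` steps, and the visits to `a` for
  -- the valley and `a` for the peak. Writing `ā` as `q + (ā ∸ q)` leaves a polynomial identity.
  pointCount : ā * (g′ * g′) * shortLen + (q * longLen₁ + (ā ∸ q) * longLen₂) ≡ a * (b * a) + (a + a)
  pointCount = subst (λ n → n * (g′ * g′) * (n * b + 0 + 0) +
      (q * ((q + (g′ * n + g′ * n)) * b + g + g) + (ā ∸ q) * ((q + n + (g′ * n + g′ * n)) * b + g + g))
      ≡ a * (b * a) + (a + a)) (m+[n∸m]≡n q≤ā)
    (trans (eq q (ā ∸ q) g′ b)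
      (cong (λ n → n * (b * n) + (n + n)) (trans (cong (_* g) (m+[n∸m]≡n q≤ā)) (sym a≡))))
    where
    eq : ∀ q r h b →
         (q + r) * (h * h) * ((q + r) * b + 0 + 0) +
           (q * ((q + (h * (q + r) + h * (q + r))) * b + (1 + h) + (1 + h)) +
            r * ((q + (q + r) + (h * (q + r) + h * (q + r))) * b + (1 + h) + (1 + h))) ≡
         (q + r) * (1 + h) * (b * ((q + r) * (1 + h))) + ((q + r) * (1 + h) + (q + r) * (1 + h))
    eq = solve-∀

  shortIndex↔ : Fin (ā * (g′ * g′)) ↔ (Fin ā × Fin g′ × Fin g′)
  shortIndex↔ = ↔-trans *↔× (↔-id _ ×-↔ *↔×)

  Point : Set
  Point = ((Fin ā × Fin g′ × Fin g′) × Fin shortLen) ⊎ ((Fin q × Fin longLen₁) ⊎ (Fin (ā ∸ q) × Fin longLen₂))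

  point : Σ Index (Fin ∘ len) → Point
  point (inj₁ i        , t) = inj₁ (i , t)
  point (inj₂ (inj₁ i) , t) = inj₂ (inj₁ (i , t))
  point (inj₂ (inj₂ i) , t) = inj₂ (inj₂ (i , t))

  point-injective : Injective _≡_ _≡_ point
  point-injective {inj₁ _        , _} {inj₁ _        , _} refl = refl
  point-injective {inj₁ _        , _} {inj₂ (inj₁ _) , _} ()
  point-injective {inj₁ _        , _} {inj₂ (inj₂ _) , _} ()
  point-injective {inj₂ (inj₁ _) , _} {inj₂ (inj₁ _) , _} refl = refl
  point-injective {inj₂ (inj₂ _) , _} {inj₂ (inj₂ _) , _} refl = refl

  point↔ : Point ↔ Fin (a * (b * a) + (a + a))
  point↔ = subst (λ n → Point ↔ Fin n) pointCount (↔-sym (↔-trans +↔⊎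
    (↔-trans *↔× (shortIndex↔ ×-↔ ↔-id _) ⊎-↔ ↔-trans +↔⊎ (*↔× ⊎-↔ *↔×))))

  Code : Set
  Code = (Fin a × Fin b × Fin a) ⊎ (Fin a ⊎ Fin a)

  decode : Code → State a′ b′
  decode (inj₁ (l , m , r)) = w l m r
  decode (inj₂ (inj₁ l))    = z l
  decode (inj₂ (inj₂ r))    = p r

  decode-injective : Injective _≡_ _≡_ decode
  decode-injective {inj₁ _}        {inj₁ _}        refl = refl
  decode-injective {inj₁ _}        {inj₂ (inj₁ _)} ()
  decode-injective {inj₁ _}        {inj₂ (inj₂ _)} ()
  decode-injective {inj₂ (inj₁ _)} {inj₂ (inj₁ _)} refl = refl
  decode-injective {inj₂ (inj₂ _)} {inj₂ (inj₂ _)} refl = refl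

  code↔ : Fin (a * (b * a) + (a + a)) ↔ Code
  code↔ = ↔-trans +↔⊎ (↔-trans *↔× (↔-id _ ×-↔ *↔×) ⊎-↔ +↔⊎)

  encodePoint : Σ Index (Fin ∘ len) → Fin (a * (b * a) + (a + a))
  encodePoint = Inverse.to point↔ ∘ point

  encodePoint-injective : Injective _≡_ _≡_ encodePoint
  encodePoint-injective {x} {y} eq =
    point-injective {x} {y} (Injection.injective (Inverse⇒Injection point↔) {point x} {point y} eq)

  nthState : Fin (a * (b * a) + (a + a)) → State a′ b′
  nthState = decode ∘ Inverse.to code↔

  nthState-injective : Injective _≡_ _≡_ nthState
  nthState-injective {x} {y} eq = Injection.injective (Inverse⇒Injection code↔) {x} {y}
    (decode-injective {Inverse.to code↔ x} {Inverse.to code↔ y} eq)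

  closed : ∀ i → iterate step (rep i) (len i) ≡ rep i
  closed i = path-iterate (roundTrip i)

  decomposition : CycleDecomposition (step {a′} {b′}) Index
  decomposition = decompose rep len len>0 closed covered {encodePoint} {nthState}
    encodePoint-injective nthState-injective

-- Ideals and antichains of the fence

module FenceModel (a′ b′ : ℕ) where

  private
    a b : ℕ
    a = suc a′
    b = suc b′

  open Fence a b

  size≡ : #fence a b ≡ a′ + (suc b + a′)
  size≡ = eq a′ b
    where
    eq : ∀ a′ b → a′ + ((1 + a′) + 0) + b ≡ a′ + ((1 + b) + a′)
    eq = solve-∀

  -- The middle positions are counted upwards, from the valley mid 0 to the peak mid b.
  data Position : Set where
    left mid right : ℕ → Position

  data Valid : Position → Set where
    left  : ∀ {i} → i < a′ → Valid (left i)
    mid   : ∀ {h} → h ≤ b → Valid (mid h)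
    right : ∀ {k} → k < a′ → Valid (right k)

  offset : Position → ℕ
  offset (left i)  = i
  offset (mid h)   = a′ + (b ∸ h)
  offset (right k) = a′ + (suc b + k)

  locate : ℕ → Position
  locate i = if i <ᵇ a′ then left i else
    (if i ∸ a′ <ᵇ suc b then mid (b ∸ (i ∸ a′)) else right (i ∸ a′ ∸ suc b))

  <ᵇ-true : ∀ {m n} → m < n → (m <ᵇ n) ≡ true
  <ᵇ-true {zero}  {suc n} _         = refl
  <ᵇ-true {suc m} {suc n} (s≤s m<n) = <ᵇ-true m<n

  <ᵇ-false : ∀ m n → (m + n <ᵇ m) ≡ false
  <ᵇ-false zero    n = refl
  <ᵇ-false (suc m) n = <ᵇ-false m n

  locate-left : ∀ {i} → i < a′ → locate i ≡ left i
  locate-left i<a′ rewrite <ᵇ-true i<a′ = refl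

  locate-mid : ∀ {i} → i < suc b → locate (a′ + i) ≡ mid (b ∸ i)
  locate-mid {i} i<1+b rewrite <ᵇ-false a′ i | m+n∸m≡n a′ i | <ᵇ-true i<1+b = refl

  locate-right : ∀ k → locate (a′ + (suc b + k)) ≡ right k
  locate-right k rewrite <ᵇ-false a′ (suc b + k) | m+n∸m≡n a′ (suc b + k) | <ᵇ-false (suc b) k | m+n∸m≡n b k = refl

  locate-offset : ∀ {x} → Valid x → locate (offset x) ≡ x
  locate-offset (left i<a′)      = locate-left i<a′
  locate-offset (mid {h} h≤b)    =
    trans (locate-mid (s≤s (m∸n≤m b h))) (cong mid (m∸[m∸n]≡n h≤b))
  locate-offset (right {k} k<a′) = locate-right k

  offset< : ∀ {x} → Valid x → offset x < #fence a b
  offset< {x} x-valid = subst (offset x <_) (sym size≡) (go x-valid)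
    where
    go : ∀ {x} → Valid x → offset x < a′ + (suc b + a′)
    go (left i<a′)      = <-≤-trans i<a′ (m≤m+n a′ _)
    go (mid {h} h≤b)    = +-monoʳ-< a′ (<-≤-trans (s≤s (m∸n≤m b h)) (m≤m+n (suc b) a′))
    go (right {k} k<a′) = +-monoʳ-< a′ (+-monoʳ-< (suc b) k<a′)

  at : ∀ {x} → Valid x → Fin (#fence a b)
  at x-valid = fromℕ< (offset< x-valid)

  toℕ-at : ∀ {x} (v : Valid x) → toℕ (at v) ≡ offset x
  toℕ-at v = toℕ-fromℕ< (offset< v)

  position : Fin (#fence a b) → Position
  position x = locate (toℕ x)

  position-at : ∀ {x} (v : Valid x) → position (at v) ≡ x
  position-at v = trans (cong locate (toℕ-at v)) (locate-offset v)

  data Located (i : ℕ) : Set where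
    at-offset : ∀ {x} → Valid x → i ≡ offset x → Located i

  located : ∀ {i} → i < a′ + (suc b + a′) → Located i
  located {i} i< with i <? a′
  ... | yes i<a′ = at-offset (left i<a′) refl
  ... | no i≮a′ with i ∸ a′ <? suc b
  ...   | yes (s≤s d≤b) = at-offset (mid (m∸n≤m b (i ∸ a′)))
    (sym (trans (cong (a′ +_) (m∸[m∸n]≡n d≤b)) (m+[n∸m]≡n (≮⇒≥ i≮a′))))
  ...   | no d≮ = at-offset (right k<a′) (sym split)
    where
    split : a′ + (suc b + (i ∸ a′ ∸ suc b)) ≡ i
    split = trans (cong (a′ +_) (m+[n∸m]≡n (≮⇒≥ d≮))) (m+[n∸m]≡n (≮⇒≥ i≮a′))
    k<a′ : i ∸ a′ ∸ suc b < a′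
    k<a′ = +-cancelˡ-< (suc b) _ _ (+-cancelˡ-< a′ _ _ (subst (_< a′ + (suc b + a′)) (sym split) i<))

  toℕ-located : ∀ x → Located (toℕ x)
  toℕ-located x = located (subst (toℕ x <_) size≡ (toℕ<n x))

  position-valid : ∀ x → Valid (position x)
  position-valid x with toℕ-located x
  ... | at-offset v eq = subst Valid (sym (trans (cong locate eq) (locate-offset v))) v

  offset-position : ∀ x → offset (position x) ≡ toℕ x
  offset-position x with toℕ-located x
  ... | at-offset v eq = trans (cong offset (trans (cong locate eq) (locate-offset v))) (sym eq)

  infix 4 _⋖ₚ_
  data _⋖ₚ_ : Position → Position → Set where
    left-left   : ∀ {i} → left i ⋖ₚ left (suc i)
    left-peak   : ∀ {i} → suc i ≡ a′ → left i ⋖ₚ mid b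
    mid-mid     : ∀ {h} → mid h ⋖ₚ mid (suc h)
    valley-right : mid 0 ⋖ₚ right 0
    right-right : ∀ {k} → right k ⋖ₚ right (suc k)

  ⋖ₚ-valid : ∀ {x y} → x ⋖ₚ y → Valid y → Valid x
  ⋖ₚ-valid left-left        (left i<)  = left (<⇒≤ i<)
  ⋖ₚ-valid (left-peak refl) _          = left ≤-refl
  ⋖ₚ-valid mid-mid          (mid h<)   = mid (<⇒≤ h<)
  ⋖ₚ-valid valley-right     _          = mid z≤n
  ⋖ₚ-valid right-right      (right k<) = right (<⇒≤ k<)

  ⋖ₚ⇒⋖ : ∀ {x y} → position x ⋖ₚ position y → x ⋖ y
  ⋖ₚ⇒⋖ {x} {y} c = go (position x) (position y) (position-valid y) (offset-position x) (offset-position y) c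
    where
    go : ∀ x′ y′ → Valid y′ → offset x′ ≡ toℕ x → offset y′ ≡ toℕ y → x′ ⋖ₚ y′ → x ⋖ y
    go _ _ (left i<) eq eq′ (left-left {i}) =
      rise (inj₁ (subst (λ n → suc n < a) eq (<-trans i< ≤-refl))) (cong suc (trans (sym eq′) (cong suc eq)))
    go _ _ _ eq eq′ (left-peak {i} refl) =
      rise (inj₁ (subst (λ n → suc n < a) eq ≤-refl))
        (cong suc (trans (sym eq′) (trans (trans (cong (a′ +_) (n∸n≡0 b)) (+-identityʳ a′)) (cong suc eq))))
    go _ _ (mid (s≤s h≤)) eq eq′ (mid-mid {h}) =
      fall (subst (λ n → a ≤ suc n × suc n < a + b) eq′ (s≤s (m≤m+n a′ _) , s≤s (+-monoʳ-< a′ (s≤s (m∸n≤m b′ h)))))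
        (cong suc (trans (sym eq) (trans (cong (a′ +_) (+-∸-assoc 1 h≤)) (trans (+-suc a′ _) (cong suc eq′)))))
    go _ _ _ eq eq′ valley-right =
      rise (inj₂ (subst (λ n → a + b ≤ suc n) eq ≤-refl))
        (cong suc (trans (sym eq′) (trans (cong (a′ +_) (+-identityʳ (suc b))) (trans (+-suc a′ b) (cong suc eq)))))
    go _ _ _ eq eq′ (right-right {k}) =
      rise (inj₂ (subst (λ n → a + b ≤ suc n) eq (s≤s (+-monoʳ-≤ a′ (m≤n⇒m≤1+n (m≤m+n b k))))))
        (cong suc (trans (sym eq′) (trans (trans (cong (a′ +_) (+-suc (suc b) k)) (+-suc a′ _)) (cong suc eq))))

  ⋖⇒⋖ₚ : ∀ {x y} → x ⋖ y → position x ⋖ₚ position y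
  ⋖⇒⋖ₚ {x} {y} c = go (position x) (position-valid x) (offset-position x) c
    where
    above : ∀ {x′} → offset x′ ≡ toℕ y → Valid x′ → position y ≡ x′
    above eq v = trans (cong locate (sym eq)) (locate-offset v)
    goFall : ∀ x′ y′ → Valid x′ → Valid y′ → a′ ≤ offset y′ → offset y′ < a′ + b →
             offset x′ ≡ suc (offset y′) → x′ ⋖ₚ y′
    goFall x′ (left i) _ (left i<) a≤ _ _ = contradiction a≤ (<⇒≱ i<)
    goFall x′ (right k) _ _ _ <a+b _ =
      contradiction <a+b (≤⇒≯ (+-monoʳ-≤ a′ (m≤n⇒m≤1+n (m≤m+n b k))))
    goFall x′ (mid zero) _ _ _ <a+b _ = contradiction <a+b (<-irrefl refl)
    goFall x′ (mid (suc h)) v (mid (s≤s h≤)) _ _ eq = subst (_⋖ₚ mid (suc h))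
      (trans (sym (locate-offset {mid h} (mid (m≤n⇒m≤1+n h≤)))) (trans (cong locate
        (trans (trans (cong (a′ +_) (+-∸-assoc 1 h≤)) (+-suc a′ _)) (sym eq))) (locate-offset v)))
      mid-mid
    go : ∀ x′ → Valid x′ → offset x′ ≡ toℕ x → x ⋖ y → x′ ⋖ₚ position y
    go (left i) (left i<) eq (rise _ 1+y≡) with m≤n⇒m<n∨m≡n i<
    ... | inj₁ 1+i< = subst (left i ⋖ₚ_)
      (sym (above (trans (cong suc eq) (sym (suc-injective 1+y≡))) (left 1+i<))) left-left
    ... | inj₂ refl = subst (left i ⋖ₚ_) (sym (above
      (trans (trans (cong (a′ +_) (n∸n≡0 b)) (+-identityʳ a′)) (trans (cong suc eq) (sym (suc-injective 1+y≡))))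
      (mid {b} ≤-refl))) (left-peak refl)
    go (mid h) v eq (rise (inj₁ <a) _) =
      contradiction (subst (λ n → suc n < a) (sym eq) <a) (≤⇒≯ (s≤s (m≤m+n a′ _)))
    go (mid h) (mid h≤) eq (rise (inj₂ a+b≤) 1+y≡) with h
    ... | zero = subst (mid 0 ⋖ₚ_) (sym (trans (cong locate y≡) (locate-right 0))) valley-right
      where
      y≡ : toℕ y ≡ a′ + (suc b + 0)
      y≡ = trans (suc-injective 1+y≡) (trans (cong suc (sym eq))
        (trans (sym (+-suc a′ b)) (cong (a′ +_) (sym (+-identityʳ (suc b))))))
    ... | suc h′ = contradiction (subst (λ n → a + b ≤ suc n) (sym eq) a+b≤)
      (<⇒≱ (s≤s (+-monoʳ-< a′ (s≤s (m∸n≤m b′ h′)))))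
    go (right k) v eq (rise _ 1+y≡) = subst (right k ⋖ₚ_)
      (sym (trans (cong locate y≡) (locate-right (suc k)))) right-right
      where
      y≡ : toℕ y ≡ a′ + (suc b + suc k)
      y≡ = trans (suc-injective 1+y≡) (trans (cong suc (sym eq))
        (trans (sym (+-suc a′ (suc b + k))) (cong (a′ +_) (sym (+-suc (suc b) k)))))
    go x′ v eq (fall (a≤ , <a+b) 1+x≡) = goFall x′ (position y) v (position-valid y)
      (subst (a′ ≤_) (sym (offset-position y)) (s≤s⁻¹ a≤))
      (subst (_< a′ + b) (sym (offset-position y)) (s≤s⁻¹ <a+b))
      (trans eq (trans (suc-injective 1+x≡) (cong suc (sym (offset-position y)))))

  left# mid# right# : State a′ b′ → ℕ
  left# (w l m r)  = toℕ l
  left# (z l)      = toℕ l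
  left# (p r)      = a′
  mid# (w l m r)   = suc (toℕ m)
  mid# (z l)       = 0
  mid# (p r)       = suc b
  right# (w l m r) = toℕ r
  right# (z l)     = 0
  right# (p r)     = toℕ r

  -- The side conditions concern the two junctions: the top of the left chain lies below the peak,
  -- and the valley below the right chain.
  Member Maximal : State a′ b′ → Position → Set
  Member s (left i)   = i < left# s
  Member s (mid h)    = h < mid# s
  Member s (right k)  = k < right# s
  Maximal s (left i)  = suc i ≡ left# s × mid# s ≤ b
  Maximal s (mid h)   = suc h ≡ mid# s × (h ≡ 0 → right# s ≡ 0)
  Maximal s (right k) = suc k ≡ right# s

  member? : ∀ s → Decidable (Member s)
  member? s (left i)  = i <? left# s
  member? s (mid h)   = h <? mid# s
  member? s (right k) = k <? right# s

  maximal? : ∀ s → Decidable (Maximal s)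
  maximal? s (left i)  = (suc i ≟ left# s) ×-dec (mid# s ≤? b)
  maximal? s (mid h)   = (suc h ≟ mid# s) ×-dec ((h ≟ 0) →-dec (right# s ≟ 0))
  maximal? s (right k) = suc k ≟ right# s

  left#≤a′ : ∀ s → left# s ≤ a′
  left#≤a′ (w l m r) = s≤s⁻¹ (toℕ<n l)
  left#≤a′ (z l)     = s≤s⁻¹ (toℕ<n l)
  left#≤a′ (p r)     = ≤-refl

  mid#≤1+b : ∀ s → mid# s ≤ suc b
  mid#≤1+b (w l m r) = ≤-trans (toℕ<n m) (n≤1+n b)
  mid#≤1+b (z l)     = z≤n
  mid#≤1+b (p r)     = ≤-refl

  right#≤a′ : ∀ s → right# s ≤ a′
  right#≤a′ (w l m r) = s≤s⁻¹ (toℕ<n r)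
  right#≤a′ (z l)     = z≤n
  right#≤a′ (p r)     = s≤s⁻¹ (toℕ<n r)

  peak⇒left-full : ∀ s → b < mid# s → left# s ≡ a′
  peak⇒left-full (w l m r) b< = contradiction (s≤s⁻¹ b<) (<⇒≱ (toℕ<n m))
  peak⇒left-full (p r)     _  = refl

  right⇒valley : ∀ s {k} → k < right# s → 0 < mid# s
  right⇒valley (w l m r) _ = z<s
  right⇒valley (p r)     _ = z<s

  Member-down : ∀ s {x y} → x ⋖ₚ y → Member s y → Member s x
  Member-down s left-left        y∈ = <⇒≤ y∈
  Member-down s (left-peak i≡)   y∈ = ≤-reflexive (trans i≡ (sym (peak⇒left-full s y∈)))
  Member-down s mid-mid          y∈ = <⇒≤ y∈
  Member-down s valley-right     y∈ = right⇒valley s y∈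
  Member-down s right-right      y∈ = <⇒≤ y∈

  Maximal⇒Member : ∀ s {x} → Maximal s x → Member s x
  Maximal⇒Member s {left _}  (eq , _) = ≤-reflexive eq
  Maximal⇒Member s {mid _}   (eq , _) = ≤-reflexive eq
  Maximal⇒Member s {right _} eq       = ≤-reflexive eq

  Maximal⇒∉above : ∀ s {x y} → Maximal s x → x ⋖ₚ y → ¬ Member s y
  Maximal⇒∉above s (eq , _)   left-left     y∈ = <⇒≢ y∈ eq
  Maximal⇒∉above s (_ , ≤b)   (left-peak _) y∈ = <⇒≱ y∈ ≤b
  Maximal⇒∉above s (eq , _)   mid-mid       y∈ = <⇒≢ y∈ eq
  Maximal⇒∉above s (_ , r≡0)  valley-right  y∈ = <⇒≢ y∈ (sym (r≡0 refl))
  Maximal⇒∉above s eq         right-right   y∈ = <⇒≢ y∈ eq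

  left-chain : ∀ {i j} → i ≤ j → Star _⋖ₚ_ (left i) (left j)
  left-chain {i} {j} i≤j with m≤n⇒m<n∨m≡n i≤j
  left-chain {j = suc j} _ | inj₁ (s≤s i≤j) = left-chain i≤j ◅◅ (left-left ◅ ε)
  ... | inj₂ refl = ε

  mid-chain : ∀ {h j} → h ≤ j → Star _⋖ₚ_ (mid h) (mid j)
  mid-chain {h} {j} h≤j with m≤n⇒m<n∨m≡n h≤j
  mid-chain {j = suc j} _ | inj₁ (s≤s h≤j) = mid-chain h≤j ◅◅ (mid-mid ◅ ε)
  ... | inj₂ refl = ε

  right-chain : ∀ {k j} → k ≤ j → Star _⋖ₚ_ (right k) (right j)
  right-chain {k} {j} k≤j with m≤n⇒m<n∨m≡n k≤j
  right-chain {j = suc j} _ | inj₁ (s≤s k≤j) = right-chain k≤j ◅◅ (right-right ◅ ε)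
  ... | inj₂ refl = ε

  Member⇒≤Maximal : ∀ s {x} → Valid x → Member s x → ∃[ y ] Valid y × Maximal s y × Star _⋖ₚ_ x y
  Member⇒≤Maximal s {left i} (left i<a′) x∈ with mid# s ≤? b
  -- The peak belongs to the ideal and lies above the whole left chain.
  ... | no mid#≰b = mid b , mid ≤-refl , (≤-antisym (≰⇒> mid#≰b) (mid#≤1+b s) , λ ()) ,
    left-chain (pred-mono-≤ i<a′) ◅◅ (left-peak (suc-pred a′ {{>-nonZero (≤-<-trans z≤n i<a′)}}) ◅ ε)
  ... | yes mid#≤b with left# s in eq | x∈ | left#≤a′ s
  ...   | suc u | s≤s i≤u | u<a′ = left u , left u<a′ , (sym eq , mid#≤b) , left-chain i≤u
  Member⇒≤Maximal s {right k} (right k<a′) x∈ with right# s in eq | x∈ | right#≤a′ s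
  ... | suc u | s≤s k≤u | u<a′ = right u , right u<a′ , sym eq , right-chain k≤u
  Member⇒≤Maximal s {mid h} (mid h≤b) x∈ with mid# s in eq | x∈ | mid#≤1+b s
  ... | suc (suc v) | s≤s h≤v | s≤s v≤b = mid (suc v) , mid v≤b , (sym eq , λ ()) , mid-chain h≤v
  ... | suc zero | s≤s z≤n | _ with right# s in eq′ | right#≤a′ s
  ...   | zero  | _ = mid 0 , mid z≤n , (sym eq , λ _ → eq′) , ε
  -- With the middle empty, the valley is below the top of the right chain.
  ...   | suc u | u<a′ = right u , right u<a′ , sym eq′ , valley-right ◅ right-chain z≤n

  left#-enter : ∀ l r → left# (enter l r) ≡ toℕ l
  left#-enter l zero    = refl
  left#-enter l (suc r) = refl

  right#-enter : ∀ l r → right# (enter l r) ≡ toℕ r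
  right#-enter l zero    = refl
  right#-enter l (suc r) = refl

  mid#-enter : ∀ l r → mid# (enter l r) ≡ 0 ⊎ mid# (enter l r) ≡ 1 × right# (enter l r) ≢ 0
  mid#-enter l zero    = inj₁ refl
  mid#-enter l (suc r) = inj₂ (refl , λ ())

  mid#-enter≤b : ∀ l r → mid# (enter l r) ≤ b
  mid#-enter≤b l zero    = z≤n
  mid#-enter≤b l (suc r) = s≤s z≤n

  right#-arrive : ∀ l m r → right# (arrive l m r) ≡ toℕ r
  right#-arrive l       (suc m) r = refl
  right#-arrive zero    zero    r = refl
  right#-arrive (suc l) zero    r = right#-enter (suc l) r

  -- Each of the three step lemmas is a dichotomy: the chain grows by one, or it cannot grow. Both
  -- inclusions between new maximal elements and old minimal nonmembers use it.
  left-step : ∀ s → (left# s < a′ × left# (step s) ≡ suc (left# s) × mid# (step s) ≤ b)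
                  ⊎ (left# s ≡ a′ × (mid# (step s) ≤ b → left# (step s) ≡ 0))
  left-step (w l m r) with inc l | incView l | inc m
  ... | _ | next l< | suc m′ = inj₁ (l< , cong suc (toℕ-fromℕ< l<) , toℕ<n (suc m′))
  ... | _ | next l< | zero   = inj₁ (l< , trans (left#-enter _ (inc r)) (cong suc (toℕ-fromℕ< l<)) , mid#-enter≤b _ (inc r))
  ... | _ | last l≡ | suc m′ = inj₂ (l≡ , λ _ → refl)
  ... | _ | last l≡ | zero   = inj₂ (l≡ , λ ≤b → contradiction ≤b 1+n≰n)
  left-step (z l) with inc l | incView l
  ... | _ | next l< = inj₁ (l< , cong suc (toℕ-fromℕ< l<) , s≤s z≤n)
  ... | _ | last l≡ = inj₂ (l≡ , λ _ → refl)
  left-step (p r) = inj₂ (refl , λ _ → left#-enter zero (inc r))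

  right-step : ∀ s → (0 < mid# s × right# s < a′ × right# (step s) ≡ suc (right# s))
                   ⊎ ((mid# s ≡ 0 ⊎ right# s ≡ a′) × right# (step s) ≡ 0)
  right-step (w l m r) rewrite right#-arrive (inc l) (inc m) (inc r) with inc r | incView r
  ... | _ | next r< = inj₁ (z<s , r< , cong suc (toℕ-fromℕ< r<))
  ... | _ | last r≡ = inj₂ (inj₂ r≡ , refl)
  right-step (z l) = inj₂ (inj₁ refl , refl)
  right-step (p r) rewrite right#-enter zero (inc r) with inc r | incView r
  ... | _ | next r< = inj₁ (z<s , r< , cong suc (toℕ-fromℕ< r<))
  ... | _ | last r≡ = inj₂ (inj₂ r≡ , refl)

  -- The middle chain fails to grow when it already contains the peak, or when the peak is next but
  -- the left chain is incomplete.
  mid-step : ∀ s → ((mid# s ≡ b → left# s ≡ a′) × mid# (step s) ≡ suc (mid# s) × (mid# s ≡ 0 → right# (step s) ≡ 0))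
                 ⊎ ((mid# s ≤ b → mid# s ≡ b × left# s < a′)
                     × (mid# (step s) ≡ 0 ⊎ mid# (step s) ≡ 1 × right# (step s) ≢ 0))
  mid-step (w l m r) with inc m | incView m | inc l | incView l
  ... | _ | next m< | _ | _       =
    inj₁ ((λ eq → contradiction (suc-injective eq) (<⇒≢ m<)) , cong suc (cong suc (toℕ-fromℕ< m<)) , λ ())
  ... | _ | last m≡ | _ | next l< = inj₂ ((λ _ → cong suc m≡ , l<) , mid#-enter _ (inc r))
  ... | _ | last m≡ | _ | last l≡ = inj₁ ((λ _ → l≡) , cong suc (cong suc (sym m≡)) , λ ())
  mid-step (z l) = inj₁ ((λ ()) , refl , λ _ → refl)
  mid-step (p r) = inj₂ ((λ b< → contradiction b< 1+n≰n) , mid#-enter zero (inc r))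

  -- Members form a down-set, so minimality outside it can be tested on lower covers alone.
  Minimal∉ : State a′ b′ → Position → Set
  Minimal∉ s x = ¬ Member s x × (∀ {y} → y ⋖ₚ x → Member s y)

  Maximal⇒Minimal∉ : ∀ s {x} → Maximal (step s) x → Minimal∉ s x
  Maximal⇒Minimal∉ s {left i} (eq , ≤b) with left-step s
  ... | inj₂ (_ , ≡0) = contradiction (trans eq (≡0 ≤b)) λ ()
  ... | inj₁ (_ , eq′ , _) = (λ i< → <⇒≢ i< i≡) , lower i≡
    where
    i≡ : i ≡ left# s
    i≡ = suc-injective (trans eq eq′)
    lower : ∀ {i} → i ≡ left# s → ∀ {y} → y ⋖ₚ left i → Member s y
    lower i≡ left-left = ≤-reflexive i≡
  Maximal⇒Minimal∉ s {mid h} (eq , r≡0) with mid-step s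
  ... | inj₂ (_ , inj₁ ≡0) = contradiction (trans eq ≡0) λ ()
  ... | inj₂ (_ , inj₂ (≡1 , r≢0)) = contradiction (r≡0 (suc-injective (trans eq ≡1))) r≢0
  ... | inj₁ (full , eq′ , _) = (λ h< → <⇒≢ h< h≡) , lower h≡
    where
    h≡ : h ≡ mid# s
    h≡ = suc-injective (trans eq eq′)
    lower : ∀ {h} → h ≡ mid# s → ∀ {y} → y ⋖ₚ mid h → Member s y
    lower h≡ (left-peak i≡) = ≤-reflexive (trans i≡ (sym (full (sym h≡))))
    lower h≡ mid-mid        = ≤-reflexive h≡
  Maximal⇒Minimal∉ s {right k} eq with right-step s
  ... | inj₂ (_ , ≡0) = contradiction (trans eq ≡0) λ ()
  ... | inj₁ (0<m , _ , eq′) = (λ k< → <⇒≢ k< k≡) , lower k≡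
    where
    k≡ : k ≡ right# s
    k≡ = suc-injective (trans eq eq′)
    lower : ∀ {k} → k ≡ right# s → ∀ {y} → y ⋖ₚ right k → Member s y
    lower k≡ valley-right = 0<m
    lower k≡ right-right  = ≤-reflexive k≡

  Minimal∉⇒Maximal : ∀ s {x} → Valid x → Minimal∉ s x → Maximal (step s) x
  Minimal∉⇒Maximal s {left i} (left i<) (∉ , lower) with ≤-antisym (≮⇒≥ ∉) (below i lower)
    where
    below : ∀ i → (∀ {y} → y ⋖ₚ left i → Member s y) → i ≤ left# s
    below zero    _     = z≤n
    below (suc i) lower = lower left-left
  ... | l≡ with left-step s
  ...   | inj₁ (_ , eq , ≤b) = sym (trans eq (cong suc l≡)) , ≤b
  ...   | inj₂ (l≡a′ , _) = contradiction (trans (sym l≡) l≡a′) (<⇒≢ i<)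
  Minimal∉⇒Maximal s {mid h} (mid h≤) (∉ , lower) with ≤-antisym (≮⇒≥ ∉) (below h lower)
    where
    below : ∀ h → (∀ {y} → y ⋖ₚ mid h → Member s y) → h ≤ mid# s
    below zero    _     = z≤n
    below (suc h) lower = lower mid-mid
  ... | refl with mid-step s
  ...   | inj₁ (_ , eq , r≡0) = sym eq , r≡0
  ...   | inj₂ (stuck , _) with stuck h≤
  -- The candidate is the peak; its lower cover in the left chain would be a member, so that chain
  -- would be complete.
  ...     | m≡b , l<a′ = contradiction l<a′ (≤⇒≯ (subst (_≤ left# s) 1+pred (lower
    (subst (λ n → left (pred a′) ⋖ₚ mid n) (sym m≡b) (left-peak 1+pred)))))
    where
    1+pred : suc (pred a′) ≡ a′
    1+pred = suc-pred a′ {{>-nonZero (≤-<-trans z≤n l<a′)}}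
  Minimal∉⇒Maximal s {right k} (right k<) (∉ , lower) with ≤-antisym (≮⇒≥ ∉) (below k lower)
    where
    below : ∀ k → (∀ {y} → y ⋖ₚ right k → Member s y) → k ≤ right# s
    below zero    _     = z≤n
    below (suc k) lower = lower right-right
  ... | refl with right-step s
  ...   | inj₁ (_ , _ , eq) = sym eq
  ...   | inj₂ (inj₂ r≡a′ , _) = contradiction r≡a′ (<⇒≢ k<)
  ...   | inj₂ (inj₁ m≡0 , _) = contradiction (sym m≡0) (<⇒≢ (valley (right# s) refl lower))
    where
    valley : ∀ k → k ≡ right# s → (∀ {y} → y ⋖ₚ right k → Member s y) → 0 < mid# s
    valley zero    _  lower = lower valley-right
    valley (suc k) eq _     = right⇒valley s (≤-reflexive eq)

-- Tools for chains, ideals and antichains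

unsnoc : ∀ {A : Set} {R : Rel A 0ℓ} {x y} → Star R x y → x ≡ y ⊎ ∃[ v ] Star R x v × R v y
unsnoc ε        = inj₁ refl
unsnoc (r ◅ rs) with unsnoc rs
... | inj₁ refl            = inj₂ (_ , ε , r)
... | inj₂ (v , rs′ , r′) = inj₂ (v , r ◅ rs′ , r′)

comprehension-cong : ∀ {n} {P Q : Pred (Fin n) 0ℓ} (P? : Decidable P) (Q? : Decidable Q) →
                     (∀ x → P x → Q x) → (∀ x → Q x → P x) → comprehension P? ≡ comprehension Q?
comprehension-cong P? Q? P⇒Q Q⇒P = ⊆-antisym
  (λ x∈ → ∈-comprehension⁺ Q? (P⇒Q _ (∈-comprehension⁻ P? x∈)))
  (λ x∈ → ∈-comprehension⁺ P? (Q⇒P _ (∈-comprehension⁻ Q? x∈)))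

-- An ideal meets a chain in an initial segment; this extracts its length, one level of the encoding
-- state.
threshold : ∀ {P : ℕ → Set} → (∀ i → Dec (P i)) → ∀ k → (∀ {i} → suc i < k → P (suc i) → P i) →
            ∃[ u ] u ≤ k × (∀ {i} → i < k → P i ⇔ i < u)
threshold P? zero    down = 0 , z≤n , λ ()
threshold {P} P? (suc k) down with P? k
... | yes Pk = suc k , ≤-refl , λ i<1+k → mk⇔ (λ _ → i<1+k) (λ _ → all k (s≤s⁻¹ i<1+k) ≤-refl Pk)
  where
  all : ∀ {i} j → i ≤ j → j < suc k → P j → P i
  all {i} j i≤j j< Pj with m≤n⇒m<n∨m≡n i≤j
  ... | inj₂ refl = Pj
  all (suc j) _ j< Pj | inj₁ (s≤s i≤j) = all j i≤j (<⇒≤ j<) (down j< Pj)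
... | no ¬Pk with threshold P? k (down ∘ m<n⇒m<1+n)
...   | u , u≤k , P⇔ = u , m≤n⇒m≤1+n u≤k , split
  where
  split : ∀ {i} → i < suc k → P i ⇔ i < u
  split (s≤s i≤k) with m≤n⇒m<n∨m≡n i≤k
  ... | inj₁ i<k  = P⇔ i<k
  ... | inj₂ refl = mk⇔ (λ Pk → contradiction Pk ¬Pk) (λ k<u → contradiction u≤k (<⇒≱ k<u))

threshold-unique : ∀ {u v k} → u ≤ k → (∀ {i} → i < k → i < u → i < v) → u ≤ v
threshold-unique {zero}  _   _ = z≤n
threshold-unique {suc u} u<k h = h u<k ≤-refl

module _ {n} {_⊑_ : Rel (Fin n) 0ℓ} (poset : IsDecPartialOrder _≡_ _⊑_) where
  open Rowmotion poset
  open IsDecPartialOrder poset using () renaming (_≤?_ to _⊑?_; trans to ⊑-trans; antisym to ⊑-antisym; refl to ⊑-refl)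

  -- Refinements store their proofs irrelevantly; decidability allows them to be recomputed.
  isAntichain? : ∀ A → Dec (IsAntichain A)
  isAntichain? A = all? λ x → all? λ y → (x ∈? A) →-dec ((y ∈? A) →-dec ((x ⊑? y) →-dec (x ≟ᶠ y)))

  isIdeal? : ∀ I → Dec (IsIdeal I)
  isIdeal? I = all? λ x → all? λ y → (y ∈? I) →-dec ((x ⊑? y) →-dec (x ∈? I))

  -- An element x of `A` lies below some y of `B`, which lies below some x′ of `A`; the antichain
  -- condition gives x = x′, and antisymmetry x = y.
  generatedIdeal-injective : ∀ {A B} → IsAntichain A → IsAntichain B →
                             generatedIdeal A ≡ generatedIdeal B → A ≡ B
  generatedIdeal-injective A-anti B-anti eq = ⊆-antisym (sub A-anti eq) (sub B-anti (sym eq))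
    where
    sub : ∀ {A B} → IsAntichain A → generatedIdeal A ≡ generatedIdeal B → A ⊆ B
    sub {A} {B} A-anti eq {x} x∈A
      with ∈-comprehension⁻ (generated? B)
             (subst (x ∈_) eq (∈-comprehension⁺ (generated? A) (x , x∈A , ⊑-refl)))
    ... | y , y∈B , x⊑y
      with ∈-comprehension⁻ (generated? A)
             (subst (y ∈_) (sym eq) (∈-comprehension⁺ (generated? B) (y , y∈B , ⊑-refl)))
    ...   | x′ , x′∈A , y⊑x′ with A-anti x x′ x∈A x′∈A (⊑-trans x⊑y y⊑x′)
    ...     | refl with ⊑-antisym x⊑y y⊑x′
    ...       | refl = y∈B

-- Conjugacy of both rowmotions with the step on states

module FenceSets (a′ b′ : ℕ) where

  private
    a b : ℕ
    a = suc a′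
    b = suc b′

  open Fence a b
  open FenceModel a′ b′

  idealSet maximalSet : State a′ b′ → Subset (#fence a b)
  idealSet s   = comprehension (λ x → member? s (position x))
  maximalSet s = comprehension (λ x → maximal? s (position x))

  Member-≼ : ∀ s {x y} → x ≼ y → Member s (position y) → Member s (position x)
  Member-≼ s ε        y∈ = y∈
  Member-≼ s (c ◅ cs) y∈ = Member-down s (⋖⇒⋖ₚ c) (Member-≼ s cs y∈)

  idealSet-isIdeal : ∀ s → IsIdeal (idealSet s)
  idealSet-isIdeal s x y y∈ x≼y = ∈-comprehension⁺ (λ x → member? s (position x))
    (Member-≼ s x≼y (∈-comprehension⁻ (λ x → member? s (position x)) y∈))

  maximalSet-isAntichain : ∀ s → IsAntichain (maximalSet s)
  maximalSet-isAntichain s x y x∈ y∈ ε = refl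
  maximalSet-isAntichain s x y x∈ y∈ (c ◅ cs) = contradiction
    (Member-≼ s cs (Maximal⇒Member s (∈-comprehension⁻ (λ x → maximal? s (position x)) y∈)))
    (Maximal⇒∉above s (∈-comprehension⁻ (λ x → maximal? s (position x)) x∈) (⋖⇒⋖ₚ c))

  Star-valid : ∀ {x y} → Star _⋖ₚ_ x y → Valid y → Valid x
  Star-valid ε        v = v
  Star-valid (c ◅ cs) v = ⋖ₚ-valid c (Star-valid cs v)

  lift-≼ : ∀ {x y} → Star _⋖ₚ_ (position x) y → Valid y → ∃[ y′ ] position y′ ≡ y × x ≼ y′
  lift-≼ {x} cs v = go cs refl v
    where
    go : ∀ {x x′ y} → Star _⋖ₚ_ x′ y → position x ≡ x′ → Valid y → ∃[ y′ ] position y′ ≡ y × x ≼ y′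
    go {x} ε eq v = x , eq , ε
    go {x} (c ◅ cs) refl v with Star-valid cs v
    ... | v₁ with go cs (position-at v₁) v
    ...   | y′ , eq , x₁≼y′ =
      y′ , eq , ⋖ₚ⇒⋖ (subst (position x ⋖ₚ_) (sym (position-at v₁)) c) ◅ x₁≼y′

  generatedIdeal-maximalSet : ∀ s → generatedIdeal (maximalSet s) ≡ idealSet s
  generatedIdeal-maximalSet s = comprehension-cong (generated? (maximalSet s)) (λ x → member? s (position x))
    (λ { x (y , y∈ , x≼y) →
      Member-≼ s x≼y (Maximal⇒Member s (∈-comprehension⁻ (λ x → maximal? s (position x)) y∈)) })
    below
    where
    below : ∀ x → Member s (position x) → ∃[ y ] y ∈ maximalSet s × x ≼ y
    below x x∈ with Member⇒≤Maximal s (position-valid x) x∈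
    ... | y , v , y-max , cs with lift-≼ cs v
    ...   | y′ , refl , x≼y′ = y′ , ∈-comprehension⁺ (λ x → maximal? s (position x)) y-max , x≼y′

  -- Combined with `generatedIdeal-maximalSet`, this single identity yields the conjugacy for
  -- antichains as well as for ideals.
  minimals-∁idealSet : ∀ s → minimals (∁ (idealSet s)) ≡ maximalSet (step s)
  minimals-∁idealSet s =
    comprehension-cong (minimal? (∁ (idealSet s))) (λ x → maximal? (step s) (position x)) to from
    where
    ∈idealSet⁺ : ∀ {x} → Member s (position x) → x ∈ idealSet s
    ∈idealSet⁺ = ∈-comprehension⁺ (λ x → member? s (position x))
    ∈idealSet⁻ : ∀ {x} → x ∈ idealSet s → Member s (position x)
    ∈idealSet⁻ = ∈-comprehension⁻ (λ x → member? s (position x))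
    to : ∀ x → x ∈ ∁ (idealSet s) × (∀ y → y ∈ ∁ (idealSet s) → y ≼ x → y ≡ x) →
         Maximal (step s) (position x)
    to x (x∈ , minimal) = Minimal∉⇒Maximal s (position-valid x) (x∈∁p⇒x∉p x∈ ∘ ∈idealSet⁺ , lower)
      where
      lower : ∀ {y} → y ⋖ₚ position x → Member s y
      lower {y} c with ⋖ₚ-valid c (position-valid x)
      ... | v with member? s y
      ...   | yes y∈ = y∈
      -- A lower cover outside the ideal would equal `x` by minimality, but nothing covers itself.
      ...   | no y∉ = contradiction (minimal (at v)
        (x∉p⇒x∈∁p (λ at∈ → y∉ (subst (Member s) (position-at v) (∈idealSet⁻ at∈))))
        (⋖ₚ⇒⋖ (subst (_⋖ₚ position x) (sym (position-at v)) c) ◅ ε))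
        (λ eq → ⋖ₚ-irrefl c (trans (sym (position-at v)) (cong position eq)))
        where
        ⋖ₚ-irrefl : ∀ {x y} → x ⋖ₚ y → x ≢ y
        ⋖ₚ-irrefl left-left     ()
        ⋖ₚ-irrefl (left-peak _) ()
        ⋖ₚ-irrefl mid-mid       ()
        ⋖ₚ-irrefl valley-right  ()
        ⋖ₚ-irrefl right-right   ()
    from : ∀ x → Maximal (step s) (position x) →
           x ∈ ∁ (idealSet s) × (∀ y → y ∈ ∁ (idealSet s) → y ≼ x → y ≡ x)
    from x x-max with Maximal⇒Minimal∉ s x-max
    ... | x∉ , lower = x∉p⇒x∈∁p (x∉ ∘ ∈idealSet⁻) , minimal
      where
      minimal : ∀ y → y ∈ ∁ (idealSet s) → y ≼ x → y ≡ x
      minimal y y∉ y≼x with unsnoc y≼x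
      ... | inj₁ eq = eq
      ... | inj₂ (x′ , y≼x′ , x′⋖x) =
        contradiction (∈idealSet⁺ (Member-≼ s y≼x′ (lower (⋖⇒⋖ₚ x′⋖x)))) (x∈∁p⇒x∉p y∉)

  toIdeal : State a′ b′ → Ideal
  toIdeal s = idealSet s , [ idealSet-isIdeal s ]

  toAntichain : State a′ b′ → Antichain
  toAntichain s = maximalSet s , [ maximalSet-isAntichain s ]

  ideal-≡ : {I J : Ideal} → value I ≡ value J → I ≡ J
  ideal-≡ refl = refl

  antichain-≡ : {A B : Antichain} → value A ≡ value B → A ≡ B
  antichain-≡ refl = refl

  toIdeal-step : ∀ s → toIdeal (step s) ≡ ρ̂ (toIdeal s)
  toIdeal-step s = ideal-≡ (sym (trans (cong generatedIdeal (minimals-∁idealSet s))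
    (generatedIdeal-maximalSet (step s))))

  toAntichain-step : ∀ s → toAntichain (step s) ≡ ρ (toAntichain s)
  toAntichain-step s = antichain-≡ (sym (trans (cong (minimals ∘ ∁) (generatedIdeal-maximalSet s))
    (minimals-∁idealSet s)))

  levels-injective : ∀ s t → left# s ≡ left# t → mid# s ≡ mid# t → right# s ≡ right# t → s ≡ t
  levels-injective (w l m r) (w l′ m′ r′) l≡ m≡ r≡
    with toℕ-injective l≡ | toℕ-injective (suc-injective m≡) | toℕ-injective r≡
  ... | refl | refl | refl = refl
  levels-injective (z l) (z l′) l≡ _ _ with toℕ-injective l≡
  ... | refl = refl
  levels-injective (p r) (p r′) _ _ r≡ with toℕ-injective r≡
  ... | refl = refl
  levels-injective (w l m r) (p r′) _ m≡ _ = contradiction (suc-injective m≡) (<⇒≢ (toℕ<n m))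
  levels-injective (p r) (w l m r′) _ m≡ _ = contradiction (suc-injective (sym m≡)) (<⇒≢ (toℕ<n m))
  levels-injective (w l m r) (z l′) _ () _
  levels-injective (z l) (w l′ m r) _ () _
  levels-injective (z l) (p r) _ () _
  levels-injective (p r) (z l) _ () _

  idealSet-injective : ∀ {s t} → idealSet s ≡ idealSet t → s ≡ t
  idealSet-injective {s} {t} eq = levels-injective s t
    (≤-antisym (threshold-unique (left#≤a′ s) (transfer eq ∘ left))
               (threshold-unique (left#≤a′ t) (transfer (sym eq) ∘ left)))
    (≤-antisym (threshold-unique (mid#≤1+b s) λ h< → transfer eq (mid (s≤s⁻¹ h<)))
               (threshold-unique (mid#≤1+b t) λ h< → transfer (sym eq) (mid (s≤s⁻¹ h<))))
    (≤-antisym (threshold-unique (right#≤a′ s) (transfer eq ∘ right))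
               (threshold-unique (right#≤a′ t) (transfer (sym eq) ∘ right)))
    where
    transfer : ∀ {s t x} → idealSet s ≡ idealSet t → Valid x → Member s x → Member t x
    transfer {s} {t} eq v x∈ = subst (Member t) (position-at v)
      (∈-comprehension⁻ (λ x → member? t (position x)) (subst (at v ∈_) eq
        (∈-comprehension⁺ (λ x → member? s (position x)) (subst (Member s) (sym (position-at v)) x∈))))

  toIdeal-injective : Injective _≡_ _≡_ toIdeal
  toIdeal-injective eq = idealSet-injective (cong value eq)

  toAntichain-injective : Injective _≡_ _≡_ toAntichain
  toAntichain-injective {s} {t} eq = idealSet-injective (trans (sym (generatedIdeal-maximalSet s))
    (trans (cong (generatedIdeal ∘ value) eq) (generatedIdeal-maximalSet t)))

  module _ (I : Subset (#fence a b)) (I-ideal : IsIdeal I) where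

    -- Comparing offsets makes sense for every position, valid or not, so `threshold` applies to
    -- predicates on all of ℕ.
    Occupied : Position → Set
    Occupied x = ∃[ y ] toℕ y ≡ offset x × y ∈ I

    occupied? : ∀ x → Dec (Occupied x)
    occupied? x = any? λ y → (toℕ y ≟ offset x) ×-dec (y ∈? I)

    Occupied-down : ∀ {x y} → Valid y → x ⋖ₚ y → Occupied y → Occupied x
    Occupied-down {x} {y} v c (y′ , eq , y′∈) = at u , toℕ-at u ,
      I-ideal (at u) y′ y′∈ (⋖ₚ⇒⋖ (subst₂ _⋖ₚ_ (sym (position-at u)) (sym y′≡) c) ◅ ε)
      where
      u : Valid x
      u = ⋖ₚ-valid c v
      y′≡ : position y′ ≡ y
      y′≡ = trans (cong locate eq) (locate-offset v)

    idealSet≡ : ∀ s → (∀ {x} → Valid x → Occupied x ⇔ Member s x) → idealSet s ≡ I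
    idealSet≡ s occ = ⊆-antisym
      (λ {x} x∈ → leave x (Equivalence.from (occ (position-valid x))
        (∈-comprehension⁻ (λ x → member? s (position x)) x∈)))
      (λ {x} x∈ → ∈-comprehension⁺ (λ x → member? s (position x))
        (Equivalence.to (occ (position-valid x)) (x , sym (offset-position x) , x∈)))
      where
      leave : ∀ x → Occupied (position x) → x ∈ I
      leave x (y , eq , y∈) = subst (_∈ I) (toℕ-injective (trans eq (offset-position x))) y∈

    idealSet-surjective : ∃[ s ] idealSet s ≡ I
    idealSet-surjective
      with threshold (occupied? ∘ left) a′ (λ i< → Occupied-down (left i<) left-left)
         | threshold (occupied? ∘ mid) (suc b) (λ h< → Occupied-down (mid (s≤s⁻¹ h<)) mid-mid)
         | threshold (occupied? ∘ right) a′ (λ k< → Occupied-down (right k<) right-right)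
    ... | l , l≤ , l⇔ | m , m≤ , m⇔ | r , r≤ , r⇔ = choose m refl
      where
      occupied⇔ : ∀ s → left# s ≡ l → mid# s ≡ m → right# s ≡ r →
                  ∀ {x} → Valid x → Occupied x ⇔ Member s x
      occupied⇔ s refl refl refl (left i<)  = l⇔ i<
      occupied⇔ s refl refl refl (mid h≤)   = m⇔ (s≤s h≤)
      occupied⇔ s refl refl refl (right k<) = r⇔ k<

      witness : ∀ s → left# s ≡ l → mid# s ≡ m → right# s ≡ r → ∃[ s ] idealSet s ≡ I
      witness s l≡ m≡ r≡ = s , idealSet≡ s (occupied⇔ s l≡ m≡ r≡)

      right-empty : 0 ≡ m → 0 ≡ r
      right-empty 0≡m = go r refl
        where
        go : ∀ k → k ≡ r → 0 ≡ k
        go zero    _   = refl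
        go (suc k) k≡r = contradiction (Equivalence.to (m⇔ z<s)
          (Occupied-down (right 0<a′) valley-right (Equivalence.from (r⇔ 0<a′) 0<r))) (≤⇒≯ (≤-reflexive (sym 0≡m)))
          where
          0<r : 0 < r
          0<r = subst (0 <_) k≡r z<s
          0<a′ : 0 < a′
          0<a′ = <-≤-trans 0<r r≤

      left-full : suc b ≡ m → a′ ≡ l
      left-full 1+b≡m = ≤-antisym (bound a′ refl) l≤
        where
        bound : ∀ k → k ≡ a′ → k ≤ l
        bound zero    _  = z≤n
        bound (suc k) eq = Equivalence.to (l⇔ (≤-reflexive eq))
          (Occupied-down (mid ≤-refl) (left-peak eq) (Equivalence.from (m⇔ ≤-refl) (≤-reflexive 1+b≡m)))

      toFin : ∀ {k} u → u ≤ k → ∃[ i ] toℕ {suc k} i ≡ u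
      toFin u u≤k = fromℕ< (s≤s u≤k) , toℕ-fromℕ< (s≤s u≤k)

      -- The middle level selects the constructor; `right-empty` and `left-full` supply the levels
      -- that `z` and `p` fix.
      choose : ∀ v → v ≡ m → ∃[ s ] idealSet s ≡ I
      choose zero 0≡m with toFin l l≤
      ... | i , i≡ = witness (z i) i≡ 0≡m (right-empty 0≡m)
      choose (suc v) 1+v≡m with m≤n⇒m<n∨m≡n (subst (_≤ suc b) (sym 1+v≡m) m≤) | toFin l l≤ | toFin r r≤
      ... | inj₂ 1+v≡1+b | _      | k , k≡ =
        witness (p k) (left-full (trans (sym 1+v≡1+b) 1+v≡m)) (trans (sym 1+v≡1+b) 1+v≡m) k≡
      ... | inj₁ (s≤s v<b) | i , i≡ | k , k≡ with toFin v (s≤s⁻¹ v<b)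
      ...   | h , h≡ = witness (w i h k) i≡ (trans (cong suc h≡) 1+v≡m) k≡

  toIdeal-surjective : ∀ I → ∃[ s ] toIdeal s ≡ I
  toIdeal-surjective (I , [ I-ideal ]) with idealSet-surjective I (recompute (isIdeal? ≼-isDecPartialOrder I) I-ideal)
  ... | s , eq = s , ideal-≡ eq

  toAntichain-surjective : ∀ A → ∃[ s ] toAntichain s ≡ A
  toAntichain-surjective (A , [ A-anti ]) with idealSet-surjective (generatedIdeal A) (generatedIdeal-isIdeal A)
  ... | s , eq = s , antichain-≡ (generatedIdeal-injective ≼-isDecPartialOrder (maximalSet-isAntichain s)
    (recompute (isAntichain? ≼-isDecPartialOrder A) A-anti) (trans (generatedIdeal-maximalSet s) eq))

  count : (ℕ → Bool) → ℕ → ℕ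
  count f zero    = 0
  count f (suc n) = (if f 0 then 1 else 0) + count (f ∘ suc) n

  ∣tabulate∣ : ∀ (f : ℕ → Bool) n → ∣ tabulate {n = n} (f ∘ toℕ) ∣ ≡ count f n
  ∣tabulate∣ f zero    = refl
  ∣tabulate∣ f (suc n) with f 0
  ... | true  = cong suc (∣tabulate∣ (f ∘ suc) n)
  ... | false = ∣tabulate∣ (f ∘ suc) n

  count-+ : ∀ f m n → count f (m + n) ≡ count f m + count (λ i → f (m + i)) n
  count-+ f zero    n = refl
  count-+ f (suc m) n = trans (cong (_ +_) (count-+ (f ∘ suc) m n)) (sym (+-assoc (if f 0 then 1 else 0) _ _))

  count-cong : ∀ {f h} n → (∀ {i} → i < n → f i ≡ h i) → count f n ≡ count h n
  count-cong zero    eq = refl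
  count-cong (suc n) eq = cong₂ (λ u v → (if u then 1 else 0) + v) (eq z<s) (count-cong n (eq ∘ s<s))

  count-snoc : ∀ f n → count f (suc n) ≡ count f n + (if f n then 1 else 0)
  count-snoc f zero    = +-comm (if f 0 then 1 else 0) 0
  count-snoc f (suc n) = trans (cong ((if f 0 then 1 else 0) +_) (count-snoc (f ∘ suc) n))
    (sym (+-assoc (if f 0 then 1 else 0) _ _))

  -- The fence lists the middle chain from peak to valley, while positions count it upwards.
  count-reverse : ∀ f n → count (λ i → f (n ∸ i)) (suc n) ≡ count f (suc n)
  count-reverse f zero    = refl
  count-reverse f (suc n) = trans (cong ((if f (suc n) then 1 else 0) +_) (count-reverse f n))
    (trans (+-comm (if f (suc n) then 1 else 0) (count f (suc n))) (sym (count-snoc f (suc n))))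

  count-false : ∀ n → count (λ _ → false) n ≡ 0
  count-false zero    = refl
  count-false (suc n) = count-false n

  count-< : ∀ {u} k → u ≤ k → count (λ i → does (i <? u)) k ≡ u
  count-< {zero}  k       _         = count-false k
  count-< {suc u} (suc k) (s≤s u≤k) = cong suc (count-< k u≤k)

  -- The contribution of a chain with `u` members to an antichain: its top, at height u - 1, subject
  -- to the condition `c`.
  pointValue : ℕ → (ℕ → Bool) → ℕ
  pointValue zero    c = 0
  pointValue (suc u) c = if c u then 1 else 0

  count-point : ∀ {u} k (c : ℕ → Bool) → u ≤ k → count (λ i → does (suc i ≟ u) ∧ c i) k ≡ pointValue u c
  count-point {zero}        k       c _         = count-false k
  count-point {suc zero}    (suc k) c _         = trans (cong ((if c 0 then 1 else 0) +_) (count-false k)) (+-identityʳ _)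
  count-point {suc (suc u)} (suc k) c (s≤s u<k) = count-point {suc u} k (c ∘ suc) u<k

  ∣comprehension-position∣ : ∀ {P : Position → Set} (P? : ∀ x → Dec (P x)) →
    ∣ comprehension (λ x → P? (position x)) ∣ ≡
    count (λ i → does (P? (left i))) a′ + (count (λ h → does (P? (mid h))) (suc b) + count (λ k → does (P? (right k))) a′)
  ∣comprehension-position∣ P? = begin
    ∣ comprehension (λ x → P? (position x)) ∣ ≡⟨ ∣tabulate∣ f (#fence a b) ⟩
    count f (#fence a b)                      ≡⟨ cong (count f) size≡ ⟩
    count f (a′ + (suc b + a′))               ≡⟨ count-+ f a′ (suc b + a′) ⟩
    count f a′ + count (λ i → f (a′ + i)) (suc b + a′)
      ≡⟨ cong (count f a′ +_) (count-+ (λ i → f (a′ + i)) (suc b) a′) ⟩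
    count f a′ + (count (λ i → f (a′ + i)) (suc b) + count (λ k → f (a′ + (suc b + k))) a′)
      ≡⟨ cong₂ _+_ (count-cong a′ (λ i< → cong (does ∘ P?) (locate-left i<))) (cong₂ _+_
           (trans (count-cong (suc b) (λ i< → cong (does ∘ P?) (locate-mid i<)))
             (count-reverse (λ h → does (P? (mid h))) b))
           (count-cong a′ (λ {k} _ → cong (does ∘ P?) (locate-right k)))) ⟩
    count (λ i → does (P? (left i))) a′ + (count (λ h → does (P? (mid h))) (suc b) + count (λ k → does (P? (right k))) a′) ∎
    where
    open ≡-Reasoning
    f : ℕ → Bool
    f i = does (P? (locate i))

  χ̂-toIdeal : ∀ s → χ̂ (toIdeal s) ≡ left# s + (mid# s + right# s)
  χ̂-toIdeal s = trans (∣comprehension-position∣ (member? s))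
    (cong₂ _+_ (count-< a′ (left#≤a′ s)) (cong₂ _+_ (count-< (suc b) (mid#≤1+b s)) (count-< a′ (right#≤a′ s))))

  χ-toAntichain : ∀ s → χ (toAntichain s) ≡
    pointValue (left# s) (λ _ → does (mid# s ≤? b)) +
      (pointValue (mid# s) (λ h → does ((h ≟ 0) →-dec (right# s ≟ 0))) + pointValue (right# s) (λ _ → true))
  χ-toAntichain s = trans (∣comprehension-position∣ (maximal? s))
    (cong₂ _+_ (count-point a′ _ (left#≤a′ s)) (cong₂ _+_ (count-point (suc b) _ (mid#≤1+b s))
      (trans (count-cong a′ (λ {k} _ → sym (∧-identityʳ (does (suc k ≟ right# s)))))
        (count-point a′ (λ _ → true) (right#≤a′ s)))))

-- Totals of χ and χ̂

module _ {k : ℕ} where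

  -- Over a full turn, `nonzero` averages k / (k + 1) and the clock value k / 2. The potentials
  -- correcting the deviation are `drop`, the number of ticks until the clock next shows 0, and
  -- `quad`.
  nonzero drop quad : Fin (suc k) → ℕ
  nonzero zero    = 0
  nonzero (suc i) = 1
  drop zero       = 0
  drop (suc i)    = k ∸ toℕ i
  quad i          = toℕ i * (suc k ∸ toℕ i)

  drop-inc : ∀ i → suc k * nonzero i + drop (inc i) ≡ k + drop i
  drop-inc zero with inc {k} zero | incView {k} zero
  ... | _ | next 0<k = trans (cong₂ _+_ (*-zeroʳ k) (cong (k ∸_) (toℕ-fromℕ< 0<k))) (+-comm 0 k)
  ... | _ | last 0≡k = trans (+-identityʳ (k * 0)) (trans (*-zeroʳ k) (trans 0≡k (sym (+-identityʳ k))))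
  drop-inc (suc i) with inc (suc i) | incView (suc i)
  ... | _ | next i<k = begin
      suc k * 1 + (k ∸ toℕ (fromℕ< i<k)) ≡⟨ cong₂ _+_ (*-identityʳ (suc k)) (cong (k ∸_) (toℕ-fromℕ< i<k)) ⟩
      suc k + (k ∸ suc (toℕ i))          ≡⟨ +-suc k (k ∸ suc (toℕ i)) ⟨
      k + suc (k ∸ suc (toℕ i))          ≡⟨ cong (k +_) (+-∸-assoc 1 (<⇒≤ i<k)) ⟨
      k + (k ∸ toℕ i)                    ∎
      where open ≡-Reasoning
  ... | _ | last 1+i≡k = begin
      suc k * 1 + 0          ≡⟨ trans (+-identityʳ (suc k * 1)) (*-identityʳ (suc k)) ⟩
      suc k                  ≡⟨ +-comm 1 k ⟩
      k + 1                  ≡⟨ cong (k +_) (m+n∸n≡m 1 (toℕ i)) ⟨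
      k + (suc (toℕ i) ∸ toℕ i) ≡⟨ cong (λ n → k + (n ∸ toℕ i)) 1+i≡k ⟩
      k + (k ∸ toℕ i)        ∎
      where open ≡-Reasoning

  quad-inc : ∀ i → 2 * toℕ i + quad (inc i) ≡ k + quad i
  quad-inc i with inc i | incView i
  ... | _ | next i<k = begin
      2 * toℕ i + suc (toℕ (fromℕ< i<k)) * (suc k ∸ suc (toℕ (fromℕ< i<k)))
        ≡⟨ cong (λ n → 2 * toℕ i + suc n * (k ∸ n)) (toℕ-fromℕ< i<k) ⟩
      2 * toℕ i + suc (toℕ i) * (k ∸ toℕ i)        ≡⟨ eq (toℕ i) (k ∸ toℕ i) ⟩
      toℕ i + (k ∸ toℕ i) + toℕ i * suc (k ∸ toℕ i)
        ≡⟨ cong₂ (λ u v → u + toℕ i * v) (m+[n∸m]≡n (<⇒≤ i<k)) (sym (+-∸-assoc 1 (<⇒≤ i<k))) ⟩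
      k + toℕ i * (suc k ∸ toℕ i)                  ∎
      where
      open ≡-Reasoning
      eq : ∀ i e → 2 * i + (1 + i) * e ≡ i + e + i * (1 + e)
      eq = solve-∀
  ... | _ | last i≡k = begin
      2 * toℕ i + 0                             ≡⟨ eq (toℕ i) ⟩
      toℕ i + toℕ i * 1                         ≡⟨ cong (λ n → toℕ i + toℕ i * n) (m+n∸n≡m 1 (toℕ i)) ⟨
      toℕ i + toℕ i * (suc (toℕ i) ∸ toℕ i)     ≡⟨ cong (λ n → n + toℕ i * (suc n ∸ toℕ i)) i≡k ⟩
      k + toℕ i * (suc k ∸ toℕ i)               ∎
      where
      open ≡-Reasoning
      eq : ∀ i → 2 * i + 0 ≡ i + i * 1
      eq = solve-∀

module FenceTotals (a′ b′ : ℕ) where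

  private
    a b : ℕ
    a = suc a′
    b = suc b′

  open Fence a b
  open FenceModel a′ b′
  open FenceSets a′ b′

  -- Indicates that the valley is itself a maximal element of the ideal.
  bothZero : ∀ {m r} → Fin (suc m) → Fin (suc r) → ℕ
  bothZero zero    zero    = 1
  bothZero zero    (suc _) = 0
  bothZero (suc _) _       = 0

  pointValue-nonzero : ∀ {k} (i : Fin (suc k)) → pointValue (toℕ i) (λ _ → true) ≡ nonzero i
  pointValue-nonzero zero    = refl
  pointValue-nonzero (suc i) = refl

  χ-w : ∀ l m r → χ (toAntichain (w l m r)) ≡ nonzero l + (nonzero m + nonzero r + bothZero m r)
  χ-w l m r rewrite χ-toAntichain (w l m r) | dec-true (suc (toℕ m) ≤? b) (toℕ<n m) | pointValue-nonzero l =
    cong (nonzero l +_) (rest m r)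
    where
    rest : ∀ m r → pointValue (suc (toℕ m)) (λ h → does ((h ≟ 0) →-dec (toℕ r ≟ 0)))
                     + pointValue (toℕ r) (λ _ → true)
                 ≡ nonzero m + nonzero r + bothZero m r
    rest zero    zero    = refl
    rest zero    (suc r) = refl
    rest (suc m) zero    = refl
    rest (suc m) (suc r) = refl

  χ-z : ∀ l → χ (toAntichain (z l)) ≡ nonzero l
  χ-z l rewrite χ-toAntichain (z l) | pointValue-nonzero l = +-identityʳ (nonzero l)

  χ-p : ∀ r → χ (toAntichain (p r)) ≡ 1 + nonzero r
  χ-p r rewrite χ-toAntichain (p r) | pointValue-nonzero r = cong (_+ suc (nonzero r)) (hidden a′)
    where
    hidden : ∀ u → pointValue u (λ _ → does (suc b ≤? b)) ≡ 0
    hidden zero = refl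
    hidden (suc u) rewrite dec-false (suc b ≤? b) 1+n≰n = refl

  -- A state `w` with middle and right clocks at 0 is entered only from `z`. The term with
  -- `bothZero` charges the valley in its antichain to that preceding `z`.
  χ-potential χ̂-potential : State a′ b′ → ℕ
  χ-potential (w l m r) = b * drop l + (a * drop m + b * drop r) + a * b * bothZero m r
  χ-potential (z l)     = b * drop l
  χ-potential (p r)     = b * drop r
  χ̂-potential (w l m r) = quad l + (quad m + quad r)
  χ̂-potential (z l)     = quad l
  χ̂-potential (p r)     = quad r

  χ-potential-enter : ∀ l r → χ-potential (enter l r) ≡ b * drop l + b * drop r
  χ-potential-enter l zero    = sym (trans (cong (b * drop l +_) (*-zeroʳ b)) (+-identityʳ _))
  χ-potential-enter l (suc r) = eq (b * drop l) a (b * drop (suc r)) (a * b)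
    where
    eq : ∀ u a v c → u + (a * 0 + v) + c * 0 ≡ u + v
    eq = solve-∀

  χ-potential-arrive : ∀ l m r → χ-potential (arrive l m r) ≡ b * drop l + (a * drop m + b * drop r)
  χ-potential-arrive l       (suc m) r =
    trans (cong (b * drop l + (a * drop (suc m) + b * drop r) +_) (*-zeroʳ (a * b))) (+-identityʳ _)
  χ-potential-arrive zero    zero    r = eq a b (b * drop r)
    where
    eq : ∀ a b v → v ≡ b * 0 + (a * 0 + v)
    eq = solve-∀
  χ-potential-arrive (suc l) zero    r = trans (χ-potential-enter (suc l) r) (eq (b * drop (suc l)) a (b * drop r))
    where
    eq : ∀ u a v → u + v ≡ u + (a * 0 + v)
    eq = solve-∀

  χ̂-potential-enter : ∀ l r → χ̂-potential (enter l r) ≡ quad l + quad r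
  χ̂-potential-enter l zero    = sym (+-identityʳ (quad l))
  χ̂-potential-enter l (suc r) = refl

  χ̂-potential-arrive : ∀ l m r → χ̂-potential (arrive l m r) ≡ quad l + (quad m + quad r)
  χ̂-potential-arrive l       (suc m) r = refl
  χ̂-potential-arrive zero    zero    r = refl
  χ̂-potential-arrive (suc l) zero    r = χ̂-potential-enter (suc l) r

  -- These are `a * b` times mean values: three chain averages for `w`; for `z` and `p` one chain
  -- average plus 1 for the valley charged to `z` or for the peak.
  wWeight eventWeight : ℕ
  wWeight     = b * a′ + (a * b′ + b * a′)
  eventWeight = b * a′ + a * b

  χ-local : ∀ s → a * b * χ (toAntichain s) + χ-potential (step s)
                ≡ weight wWeight eventWeight eventWeight s + χ-potential s
  χ-local (w l m r) rewrite χ-w l m r | χ-potential-arrive (inc l) (inc m) (inc r) = begin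
    a * b * (nonzero l + (nonzero m + nonzero r + o)) + (b * drop (inc l) + (a * drop (inc m) + b * drop (inc r)))
      ≡⟨ eq a b (nonzero l) (nonzero m) (nonzero r) o (drop (inc l)) (drop (inc m)) (drop (inc r)) ⟩
    b * (a * nonzero l + drop (inc l))
      + (a * (b * nonzero m + drop (inc m)) + b * (a * nonzero r + drop (inc r))) + a * b * o
      ≡⟨ cong₂ (λ u v → b * u + v + a * b * o) (drop-inc l) (cong₂ (λ u v → a * u + b * v) (drop-inc m) (drop-inc r)) ⟩
    b * (a′ + drop l) + (a * (b′ + drop m) + b * (a′ + drop r)) + a * b * o
      ≡⟨ eq′ a b a′ b′ (drop l) (drop m) (drop r) (a * b * o) ⟩
    wWeight + (b * drop l + (a * drop m + b * drop r) + a * b * o) ∎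
    where
    open ≡-Reasoning
    o : ℕ
    o = bothZero m r
    eq : ∀ a b i j k o u v x → a * b * (i + (j + k + o)) + (b * u + (a * v + b * x))
                             ≡ b * (a * i + u) + (a * (b * j + v) + b * (a * k + x)) + a * b * o
    eq = solve-∀
    eq′ : ∀ a b c d u v x o → b * (c + u) + (a * (d + v) + b * (c + x)) + o
                            ≡ b * c + (a * d + b * c) + (b * u + (a * v + b * x) + o)
    eq′ = solve-∀
  χ-local (z l) rewrite χ-z l = begin
    a * b * nonzero l + (b * drop (inc l) + (a * 0 + b * 0) + a * b * 1) ≡⟨ eq a b (nonzero l) (drop (inc l)) ⟩
    b * (a * nonzero l + drop (inc l)) + a * b                           ≡⟨ cong (λ u → b * u + a * b) (drop-inc l) ⟩
    b * (a′ + drop l) + a * b                                            ≡⟨ eq′ a b a′ (drop l) ⟩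
    eventWeight + b * drop l                                             ∎
    where
    open ≡-Reasoning
    eq : ∀ a b i u → a * b * i + (b * u + (a * 0 + b * 0) + a * b * 1) ≡ b * (a * i + u) + a * b
    eq = solve-∀
    eq′ : ∀ a b c u → b * (c + u) + a * b ≡ b * c + a * b + b * u
    eq′ = solve-∀
  χ-local (p r) rewrite χ-p r | χ-potential-enter zero (inc r) = begin
    a * b * (1 + nonzero r) + (b * 0 + b * drop (inc r)) ≡⟨ eq a b (nonzero r) (drop (inc r)) ⟩
    b * (a * nonzero r + drop (inc r)) + a * b           ≡⟨ cong (λ u → b * u + a * b) (drop-inc r) ⟩
    b * (a′ + drop r) + a * b                            ≡⟨ eq′ a b a′ (drop r) ⟩
    eventWeight + b * drop r                             ∎
    where
    open ≡-Reasoning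
    eq : ∀ a b i u → a * b * (1 + i) + (b * 0 + b * u) ≡ b * (a * i + u) + a * b
    eq = solve-∀
    eq′ : ∀ a b c u → b * (c + u) + a * b ≡ b * c + a * b + b * u
    eq′ = solve-∀

  -- The weight of `z` falls short of n by as much as that of `p` exceeds it. Since every orbit
  -- visits both equally often, the average weight is n.
  χ̂-local : ∀ s → 2 * χ̂ (toIdeal s) + χ̂-potential (step s)
                ≡ weight (#fence a b) a′ (2 * (a′ + suc b) + a′) s + χ̂-potential s
  χ̂-local (w l m r) rewrite χ̂-toIdeal (w l m r) | χ̂-potential-arrive (inc l) (inc m) (inc r) = begin
    2 * (toℕ l + (suc (toℕ m) + toℕ r)) + (quad (inc l) + (quad (inc m) + quad (inc r)))
      ≡⟨ eq (toℕ l) (toℕ m) (toℕ r) (quad (inc l)) (quad (inc m)) (quad (inc r)) ⟩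
    2 * toℕ l + quad (inc l) + (2 * toℕ m + quad (inc m) + (2 * toℕ r + quad (inc r))) + 2
      ≡⟨ cong₂ (λ u v → u + v + 2) (quad-inc l) (cong₂ _+_ (quad-inc m) (quad-inc r)) ⟩
    a′ + quad l + (b′ + quad m + (a′ + quad r)) + 2
      ≡⟨ eq′ a′ b′ (quad l) (quad m) (quad r) ⟩
    #fence a b + (quad l + (quad m + quad r)) ∎
    where
    open ≡-Reasoning
    eq : ∀ i j k u v x → 2 * (i + ((1 + j) + k)) + (u + (v + x)) ≡ 2 * i + u + (2 * j + v + (2 * k + x)) + 2
    eq = solve-∀
    eq′ : ∀ c d u v x → c + u + (d + v + (c + x)) + 2 ≡ c + (1 + (c + 0)) + (1 + d) + (u + (v + x))
    eq′ = solve-∀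
  χ̂-local (z l) rewrite χ̂-toIdeal (z l) = begin
    2 * (toℕ l + 0) + (quad (inc l) + 0) ≡⟨ eq (toℕ l) (quad (inc l)) ⟩
    2 * toℕ l + quad (inc l)             ≡⟨ quad-inc l ⟩
    a′ + quad l                          ∎
    where
    open ≡-Reasoning
    eq : ∀ i u → 2 * (i + 0) + (u + 0) ≡ 2 * i + u
    eq = solve-∀
  χ̂-local (p r) rewrite χ̂-toIdeal (p r) | χ̂-potential-enter zero (inc r) = begin
    2 * (a′ + (suc b + toℕ r)) + quad (inc r)       ≡⟨ eq a′ (suc b) (toℕ r) (quad (inc r)) ⟩
    2 * (a′ + suc b) + (2 * toℕ r + quad (inc r))   ≡⟨ cong (2 * (a′ + suc b) +_) (quad-inc r) ⟩
    2 * (a′ + suc b) + (a′ + quad r)                ≡⟨ +-assoc (2 * (a′ + suc b)) a′ (quad r) ⟨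
    2 * (a′ + suc b) + a′ + quad r                  ∎
    where
    open ≡-Reasoning
    eq : ∀ c d i u → 2 * (c + (d + i)) + u ≡ 2 * (c + d) + (2 * i + u)
    eq = solve-∀

-- Orbit classes and the theorem

open import Data.Integer.Base using (+_)

OrbitClasses : {X : Set} → (X → X) → (#𝒮 #ℳ #ℒ ℓ𝒮 ℓℳ ℓℒ : ℕ) → Set₁
OrbitClasses f #𝒮 #ℳ #ℒ ℓ𝒮 ℓℳ ℓℒ =
  Σ[ 𝒮 ∈ Pred (Orbit f) 0ℓ ] Σ[ ℳ ∈ Pred (Orbit f) 0ℓ ] Σ[ ℒ ∈ Pred (Orbit f) 0ℓ ]
    IsPartitionByLength 𝒮 ℳ ℒ
    × (# 𝒮 ≐ #𝒮)
    × (# ℳ ≐ #ℳ)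
    × (# ℒ ≐ #ℒ)
    × (∀ O → 𝒮 O → size O ≡ ℓ𝒮)
    × (∀ O → ℳ O → size O ≡ ℓℳ)
    × (∀ O → ℒ O → size O ≡ ℓℒ)

partitionByLength : ∀ {X : Set} {f : X → X} {ℓ𝒮 ℓℳ ℓℒ : ℕ} → ℓ𝒮 ≢ ℓℳ → ℓ𝒮 ≢ ℓℒ → ℓℳ ≢ ℓℒ →
  ((O : Orbit f) → size O ≡ ℓ𝒮 ⊎ size O ≡ ℓℳ ⊎ size O ≡ ℓℒ) →
  IsPartitionByLength {f = f} (λ O → size O ≡ ℓ𝒮) (λ O → size O ≡ ℓℳ) (λ O → size O ≡ ℓℒ)
partitionByLength {f = f} {ℓ𝒮} {ℓℳ} {ℓℒ} 𝒮≢ℳ 𝒮≢ℒ ℳ≢ℒ cover = record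
  { cover     = cover
  ; disjoint₁ = λ (x , y) → 𝒮≢ℳ (trans (sym x) y)
  ; disjoint₂ = λ (x , y) → 𝒮≢ℒ (trans (sym x) y)
  ; disjoint₃ = λ (x , y) → ℳ≢ℒ (trans (sym x) y)
  ; uniform   = λ O₁ O₂ → mk⇔ (same O₁ O₂) (λ eq → together O₁ O₂ eq (cover O₁))
  }
  where
  Together : Orbit f → Orbit f → Set
  Together O₁ O₂ = (size O₁ ≡ ℓ𝒮 × size O₂ ≡ ℓ𝒮) ⊎ (size O₁ ≡ ℓℳ × size O₂ ≡ ℓℳ) ⊎ (size O₁ ≡ ℓℒ × size O₂ ≡ ℓℒ)
  same : ∀ O₁ O₂ → Together O₁ O₂ → size O₁ ≡ size O₂
  same _ _ (inj₁ (x , y))        = trans x (sym y)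
  same _ _ (inj₂ (inj₁ (x , y))) = trans x (sym y)
  same _ _ (inj₂ (inj₂ (x , y))) = trans x (sym y)
  together : ∀ O₁ O₂ → size O₁ ≡ size O₂ →
             size O₁ ≡ ℓ𝒮 ⊎ size O₁ ≡ ℓℳ ⊎ size O₁ ≡ ℓℒ → Together O₁ O₂
  together _ _ eq (inj₁ x)        = inj₁ (x , trans (sym eq) x)
  together _ _ eq (inj₂ (inj₁ x)) = inj₂ (inj₁ (x , trans (sym eq) x))
  together _ _ eq (inj₂ (inj₂ x)) = inj₂ (inj₂ (x , trans (sym eq) x))

module FenceOrbits (a′ b′ ā b̄ g′ m q : ℕ)
                   (a≡ : suc a′ ≡ ā * suc g′) (b≡ : suc b′ ≡ b̄ * suc g′)
                   (mā≡ : m * ā ≡ q * b̄ + 1) (1≤q : 1 ≤ q) (q≤ā : q ≤ ā) (2≤a : 2 ≤ suc a′) where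

  private
    a b g : ℕ
    a = suc a′
    b = suc b′
    g = suc g′

  open Fence a b
  open FenceModel a′ b′
  open FenceSets a′ b′
  open FenceTotals a′ b′
  open Orbits a′ b′ ā b̄ g′ m q a≡ b≡ mā≡ 1≤q q≤ā

  short<long₂ : shortLen < longLen₂
  short<long₂ = begin-strict
    ā * b + 0 + 0                               ≡⟨ trans (+-identityʳ _) (+-identityʳ _) ⟩
    ā * b                                       ≤⟨ *-monoˡ-≤ b (≤-trans (m≤n+m ā q) (m≤m+n (q + ā) _)) ⟩
    (q + ā + (g′ * ā + g′ * ā)) * b             <⟨ m<m+n _ {g + g} z<s ⟩
    (q + ā + (g′ * ā + g′ * ā)) * b + (g + g)   ≡⟨ +-assoc _ g g ⟨
    longLen₂                                    ∎
    where open ≤-Reasoning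

  long₁<long₂ : longLen₁ < longLen₂
  long₁<long₂ = +-monoˡ-< g (+-monoˡ-< g (*-monoˡ-< b (+-monoˡ-< (g′ * ā + g′ * ā) (m<m+n q 0<ā))))

  -- For g > 1 the long orbit has at least `ā` turns and visits besides. For g = 1 equality would
  -- give b̄ a = m a + 1, so `a` would divide 1. There are no short orbits then, but the parts are
  -- defined by their lengths, which must still differ.
  short≢long₁ : shortLen ≢ longLen₁
  short≢long₁ eq = go g′ refl
    where
    short≡ : ā * b ≡ longLen₁
    short≡ = trans (sym (trans (+-identityʳ _) (+-identityʳ _))) eq
    go : ∀ h → h ≡ g′ → ⊥
    go (suc h) refl = <-irrefl short≡ (begin-strict
      ā * b                             ≤⟨ *-monoˡ-≤ b (≤-trans (m≤m+n ā (h * ā)) (≤-trans (m≤m+n _ _) (m≤n+m _ q))) ⟩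
      (q + (g′ * ā + g′ * ā)) * b             <⟨ m<m+n _ {g + g} z<s ⟩
      (q + (g′ * ā + g′ * ā)) * b + (g + g)   ≡⟨ +-assoc _ g g ⟨
      longLen₁                          ∎)
      where open ≤-Reasoning
    go zero refl = <⇒≱ 2≤a (∣⇒≤ (∣m+n∣m⇒∣n (divides b̄ (begin
      m * a + 1                    ≡⟨ cong (_+ 1) qb+g≡ma ⟨
      q * b + 1 + 1                ≡⟨ cong (λ u → u * b + 1 + 1) (+-identityʳ q) ⟨
      (q + 0) * b + 1 + 1          ≡⟨ short≡ ⟨
      ā * b                        ≡⟨ āb≡b̄a ⟩
      b̄ * a                        ∎)) (divides m refl)))
      where open ≡-Reasoning

  -- The total of χ depends only on the numbers of turns and visits, so this is homometry at the
  -- level of indices.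
  same-length : ∀ i j → len i ≡ len j → cycles i ≡ cycles j × visits i ≡ visits j
  same-length (inj₁ _)        (inj₁ _)        _  = refl , refl
  same-length (inj₂ (inj₁ _)) (inj₂ (inj₁ _)) _  = refl , refl
  same-length (inj₂ (inj₂ _)) (inj₂ (inj₂ _)) _  = refl , refl
  same-length (inj₁ _)        (inj₂ (inj₁ _)) eq = contradiction eq short≢long₁
  same-length (inj₁ _)        (inj₂ (inj₂ _)) eq = contradiction eq (<⇒≢ short<long₂)
  same-length (inj₂ (inj₁ _)) (inj₁ _)        eq = contradiction (sym eq) short≢long₁
  same-length (inj₂ (inj₁ _)) (inj₂ (inj₂ _)) eq = contradiction eq (<⇒≢ long₁<long₂)
  same-length (inj₂ (inj₂ _)) (inj₁ _)        eq = contradiction (sym eq) (<⇒≢ short<long₂)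
  same-length (inj₂ (inj₂ _)) (inj₂ (inj₁ _)) eq = contradiction (sym eq) (<⇒≢ long₁<long₂)

  orbitStructure : ∀ {X} {f : X → X} (D : CycleDecomposition f Index) →
                   (∀ i → CycleDecomposition.len D i ≡ len i) →
                   OrbitClasses f (ā * (g′ * g′)) q (ā ∸ q) shortLen longLen₁ longLen₂
  orbitStructure {f = f} D len≡ = _ , _ , _ ,
    partitionByLength short≢long₁ (<⇒≢ short<long₂) (<⇒≢ long₁<long₂) cover ,
    #ofLength D (inj₁ ∘ Inverse.to shortIndex↔)
      (λ { eq → Injection.injective (Inverse⇒Injection shortIndex↔) (inj₁-inj eq) }) (len≡ ∘ inj₁ ∘ Inverse.to shortIndex↔)
      (λ i eq → short i (trans (sym (len≡ i)) eq)) ,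
    #ofLength D (inj₂ ∘ inj₁) (λ { refl → refl }) (len≡ ∘ inj₂ ∘ inj₁)
      (λ i eq → long₁ i (trans (sym (len≡ i)) eq)) ,
    #ofLength D (inj₂ ∘ inj₂) (λ { refl → refl }) (len≡ ∘ inj₂ ∘ inj₂)
      (λ i eq → long₂ i (trans (sym (len≡ i)) eq)) ,
    (λ _ eq → eq) , (λ _ eq → eq) , (λ _ eq → eq)
    where
    inj₁-inj : ∀ {A B : Set} {x y : A} → inj₁ {B = B} x ≡ inj₁ y → x ≡ y
    inj₁-inj refl = refl
    lengths : ∀ i → len i ≡ shortLen ⊎ len i ≡ longLen₁ ⊎ len i ≡ longLen₂
    lengths (inj₁ _)        = inj₁ refl
    lengths (inj₂ (inj₁ _)) = inj₂ (inj₁ refl)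
    lengths (inj₂ (inj₂ _)) = inj₂ (inj₂ refl)
    cover : (O : Orbit f) → size O ≡ shortLen ⊎ size O ≡ longLen₁ ⊎ size O ≡ longLen₂
    cover O rewrite size-orbit D O | len≡ (orbitIndex D O) = lengths (orbitIndex D O)
    short : ∀ i → len i ≡ shortLen → ∃[ x ] inj₁ (Inverse.to shortIndex↔ x) ≡ i
    short (inj₁ i) _ = Inverse.from shortIndex↔ i , cong inj₁ (Inverse.strictlyInverseˡ shortIndex↔ i)
    short (inj₂ (inj₁ _)) eq = contradiction (sym eq) short≢long₁
    short (inj₂ (inj₂ _)) eq = contradiction (sym eq) (<⇒≢ short<long₂)
    long₁ : ∀ i → len i ≡ longLen₁ → ∃[ x ] inj₂ (inj₁ x) ≡ i
    long₁ (inj₁ _) eq = contradiction eq short≢long₁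
    long₁ (inj₂ (inj₁ i)) _ = i , refl
    long₁ (inj₂ (inj₂ _)) eq = contradiction (sym eq) (<⇒≢ long₁<long₂)
    long₂ : ∀ i → len i ≡ longLen₂ → ∃[ x ] inj₂ (inj₂ x) ≡ i
    long₂ (inj₁ _) eq = contradiction eq (<⇒≢ short<long₂)
    long₂ (inj₂ (inj₁ _)) eq = contradiction eq (<⇒≢ long₁<long₂)
    long₂ (inj₂ (inj₂ i)) _ = i , refl

  antichainDecomposition : CycleDecomposition ρ Index
  antichainDecomposition =
    conjugate toAntichain toAntichain-step toAntichain-injective toAntichain-surjective decomposition

  idealDecomposition : CycleDecomposition ρ̂ Index
  idealDecomposition = conjugate toIdeal toIdeal-step toIdeal-injective toIdeal-surjective decomposition

  -- Potentials cancel along a closed orbit.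
  sumAlong-rep : ∀ k (st Φ : State a′ b′ → ℕ) α β γ →
                 (∀ s → k * st s + Φ (step s) ≡ weight α β γ s + Φ s) → ∀ i →
                 k * sumAlong step st (rep i) (len i) ≡ α * (cycles i * b) + β * visits i + γ * visits i
  sumAlong-rep k st Φ α β γ local i = trans
    (+-cancelʳ-≡ (Φ (rep i)) _ _ (trans
      (cong (λ s → k * sumAlong step st (rep i) (len i) + Φ s) (sym (closed i)))
      (sumAlong-telescope step k st (weight α β γ) Φ local (rep i) (len i))))
    (path-weight (roundTrip i) α β γ)

  total-χ : ∀ O → let i = orbitIndex antichainDecomposition O in
            a * b * total O χ ≡ wWeight * (cycles i * b) + eventWeight * visits i + eventWeight * visits i
  total-χ O = trans
    (cong (a * b *_) (trans (total-orbit antichainDecomposition O χ)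
      (trans (cong (sumAlong ρ χ (toAntichain (rep i))) (size-orbit antichainDecomposition O))
        (sumAlong-conjugate toAntichain toAntichain-step χ (rep i) (len i)))))
    (sumAlong-rep (a * b) (χ ∘ toAntichain) χ-potential wWeight eventWeight eventWeight χ-local i)
    where
    i : Index
    i = orbitIndex antichainDecomposition O

  total-χ̂ : ∀ O → 2 * total O χ̂ ≡ #fence a b * size O
  total-χ̂ O = trans
    (cong (2 *_) (trans (total-orbit idealDecomposition O χ̂)
      (trans (cong (sumAlong ρ̂ χ̂ (toIdeal (rep i))) (size-orbit idealDecomposition O))
        (sumAlong-conjugate toIdeal toIdeal-step χ̂ (rep i) (len i)))))
    (trans (sumAlong-rep 2 (χ̂ ∘ toIdeal) χ̂-potential (#fence a b) a′ (2 * (a′ + suc b) + a′) χ̂-local i)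
      (trans (eq a′ b (cycles i * b) (visits i)) (cong (#fence a b *_) (sym (size-orbit idealDecomposition O)))))
    where
    i : Index
    i = orbitIndex idealDecomposition O
    eq : ∀ c b u v → (c + (1 + (c + 0)) + b) * u + c * v + (2 * (c + (1 + b)) + c) * v
                   ≡ (c + (1 + (c + 0)) + b) * (u + v + v)
    eq = solve-∀

  χ-homometric : Homometric ρ χ
  χ-homometric O₁ O₂ eq = *-cancelˡ-≡ _ _ (a * b) (trans (total-χ O₁) (trans
    (cong₂ (λ u v → wWeight * (u * b) + eventWeight * v + eventWeight * v) (proj₁ same) (proj₂ same))
    (sym (total-χ O₂))))
    where
    same = same-length (orbitIndex antichainDecomposition O₁) (orbitIndex antichainDecomposition O₂)
      (trans (sym (size-orbit antichainDecomposition O₁)) (trans eq (size-orbit antichainDecomposition O₂)))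

  χ̂-mesic : Mesic ρ̂ χ̂ ((+ #fence a b) /ℚ 2)
  χ̂-mesic O = fromℚᵘ-cong {mkℚᵘ (+ total O χ̂) (List.length (tail (Orbit.elements O)))} {mkℚᵘ (+ #fence a b) 1}
    (*≡* (trans (sym (ℤ.pos-* (total O χ̂) 2))
      (trans (cong +_ (trans (*-comm (total O χ̂) 2) (total-χ̂ O))) (ℤ.pos-* (#fence a b) (size O)))))

  -- Here q b + g becomes m a, and the `2 * g′ * ā` turns inside the blocks become a (2 b - 2 b̄),
  -- because b - b̄ = b̄ g′.
  longLen₁≡ : longLen₁ ≡ a * (2 * b ∸ 2 * b̄ + m) + g
  longLen₁≡ = sym (begin
    a * (2 * b ∸ 2 * b̄ + m) + g             ≡⟨ cong (λ u → a * (u + m) + g) gap ⟩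
    a * (2 * b̄ * g′ + m) + g                ≡⟨ eq a b̄ g′ m g ⟩
    m * a + (b̄ * a * g′ + b̄ * a * g′) + g   ≡⟨ cong₂ (λ u v → u + (v * g′ + v * g′) + g) qb+g≡ma āb≡b̄a ⟨
    q * b + g + (ā * b * g′ + ā * b * g′) + g ≡⟨ eq′ q b g ā g′ ⟩
    longLen₁                                ∎)
    where
    open ≡-Reasoning
    gap : 2 * b ∸ 2 * b̄ ≡ 2 * b̄ * g′
    gap = trans (cong (_∸ 2 * b̄) (trans (cong (2 *_) b≡) (split b̄ g′))) (m+n∸n≡m _ (2 * b̄))
      where
      split : ∀ c h → 2 * (c * (1 + h)) ≡ 2 * c * h + 2 * c
      split = solve-∀
    eq : ∀ a c h m g → a * (2 * c * h + m) + g ≡ m * a + (c * a * h + c * a * h) + g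
    eq = solve-∀
    eq′ : ∀ q b g c h → q * b + g + (c * b * h + c * b * h) + g ≡ (q + (h * c + h * c)) * b + g + g
    eq′ = solve-∀

  longLen₂≡ : longLen₂ ≡ a * (2 * b ∸ b̄ + m) + g
  longLen₂≡ = sym (begin
    a * (2 * b ∸ b̄ + m) + g                         ≡⟨ cong (λ u → a * (u + m) + g) gap ⟩
    a * (2 * b̄ * g′ + b̄ + m) + g                    ≡⟨ eq a b̄ g′ m g ⟩
    m * a + (b̄ * a * g′ + b̄ * a * g′ + b̄ * a) + g   ≡⟨ cong₂ (λ u v → u + (v * g′ + v * g′ + v) + g) qb+g≡ma āb≡b̄a ⟨
    q * b + g + (ā * b * g′ + ā * b * g′ + ā * b) + g ≡⟨ eq′ q b g ā g′ ⟩
    longLen₂                                        ∎)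
    where
    open ≡-Reasoning
    gap : 2 * b ∸ b̄ ≡ 2 * b̄ * g′ + b̄
    gap = trans (cong (_∸ b̄) (trans (cong (2 *_) b≡) (split b̄ g′))) (m+n∸n≡m _ b̄)
      where
      split : ∀ c h → 2 * (c * (1 + h)) ≡ 2 * c * h + c + c
      split = solve-∀
    eq : ∀ a c h m g → a * (2 * c * h + c + m) + g ≡ m * a + (c * a * h + c * a * h + c * a) + g
    eq = solve-∀
    eq′ : ∀ q b g c h → q * b + g + (c * b * h + c * b * h + c * b) + g ≡ (q + c + (h * c + h * c)) * b + g + g
    eq′ = solve-∀


castStructure : ∀ {X : Set} {f : X → X} {#𝒮 #ℳ #ℒ ℓ𝒮 ℓℳ ℓℒ #𝒮′ ℓ𝒮′ ℓℳ′ ℓℒ′} →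
                #𝒮 ≡ #𝒮′ → ℓ𝒮 ≡ ℓ𝒮′ → ℓℳ ≡ ℓℳ′ → ℓℒ ≡ ℓℒ′ →
                OrbitClasses f #𝒮 #ℳ #ℒ ℓ𝒮 ℓℳ ℓℒ → OrbitClasses f #𝒮′ #ℳ #ℒ ℓ𝒮′ ℓℳ′ ℓℒ′
castStructure refl refl refl refl structure = structure

-- The quotients, the gcd and the lcm enter only through equations, so that division stays out of
-- the argument.
rowmotionOrbits : ∀ a b g ā b̄ ℓ m q → 2 ≤ a → 1 ≤ b → a ≡ ā * g → b ≡ b̄ * g → ℓ ≡ ā * b →
  m * ā ≡ q * b̄ + 1 → 1 ≤ q → q ≤ ā → let open Fence a b in
  OrbitClasses ρ (ā * (g ∸ 1) ^ 2) q (ā ∸ q) ℓ (a * (2 * b ∸ 2 * b̄ + m) + g) (a * (2 * b ∸ b̄ + m) + g)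
  × OrbitClasses ρ̂ (ā * (g ∸ 1) ^ 2) q (ā ∸ q) ℓ (a * (2 * b ∸ 2 * b̄ + m) + g) (a * (2 * b ∸ b̄ + m) + g)
  × Homometric ρ χ
  × Mesic ρ̂ χ̂ ((+ #fence a b) /ℚ 2)
rowmotionOrbits (suc a′) (suc b′) zero ā b̄ ℓ m q 2≤a 1≤b a≡ _ _ _ _ _ =
  contradiction (trans a≡ (*-zeroʳ ā)) λ ()
rowmotionOrbits (suc a′) (suc b′) (suc g′) ā b̄ ℓ m q 2≤a 1≤b a≡ b≡ ℓ≡ mā≡ 1≤q q≤ā =
  restate (orbitStructure antichainDecomposition (λ _ → refl)) ,
  restate (orbitStructure idealDecomposition (λ _ → refl)) ,
  χ-homometric , χ̂-mesic
  where
  open FenceOrbits a′ b′ ā b̄ g′ m q a≡ b≡ mā≡ 1≤q q≤ā 2≤a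
  open Orbits a′ b′ ā b̄ g′ m q a≡ b≡ mā≡ 1≤q q≤ā using (shortLen; longLen₁; longLen₂)
  restate : ∀ {X : Set} {f : X → X} → OrbitClasses f (ā * (g′ * g′)) q (ā ∸ q) shortLen longLen₁ longLen₂ → _
  restate {f = f} = castStructure {f = f} (cong (λ n → ā * (g′ * n)) (sym (*-identityʳ g′)))
    (trans (+-identityʳ _) (trans (+-identityʳ _) (sym ℓ≡))) longLen₁≡ longLen₂≡

-- If `q` exceeded `ā`, then m - b̄ with q - ā would be a smaller solution.
smallest⇒≤ : ∀ {ā b̄ m q} → 1 ≤ b̄ → IsSmallest (λ k → 1 ≤ k × ∃[ r ] (1 ≤ r × k * ā ≡ r * b̄ + 1)) m →
             m * ā ≡ q * b̄ + 1 → q ≤ ā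
smallest⇒≤ {ā} {b̄} {m} {q} 1≤b̄ (_ , minimal) mā≡ = ≮⇒≥ λ ā<q → <⇒≱ (m∸b̄<m ā<q)
  (minimal (m ∸ b̄) (m<n⇒0<n∸m (b̄<m ā<q) , q ∸ ā , m<n⇒0<n∸m ā<q , (begin
    (m ∸ b̄) * ā              ≡⟨ *-distribʳ-∸ ā m b̄ ⟩
    m * ā ∸ b̄ * ā            ≡⟨ cong₂ _∸_ mā≡ (*-comm b̄ ā) ⟩
    q * b̄ + 1 ∸ ā * b̄        ≡⟨ cong (_∸ ā * b̄) (+-comm (q * b̄) 1) ⟩
    1 + q * b̄ ∸ ā * b̄        ≡⟨ +-∸-assoc 1 (*-monoˡ-≤ b̄ (<⇒≤ ā<q)) ⟩
    1 + (q * b̄ ∸ ā * b̄)      ≡⟨ +-comm 1 _ ⟩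
    q * b̄ ∸ ā * b̄ + 1        ≡⟨ cong (_+ 1) (*-distribʳ-∸ b̄ q ā) ⟨
    (q ∸ ā) * b̄ + 1          ∎)))
  where
  open ≡-Reasoning
  b̄<m : ā < q → b̄ < m
  b̄<m ā<q = *-cancelʳ-< ā b̄ m (subst₂ _<_ (*-comm ā b̄) (sym mā≡)
    (≤-<-trans (*-monoˡ-≤ b̄ (<⇒≤ ā<q)) (m<m+n (q * b̄) z<s)))
  m∸b̄<m : ā < q → m ∸ b̄ < m
  m∸b̄<m ā<q = ∸-monoʳ-< 1≤b̄ (<⇒≤ (b̄<m ā<q))

theorem4p4 :
  ∀ (a b : ℕ) → 2 ≤ a → (1≤b : 1 ≤ b) →
  let g = gcd a b
      ā = _/_ a g {{gcd-nonZero a 1≤b}}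
      b̄ = _/_ b g {{gcd-nonZero a 1≤b}}
      ℓ = lcm a b
      n = #fence a b
      open Fence a b
  in
  ∀ (m q : ℕ) →
  IsSmallest (λ k → 1 ≤ k × ∃[ r ] (1 ≤ r × k * ā ≡ r * b̄ + 1)) m →
  m * ā ≡ q * b̄ + 1 →
  let OrbitStructure : {X : Set} → (X → X) → Set₁
      OrbitStructure f =
        Σ[ 𝒮 ∈ Pred (Orbit f) 0ℓ ] Σ[ ℳ ∈ Pred (Orbit f) 0ℓ ] Σ[ ℒ ∈ Pred (Orbit f) 0ℓ ]
          IsPartitionByLength 𝒮 ℳ ℒ
          × (# 𝒮 ≐ ā * (g ∸ 1) ^ 2)
          × (# ℳ ≐ q)
          × (# ℒ ≐ ā ∸ q)
          × (∀ O → 𝒮 O → size O ≡ ℓ)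
          × (∀ O → ℳ O → size O ≡ a * (2 * b ∸ 2 * b̄ + m) + g)
          × (∀ O → ℒ O → size O ≡ a * (2 * b ∸ b̄ + m) + g)
  in
  OrbitStructure ρ × OrbitStructure ρ̂
  × Homometric ρ χ
  × Mesic ρ̂ χ̂ ((+ n) /ℚ 2)
theorem4p4 a b 2≤a 1≤b m q smallest@((_ , r , 1≤r , mā≡r) , _) mā≡ =
  rowmotionOrbits a b g ā b̄ (lcm a b) m q 2≤a 1≤b a≡ b≡ ℓ≡ mā≡
    (subst (1 ≤_) r≡q 1≤r) (smallest⇒≤ 1≤b̄ smallest mā≡)
  where
  instance
    _ : NonZero (gcd a b)
    _ = gcd-nonZero a 1≤b
  g ā b̄ : ℕ
  g = gcd a b
  ā = a / g
  b̄ = b / g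
  a≡ : a ≡ ā * g
  a≡ = sym (m/n*n≡m (gcd[m,n]∣m a b))
  b≡ : b ≡ b̄ * g
  b≡ = sym (m/n*n≡m (gcd[m,n]∣n a b))
  1≤b̄ : 1 ≤ b̄
  1≤b̄ = n≢0⇒n>0 λ b̄≡0 → <⇒≢ 1≤b (sym (trans b≡ (cong (_* g) b̄≡0)))
  -- Positivity is known for the witness `r` inside `IsSmallest`; `q` solves the same equation and
  -- inherits it.
  r≡q : r ≡ q
  r≡q = *-cancelʳ-≡ r q b̄ {{>-nonZero 1≤b̄}} (+-cancelʳ-≡ 1 _ _ (trans (sym mā≡r) mā≡))
  ℓ≡ : lcm a b ≡ ā * b
  ℓ≡ = *-cancelˡ-≡ (lcm a b) (ā * b) g (begin
    g * lcm a b     ≡⟨ gcd*lcm a b ⟩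
    a * b           ≡⟨ cong (_* b) a≡ ⟩
    ā * g * b       ≡⟨ eq ā g b ⟩
    g * (ā * b)     ∎)
    where
    open ≡-Reasoning
    eq : ∀ u v w → u * v * w ≡ v * (u * w)
    eq = solve-∀
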